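{- Let $X$ and $Y$ be finite sets and let $f:X \times Y \to \{ -1,1\}$ be a boolean function whose associated $X \times Y$ matrix $(f(x,y))_{x\in X, y \in Y}$ has rank $r$ over the reals. Then there exists a deterministic two-party communication protocol computing $f$ which uses $O(\sqrt{r} \cdot \log r)$ bits of communication, where the constant implied by the $O(\cdot)$ notation is absolute (independent of $f$, $X$, $Y$ and $r$).
   Context: In the two-party communication model, one player holds $x \in X$, the other holds $y \in Y$, and a deterministic protocol is a fixed sequence of bits exchanged (each bit determined by the sender's input and the previous messages) after which both players know $f(x,y)$; its complexity is the maximum number of bits exchanged over all inputs. The rank of $f$ means the real rank of its $X\times Y$ matrix. -}

module Defs where

open import Data.Nat using (ℕ; zero; suc)
open import Data.Fin using (Fin; zero; suc)
open import Data.Bool using (Bool; true; false)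
open import Data.Sign using (Sign)
open import Data.Rational using (ℚ; 0ℚ; 1ℚ; -_; _+_; _*_)
open import Data.Product using (Σ; _×_)
open import Relation.Binary.PropositionalEquality using (_≡_)
open import Relation.Nullary using (¬_)

sumFin : (k : ℕ) → (Fin k → ℚ) → ℚ
sumFin zero    g = 0ℚ
sumFin (suc k) g = g zero + sumFin k (λ i → g (suc i))

IndepRows : {m n : ℕ} → (Fin m → Fin n → ℚ) → (k : ℕ) → (Fin k → Fin m) → Set
IndepRows {m} {n} M k s =
  (c : Fin k → ℚ) →
  ((j : Fin n) → sumFin k (λ i → c i * M (s i) j) ≡ 0ℚ) →
  (i : Fin k) → c i ≡ 0ℚ

HasRank : {m n : ℕ} → (Fin m → Fin n → ℚ) → ℕ → Set
HasRank {m} M r =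
  Σ (Fin r → Fin m) (λ s → IndepRows M r s) ×
  ((s : Fin (suc r) → Fin m) → ¬ IndepRows M (suc r) s)

signToℚ : Sign → ℚ
signToℚ Sign.+ = 1ℚ
signToℚ Sign.- = - 1ℚ

matrixOf : {m n : ℕ} → (Fin m → Fin n → Sign) → Fin m → Fin n → ℚ
matrixOf f x y = signToℚ (f x y)

-- Deterministic two-party protocols as protocol trees: at each internal node
-- either Alice (holding x) or Bob (holding y) sends one bit computed from her/his
-- input; the position in the tree encodes the previous messages.
data Protocol (X Y A : Set) : Set where
  leaf  : A → Protocol X Y A
  alice : (X → Bool) → (Protocol X Y A) → (Protocol X Y A) → Protocol X Y A
  bob   : (Y → Bool) → (Protocol X Y A) → (Protocol X Y A) → Protocol X Y A

run : {X Y A : Set} → Protocol X Y A → X → Y → A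
run (leaf a)      x y = a
run (alice g p q) x y with g x
... | true  = run p x y
... | false = run q x y
run (bob h p q)   x y with h y
... | true  = run p x y
... | false = run q x y

bits : {X Y A : Set} → Protocol X Y A → X → Y → ℕ
bits (leaf a)      x y = zero
bits (alice g p q) x y with g x
... | true  = suc (bits p x y)
... | false = suc (bits q x y)
bits (bob h p q)   x y with h y
... | true  = suc (bits p x y)
... | false = suc (bits q x y)

{-# OPTIONS --safe #-}
-- Multiply each entry of the sign matrix f by a weight giving the + entries and the − entries the same total mass.
-- If f has rank r, then Gram–Schmidt in the space weighted by the row marginals writes f as a matrix of inner
-- products ⟨u_x , v_y⟩ with ‖v_y‖² at most the total mass W and ‖u_x‖² = O(r / W) outside half of the mass
-- (Markov), so Grothendieck's inequality yields a rectangle on which the weighted sum of f is Ω(1 / √r) of the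
-- mass.  Passing to such rectangles repeatedly leads to a rectangle of density 2^{−O(√r log r)} where the
-- minority sign has proportion at most 1 / 8(r + 1); since r + 1 rows determine all columns, it contains a
-- monochromatic rectangle of comparable size.
--
-- Subtracting one of its rows from f gives a matrix vanishing on that rectangle, so the bands of rows and of columns
-- through it have ranks adding up to at most r, and one of them has rank at most r / 2.  Peeling off such bands until
-- nothing is left, the players announce the first band of rows, respectively of columns, that applies to them, and
-- continue in the earlier one with half the rank.  The costs of the levels form a geometric series.
module Submission where

-- Low rank gives a factorisation of `f` into short vectors, but no rectangle. Grothendieck's
-- inequality makes the passage: if every rectangle has small signed mass, no matrix of inner
-- products of short vectors correlates with the signed weights, whereas `f` is such a matrix and
-- correlates with them perfectly.
--
-- The rank has to halve exactly from level to level. It is therefore measured modulo matrices with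
-- constant columns: subtracting a row then costs nothing, and at the bottom `f` depends on the
-- column alone.
--
-- The number of peeled bands must not depend on m and n. A sign matrix of rank r has at most 2^r
-- distinct rows and columns, so about r times the inverse density many bands suffice, and
-- announcing one of them takes O(√r log r) bits.
--
-- All arithmetic is rational or natural: roots are approximated within a factor of two, the best
-- rectangle is replaced by an exhaustive search, and the final bound is one on the square of the
-- cost.

-- Ordered-field arithmetic of the rationals and the embedding of the naturals.

module Rationals where
  open import Level using (0ℓ)
  open import Data.Empty using (⊥-elim)
  open import Data.Sum using (_⊎_; inj₁; inj₂)
  open import Data.Product using (Σ; _,_)
  open import Data.Nat as ℕ using (ℕ; zero; suc)
  import Data.Nat.Properties as ℕ
  open import Relation.Binary.Definitions using (tri<; tri≈; tri>)
  open import Data.Rational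
  open import Data.Rational.Properties
  open import Relation.Nullary using (yes; no)
  open import Relation.Nullary.Decidable using (dec⇒maybe)
  open import Relation.Binary.PropositionalEquality
  open import Tactic.RingSolver.Core.AlmostCommutativeRing using (AlmostCommutativeRing; fromCommutativeRing)
  open import Tactic.RingSolver using (solve-∀)

  ℚ-ring : AlmostCommutativeRing 0ℓ 0ℓ
  ℚ-ring = fromCommutativeRing +-*-commutativeRing (λ x → dec⇒maybe (0ℚ ≟ x))

  2ℚ 3ℚ 4ℚ 16ℚ 48ℚ 96ℚ : ℚ
  2ℚ = 1ℚ + 1ℚ
  3ℚ = 2ℚ + 1ℚ
  4ℚ = 2ℚ + 2ℚ
  16ℚ = 4ℚ * 4ℚ
  48ℚ = 16ℚ * 3ℚ
  96ℚ = 48ℚ + 48ℚ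

  private
    add-diff : ∀ p q → p + (q - p) ≡ q
    add-diff = solve-∀ ℚ-ring

    diff-self : ∀ p → p - p ≡ 0ℚ
    diff-self = solve-∀ ℚ-ring

    diff-zero : ∀ p → p - 0ℚ ≡ p
    diff-zero = solve-∀ ℚ-ring

  -- The device behind the nonlinear inequalities below: the difference of the two sides is
  -- exhibited as a sum of products of nonnegative factors, and the ring solver checks the identity.
  ≤-gap : ∀ {p q d} → 0ℚ ≤ d → p + d ≡ q → p ≤ q
  ≤-gap {p} {q} {d} 0≤d e = subst₂ _≤_ (+-identityʳ p) e (+-monoʳ-≤ p 0≤d)

  gap : ∀ {p q} → p ≤ q → 0ℚ ≤ q - p
  gap {p} {q} h = subst (_≤ q - p) (diff-self p) (+-monoˡ-≤ (- p) h)

  0≤+ : ∀ {p q} → 0ℚ ≤ p → 0ℚ ≤ q → 0ℚ ≤ p + q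
  0≤+ {p} {q} a b = subst (_≤ p + q) (+-identityʳ 0ℚ) (+-mono-≤ a b)

  0≤* : ∀ {p q} → 0ℚ ≤ p → 0ℚ ≤ q → 0ℚ ≤ p * q
  0≤* {p} {q} a b = subst (_≤ p * q) (*-zeroʳ p) (*-monoˡ-≤-nonNeg p {{nonNegative a}} b)

  0<* : ∀ {p q} → 0ℚ < p → 0ℚ < q → 0ℚ < p * q
  0<* {p} {q} a b = positive⁻¹ (p * q) {{pos*pos⇒pos p {{positive a}} q {{positive b}}}}

  *-monoˡ : ∀ {r p q} → 0ℚ ≤ r → p ≤ q → r * p ≤ r * q
  *-monoˡ {r} h = *-monoˡ-≤-nonNeg r {{nonNegative h}}

  *-mono : ∀ {p q r s} → 0ℚ ≤ p → p ≤ q → 0ℚ ≤ r → r ≤ s → p * r ≤ q * s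
  *-mono {p} {q} {r} {s} 0≤p p≤q 0≤r r≤s = ≤-trans (*-monoˡ 0≤p r≤s)
    (*-monoʳ-≤-nonNeg s {{nonNegative (≤-trans 0≤r r≤s)}} p≤q)

  *-cancelˡ : ∀ {r p q} → 0ℚ < r → r * p ≤ r * q → p ≤ q
  *-cancelˡ {r} h = *-cancelˡ-≤-pos r {{positive h}}

  0≤1 : 0ℚ ≤ 1ℚ
  0≤1 = nonNegative⁻¹ 1ℚ

  0<1 : 0ℚ < 1ℚ
  0<1 = positive⁻¹ 1ℚ

  0≤sq : ∀ p → 0ℚ ≤ p * p
  0≤sq p with ≤-total 0ℚ p
  ... | inj₁ h = 0≤* h h
  ... | inj₂ h = subst (0ℚ ≤_) (neg-sq p) (0≤* (neg-antimono-≤ h) (neg-antimono-≤ h))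
    where
    neg-sq : ∀ p → (- p) * (- p) ≡ p * p
    neg-sq = solve-∀ ℚ-ring

  ≤-or-> : ∀ p q → p ≤ q ⊎ q < p
  ≤-or-> p q with p ≤? q
  ... | yes h = inj₁ h
  ... | no h  = inj₂ (≰⇒> h)

  ≢0⇒0<sq : ∀ {p} → p ≢ 0ℚ → 0ℚ < p * p
  ≢0⇒0<sq {p} p≢0 with <-cmp 0ℚ p
  ... | tri< h _ _ = 0<* h h
  ... | tri≈ _ h _ = ⊥-elim (p≢0 (sym h))
  ... | tri> _ _ h = subst (0ℚ <_) (neg-sq p) (0<* (neg-antimono-< h) (neg-antimono-< h))
    where
    neg-sq : ∀ p → (- p) * (- p) ≡ p * p
    neg-sq = solve-∀ ℚ-ring

  sq-cancel-≤ : ∀ {p q} → 0ℚ ≤ q → p * p ≤ q * q → p ≤ q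
  sq-cancel-≤ {p} {q} 0≤q h with ≤-or-> p q
  ... | inj₁ p≤q = p≤q
  ... | inj₂ q<p = ⊥-elim (<-irrefl refl (<-≤-trans lt h))
    where
    lt : q * q < p * p
    lt = ≤-<-trans (*-monoˡ 0≤q (<⇒≤ q<p)) (*-monoˡ-<-pos p {{positive (≤-<-trans 0≤q q<p)}} q<p)

  inverse : ∀ p → p ≢ 0ℚ → Σ ℚ λ i → i * p ≡ 1ℚ
  inverse p p≢0 = (1/ p) {{≢-nonZero p≢0}} , *-inverseˡ p {{≢-nonZero p≢0}}

  inverse-pos : ∀ {p i} → 0ℚ < p → i * p ≡ 1ℚ → 0ℚ < i
  inverse-pos {p} {i} 0<p e with ≤-or-> i 0ℚ
  ... | inj₂ h = h
  ... | inj₁ h = ⊥-elim (<-irrefl refl (<-≤-trans 0<1 (subst₂ _≤_ e (*-zeroˡ p)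
                   (*-monoʳ-≤-nonNeg p {{nonNegative (<⇒≤ 0<p)}} h))))

  ι : ℕ → ℚ
  ι zero    = 0ℚ
  ι (suc n) = 1ℚ + ι n

  ι-+ : ∀ m n → ι (m ℕ.+ n) ≡ ι m + ι n
  ι-+ zero    n = sym (+-identityˡ (ι n))
  ι-+ (suc m) n = trans (cong (1ℚ +_) (ι-+ m n)) (sym (+-assoc 1ℚ (ι m) (ι n)))

  ι-* : ∀ m n → ι (m ℕ.* n) ≡ ι m * ι n
  ι-* zero    n = sym (*-zeroˡ (ι n))
  ι-* (suc m) n = trans (ι-+ n (m ℕ.* n)) (trans (cong (ι n +_) (ι-* m n)) (expand (ι m) (ι n)))
    where
    expand : ∀ a b → b + a * b ≡ (1ℚ + a) * b
    expand = solve-∀ ℚ-ring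

  0≤ι : ∀ n → 0ℚ ≤ ι n
  0≤ι zero    = ≤-refl
  0≤ι (suc n) = 0≤+ 0≤1 (0≤ι n)

  0<ι : ∀ n → 0ℚ < ι (suc n)
  0<ι n = <-≤-trans 0<1 (≤-gap (0≤ι n) refl)

  ι-mono : ∀ {m n} → m ℕ.≤ n → ι m ≤ ι n
  ι-mono {n = n} ℕ.z≤n   = 0≤ι n
  ι-mono (ℕ.s≤s h) = +-monoʳ-≤ 1ℚ (ι-mono h)

  ι-mono-< : ∀ {m n} → m ℕ.< n → ι m < ι n
  ι-mono-< {m} h = <-≤-trans (subst (_< 1ℚ + ι m) (+-identityˡ (ι m)) (+-monoˡ-< (ι m) 0<1)) (ι-mono h)

  ι-cancel-≤ : ∀ {m n} → ι m ≤ ι n → m ℕ.≤ n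
  ι-cancel-≤ {m} {n} h with m ℕ.≤? n
  ... | yes m≤n = m≤n
  ... | no m≰n  = ⊥-elim (<-irrefl refl (<-≤-trans (ι-mono-< (ℕ.≰⇒> m≰n)) h))

  ι-pos : ∀ {n} → 1 ℕ.≤ n → 0ℚ < ι n
  ι-pos {suc n} _ = 0<ι n

-- Finite sums of rationals over lists.

module ListSums where
  open import Data.Bool using (Bool; true; false; not)
  open import Data.List using (List; []; _∷_; map; _++_; filterᵇ)
  open import Data.List.Relation.Unary.Any using (here; there)
  open import Data.List.Membership.Propositional using (_∈_)
  open import Data.Nat as ℕ using ()
  open import Data.Rational
  open import Data.Rational.Properties
  open import Relation.Binary.PropositionalEquality
  open import Tactic.RingSolver using (solve-∀)
  open Rationals

  private variable
    I K : Set

  sumL : List I → (I → ℚ) → ℚ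
  sumL []       g = 0ℚ
  sumL (i ∷ is) g = g i + sumL is g

  sum-cong : (is : List I) {g h : I → ℚ} → (∀ i → i ∈ is → g i ≡ h i) → sumL is g ≡ sumL is h
  sum-cong []       e = refl
  sum-cong (i ∷ is) e = cong₂ _+_ (e i (here refl)) (sum-cong is (λ j m → e j (there m)))

  sum-ext : (is : List I) {g h : I → ℚ} → (∀ i → g i ≡ h i) → sumL is g ≡ sumL is h
  sum-ext is e = sum-cong is (λ i _ → e i)

  sum-0 : (is : List I) → sumL is (λ _ → 0ℚ) ≡ 0ℚ
  sum-0 []       = refl
  sum-0 (i ∷ is) = trans (+-identityˡ _) (sum-0 is)

  sum-mono : (is : List I) {g h : I → ℚ} → (∀ i → i ∈ is → g i ≤ h i) → sumL is g ≤ sumL is h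
  sum-mono []       e = ≤-refl
  sum-mono (i ∷ is) e = +-mono-≤ (e i (here refl)) (sum-mono is (λ j m → e j (there m)))

  sum-nonneg : (is : List I) {g : I → ℚ} → (∀ i → i ∈ is → 0ℚ ≤ g i) → 0ℚ ≤ sumL is g
  sum-nonneg is {g} e = subst (_≤ sumL is g) (sum-0 is) (sum-mono is e)

  sum-+ : (is : List I) (g h : I → ℚ) → sumL is (λ i → g i + h i) ≡ sumL is g + sumL is h
  sum-+ []       g h = refl
  sum-+ (i ∷ is) g h = trans (cong (g i + h i +_) (sum-+ is g h)) (swap (g i) (h i) (sumL is g) (sumL is h))
    where
    swap : ∀ a b c d → a + b + (c + d) ≡ a + c + (b + d)
    swap = solve-∀ ℚ-ring

  sum-*ˡ : (is : List I) (c : ℚ) (g : I → ℚ) → sumL is (λ i → c * g i) ≡ c * sumL is g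
  sum-*ˡ []       c g = sym (*-zeroʳ c)
  sum-*ˡ (i ∷ is) c g = trans (cong (c * g i +_) (sum-*ˡ is c g)) (sym (*-distribˡ-+ c (g i) (sumL is g)))

  sum-*ʳ : (is : List I) (c : ℚ) (g : I → ℚ) → sumL is (λ i → g i * c) ≡ sumL is g * c
  sum-*ʳ is c g = trans (sum-ext is (λ i → *-comm (g i) c)) (trans (sum-*ˡ is c g) (*-comm c _))

  sum-swap : (is : List I) (js : List K) (g : I → K → ℚ) →
             sumL is (λ i → sumL js (g i)) ≡ sumL js (λ j → sumL is (λ i → g i j))
  sum-swap []       js g = sym (sum-0 js)
  sum-swap (i ∷ is) js g = trans (cong (sumL js (g i) +_) (sum-swap is js g))
    (sym (sum-+ js (g i) (λ j → sumL is (λ i → g i j))))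

  sum-++ : (is js : List I) (g : I → ℚ) → sumL (is ++ js) g ≡ sumL is g + sumL js g
  sum-++ []       js g = sym (+-identityˡ _)
  sum-++ (i ∷ is) js g = trans (cong (g i +_) (sum-++ is js g)) (sym (+-assoc (g i) _ _))

  sum-map : (φ : I → K) (is : List I) (g : K → ℚ) → sumL (map φ is) g ≡ sumL is (λ i → g (φ i))
  sum-map φ []       g = refl
  sum-map φ (i ∷ is) g = cong (g (φ i) +_) (sum-map φ is g)

  sum-split : (P : I → Bool) (is : List I) (g : I → ℚ) →
              sumL is g ≡ sumL (filterᵇ P is) g + sumL (filterᵇ (λ i → not (P i)) is) g
  sum-split P []       g = refl
  sum-split P (i ∷ is) g with P i
  ... | true  = trans (cong (g i +_) (sum-split P is g)) (sym (+-assoc (g i) _ _))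
  ... | false = trans (cong (g i +_) (sum-split P is g)) (swap (g i) (sumL (filterᵇ P is) g)
    (sumL (filterᵇ (λ i → not (P i)) is) g))
    where
    swap : ∀ a b c → a + (b + c) ≡ b + (a + c)
    swap = solve-∀ ℚ-ring

  sum-≡0 : (is : List I) {g : I → ℚ} → (∀ i → i ∈ is → 0ℚ ≤ g i) → sumL is g ≡ 0ℚ →
           ∀ i → i ∈ is → g i ≡ 0ℚ
  sum-≡0 (j ∷ is) {g} 0≤g e i m = ≤-antisym (upper m) (0≤g i m)
    where
    tail≥0 = sum-nonneg is (λ k n → 0≤g k (there n))
    upper : ∀ {i} → i ∈ j ∷ is → g i ≤ 0ℚ
    upper (here refl) = subst (g j ≤_) e (≤-gap tail≥0 refl)
    upper {i} (there n)   = ≤-reflexive (sum-≡0 is (λ k n → 0≤g k (there n))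
      (≤-antisym (subst (sumL is g ≤_) e (≤-gap (0≤g j (here refl)) (+-comm _ (g j)))) tail≥0) i n)

-- Grothendieck's inequality over the rationals.

module Grothendieck where
  open import Data.Bool using (Bool; true; false)
  open import Data.Sum using (inj₁; inj₂)
  open import Data.Product using (Σ; _×_; _,_; proj₁; proj₂)
  open import Data.List using (List; []; _∷_; map; _++_; length)
  open import Data.List.Relation.Unary.Any using (here; there)
  open import Data.List.Membership.Propositional using (_∈_)
  open import Data.Nat as ℕ using (ℕ; zero; suc)
  open import Data.Rational
  open import Data.Rational.Properties
  open import Relation.Binary.PropositionalEquality hiding (J)
  open import Tactic.RingSolver using (solve-∀)
  open Rationals
  open ListSums

  private variable
    I X Y : Set

  pair : List X → List Y → (X → Y → ℚ) → (X → Y → ℚ) → ℚ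
  pair xs ys B Q = sumL xs (λ x → sumL ys (λ y → B x y * Q x y))

  pair-cong : (xs : List X) (ys : List Y) (B : X → Y → ℚ) {Q R : X → Y → ℚ} →
              (∀ x y → x ∈ xs → y ∈ ys → Q x y ≡ R x y) → pair xs ys B Q ≡ pair xs ys B R
  pair-cong xs ys B e = sum-cong xs (λ x m → sum-cong ys (λ y n → cong (B x y *_) (e x y m n)))

  pair-+ : (xs : List X) (ys : List Y) (B Q R : X → Y → ℚ) →
           pair xs ys B (λ x y → Q x y + R x y) ≡ pair xs ys B Q + pair xs ys B R
  pair-+ xs ys B Q R = trans
    (sum-ext xs (λ x → trans (sum-ext ys (λ y → *-distribˡ-+ (B x y) (Q x y) (R x y))) (sum-+ ys _ _)))
    (sum-+ xs _ _)

  pair-* : (xs : List X) (ys : List Y) (B : X → Y → ℚ) (c : ℚ) (Q : X → Y → ℚ) →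
           pair xs ys B (λ x y → c * Q x y) ≡ c * pair xs ys B Q
  pair-* xs ys B c Q = trans
    (sum-ext xs (λ x → trans (sum-ext ys (λ y → comm (B x y) c (Q x y))) (sum-*ˡ ys c _)))
    (sum-*ˡ xs c _)
    where
    comm : ∀ a b c → a * (b * c) ≡ b * (a * c)
    comm = solve-∀ ℚ-ring

  pair-sum : (xs : List X) (ys : List Y) (B : X → Y → ℚ) (is : List I) (Q : I → X → Y → ℚ) →
             pair xs ys B (λ x y → sumL is (λ i → Q i x y)) ≡ sumL is (λ i → pair xs ys B (Q i))
  pair-sum xs ys B is Q = trans
    (sum-ext xs (λ x → trans (sum-ext ys (λ y → sym (sum-*ˡ is (B x y) _))) (sum-swap ys is _)))
    (sum-swap xs is _)

  pair-swap : (xs : List X) (ys : List Y) (B Q : X → Y → ℚ) →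
              pair xs ys B Q ≡ pair ys xs (λ y x → B x y) (λ y x → Q x y)
  pair-swap xs ys B Q = sum-swap xs ys _

  sgn : Bool → ℚ
  sgn true  = 1ℚ
  sgn false = - 1ℚ

  -- The sign makes `sgn b * g` equal to |g|. It depends on `g` alone and so serves every `a`
  -- bounded by `s`.
  round-scalar : ∀ g → Σ Bool λ b → ∀ {a s} → a ≤ s → - a ≤ s → a * g ≤ s * (sgn b * g)
  round-scalar g with ≤-total 0ℚ g
  ... | inj₁ 0≤g = true , λ {a} {s} a≤s -a≤s → ≤-gap (0≤* (gap a≤s) 0≤g) (id₁ a s g)
    where
    id₁ : ∀ a s g → a * g + (s - a) * g ≡ s * (1ℚ * g)
    id₁ = solve-∀ ℚ-ring
  ... | inj₂ g≤0 = false , λ {a} {s} a≤s -a≤s → ≤-gap (0≤* (gap -a≤s) (neg-antimono-≤ g≤0)) (id₂ a s g)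
    where
    id₂ : ∀ a s g → a * g + (s - (- a)) * (- g) ≡ s * ((- 1ℚ) * g)
    id₂ = solve-∀ ℚ-ring

  -- A bilinear form is linear in each `a x` separately, so over a box it is largest at a vertex:
  -- every `a x` moves to `s` or `- s` according to the sign of its coefficient `g x`.
  round-left : (xs : List X) (ys : List Y) (B : X → Y → ℚ) (a : X → ℚ) (b : Y → ℚ) (s : ℚ) →
               (∀ x → x ∈ xs → (a x ≤ s) × (- a x ≤ s)) →
               Σ (X → Bool) λ σ → pair xs ys B (λ x y → a x * b y) ≤ s * pair xs ys B (λ x y → sgn (σ x) * b y)
  round-left {X = X} xs ys B a b s bd = σ ,
    subst₂ _≤_ (sym (factor a)) (trans (sum-*ˡ xs s (λ x → sgn (σ x) * g x))
      (cong (s *_) (sym (factor (λ x → sgn (σ x))))))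
      (sum-mono xs (λ x m → proj₂ (round-scalar (g x)) (proj₁ (bd x m)) (proj₂ (bd x m))))
    where
    g = λ x → sumL ys (λ y → B x y * b y)
    σ : X → Bool
    σ x = proj₁ (round-scalar (g x))
    comm : ∀ a b c → a * (b * c) ≡ b * (a * c)
    comm = solve-∀ ℚ-ring
    factor : ∀ a → pair xs ys B (λ x y → a x * b y) ≡ sumL xs (λ x → a x * g x)
    factor a = sum-ext xs (λ x → trans (sum-ext ys (λ y → comm (B x y) (a x) (b y)))
      (sum-*ˡ ys (a x) (λ y → B x y * b y)))

  SignBound : List X → List Y → (X → Y → ℚ) → ℚ → Set
  SignBound {X} {Y} xs ys B τ = (σ : X → Bool) (ρ : Y → Bool) → pair xs ys B (λ x y → sgn (σ x) * sgn (ρ y)) ≤ τ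

  box-bound : (xs : List X) (ys : List Y) (B : X → Y → ℚ) {τ : ℚ} → SignBound xs ys B τ →
              (a : X → ℚ) (b : Y → ℚ) (s t : ℚ) → 0ℚ ≤ s → 0ℚ ≤ t →
              (∀ x → x ∈ xs → (a x ≤ s) × (- a x ≤ s)) → (∀ y → y ∈ ys → (b y ≤ t) × (- b y ≤ t)) →
              pair xs ys B (λ x y → a x * b y) ≤ s * (t * τ)
  box-bound {X = X} {Y = Y} xs ys B bound a b s t 0≤s 0≤t ba bb =
    ≤-trans (proj₂ left) (*-monoˡ 0≤s (≤-trans (≤-reflexive (flip (λ x → sgn (σ x)) b))
      (≤-trans (proj₂ right) (*-monoˡ 0≤t
        (≤-trans (≤-reflexive (sym (flip (λ x → sgn (σ x)) (λ y → sgn (ρ y))))) (bound σ ρ))))))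
    where
    flip : (a : X → ℚ) (b : Y → ℚ) → pair xs ys B (λ x y → a x * b y) ≡ pair ys xs (λ y x → B x y) (λ y x → b y * a x)
    flip a b = trans (pair-swap xs ys B (λ x y → a x * b y))
      (pair-cong ys xs (λ y x → B x y) (λ y x _ _ → *-comm (a x) (b y)))
    left  = round-left xs ys B a b s ba
    σ     = proj₁ left
    right = round-left ys xs (λ y x → B x y) b (λ x → sgn (σ x)) t bb
    ρ     = proj₁ right

  absolute : ∀ p → Σ ℚ λ t → (0ℚ ≤ t) × (t * t ≡ p * p) × (p ≤ t) × (- p ≤ t)
  absolute p with ≤-total 0ℚ p
  ... | inj₁ 0≤p = p , 0≤p , refl , ≤-refl , ≤-trans (neg-antimono-≤ 0≤p) 0≤p
  ... | inj₂ p≤0 = - p , neg-antimono-≤ p≤0 , neg-sq p , ≤-trans p≤0 (neg-antimono-≤ p≤0) , ≤-refl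
    where
    neg-sq : ∀ p → (- p) * (- p) ≡ p * p
    neg-sq = solve-∀ ℚ-ring

  -- `box-bound` needs a bound on the entries, while truncation bounds their squares by a number `A`
  -- whose root may be irrational. The largest absolute value of an entry is rational and will do.
  uniform-bound : (xs : List X) (a : X → ℚ) (A : ℚ) → 0ℚ ≤ A → (∀ x → x ∈ xs → a x * a x ≤ A) →
                  Σ ℚ λ s → (0ℚ ≤ s) × (s * s ≤ A) × (∀ x → x ∈ xs → (a x ≤ s) × (- a x ≤ s))
  uniform-bound []       a A 0≤A h = 0ℚ , ≤-refl , 0≤A , λ _ ()
  uniform-bound (x ∷ xs) a A 0≤A h
    with uniform-bound xs a A 0≤A (λ z m → h z (there m)) | absolute (a x)
  ... | s , 0≤s , ss , bd | t , 0≤t , tt , p≤t , -p≤t with ≤-total s t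
  ... | inj₁ s≤t = t , 0≤t , ≤-trans (≤-reflexive tt) (h x (here refl)) ,
                   λ { z (here refl) → p≤t , -p≤t
                     ; z (there m) → ≤-trans (proj₁ (bd z m)) s≤t , ≤-trans (proj₂ (bd z m)) s≤t }
  ... | inj₂ t≤s = s , 0≤s , ss ,
                   λ { z (here refl) → ≤-trans p≤t t≤s , ≤-trans -p≤t t≤s
                     ; z (there m) → bd z m }

  pow2 : ℕ → ℚ
  pow2 zero    = 1ℚ
  pow2 (suc k) = pow2 k + pow2 k

  0<pow2 : ∀ k → 0ℚ < pow2 k
  0<pow2 zero    = 0<1
  0<pow2 (suc k) = subst (_< pow2 k + pow2 k) (+-identityʳ 0ℚ) (+-mono-< (0<pow2 k) (0<pow2 k))

  cube : ℕ → List (List Bool)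
  cube zero    = [] ∷ []
  cube (suc d) = map (true ∷_) (cube d) ++ map (false ∷_) (cube d)

  sum-cube : ∀ d (F : List Bool → ℚ) →
             sumL (cube (suc d)) F ≡ sumL (cube d) (λ ε → F (true ∷ ε) + F (false ∷ ε))
  sum-cube d F = trans (sum-++ (map (true ∷_) (cube d)) _ F)
    (trans (cong₂ _+_ (sum-map (true ∷_) (cube d) F) (sum-map (false ∷_) (cube d) F)) (sym (sum-+ (cube d) _ _)))

  sum-cube-const : ∀ d c → sumL (cube d) (λ _ → c) ≡ pow2 d * c
  sum-cube-const zero    c = trans (+-identityʳ c) (sym (*-identityˡ c))
  sum-cube-const (suc d) c = trans (sum-cube d (λ _ → c)) (trans (sum-+ (cube d) _ _)
    (trans (cong₂ _+_ (sum-cube-const d c) (sum-cube-const d c)) (sym (*-distribʳ-+ c (pow2 d) (pow2 d)))))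

  rademacher : List I → (I → ℚ) → List Bool → ℚ
  rademacher (i ∷ is) u (b ∷ ε) = sgn b * u i + rademacher is u ε
  rademacher _        u _       = 0ℚ

  -- Adding up the two choices of the first sign cancels the cross terms. The power of two is there
  -- because sums over the cube are not normalised.
  rademacher-2 : (is : List I) (u v : I → ℚ) →
                 sumL (cube (length is)) (λ ε → rademacher is u ε * rademacher is v ε) ≡
                 pow2 (length is) * sumL is (λ i → u i * v i)
  rademacher-2 []       u v = refl
  rademacher-2 (i ∷ is) u v =
    trans (sum-cube d _)
    (trans (sum-ext (cube d) (λ ε → square (u i) (v i) (rademacher is u ε) (rademacher is v ε)))
    (trans (sum-+ (cube d) _ _)
    (trans (cong₂ _+_ (sum-cube-const d _) (trans (sum-*ˡ (cube d) 2ℚ _) (cong (2ℚ *_) (rademacher-2 is u v))))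
           (collect (pow2 d) (u i) (v i) (sumL is (λ i → u i * v i))))))
    where
    d = length is
    square : ∀ a b p q → (1ℚ * a + p) * (1ℚ * b + q) + ((- 1ℚ) * a + p) * ((- 1ℚ) * b + q) ≡
                         2ℚ * (a * b) + 2ℚ * (p * q)
    square = solve-∀ ℚ-ring
    collect : ∀ p a b s → p * (2ℚ * (a * b)) + 2ℚ * (p * s) ≡ (p + p) * (a * b + s)
    collect = solve-∀ ℚ-ring

  -- Averaging (±a + R)^4 over the sign leaves a^4 + 6a²R² + R^4. With second moment `s` and the
  -- induction hypothesis this is at most a^4 + 6a²s + 3s², which falls short of 3(a² + s)² by 2a^4.
  rademacher-4 : (is : List I) (u : I → ℚ) →
                 let s = sumL is (λ i → u i * u i) in
                 sumL (cube (length is)) (λ ε → let r = rademacher is u ε in r * r * (r * r)) ≤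
                 3ℚ * (pow2 (length is) * (s * s))
  rademacher-4 []       u = nonNegative⁻¹ 0ℚ
  rademacher-4 (i ∷ is) u = ≤-trans (≤-reflexive expand) (≤-trans
      (+-mono-≤ (≤-refl {2ℚ * (p * (a * a * (a * a))) + 12ℚ * (a * a * (p * s))}) (*-monoˡ 0≤2 (rademacher-4 is u)))
      (≤-gap (0≤* 0≤4 (0≤* (<⇒≤ (0<pow2 d)) (0≤sq (a * a)))) (collect p a s)))
    where
    d = length is
    p = pow2 d
    a = u i
    s = sumL is (λ i → u i * u i)
    12ℚ = 4ℚ * 3ℚ
    0≤2 : 0ℚ ≤ 2ℚ
    0≤2 = nonNegative⁻¹ 2ℚ
    0≤4 : 0ℚ ≤ 4ℚ
    0≤4 = nonNegative⁻¹ 4ℚ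
    R = rademacher is u
    Q = sumL (cube d) (λ ε → R ε * R ε * (R ε * R ε))
    fourth : ∀ a r → (1ℚ * a + r) * (1ℚ * a + r) * ((1ℚ * a + r) * (1ℚ * a + r)) +
                     ((- 1ℚ) * a + r) * ((- 1ℚ) * a + r) * (((- 1ℚ) * a + r) * ((- 1ℚ) * a + r)) ≡
                     2ℚ * (a * a * (a * a)) + 4ℚ * 3ℚ * (a * a) * (r * r) + 2ℚ * (r * r * (r * r))
    fourth = solve-∀ ℚ-ring
    arrange : ∀ p a s q → p * (2ℚ * (a * a * (a * a))) + 4ℚ * 3ℚ * (a * a) * (p * s) + 2ℚ * q ≡
                          2ℚ * (p * (a * a * (a * a))) + 4ℚ * 3ℚ * (a * a * (p * s)) + 2ℚ * q
    arrange = solve-∀ ℚ-ring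
    expand : sumL (cube (suc d)) (λ ε → let r = rademacher (i ∷ is) u ε in r * r * (r * r)) ≡
             2ℚ * (p * (a * a * (a * a))) + 12ℚ * (a * a * (p * s)) + 2ℚ * Q
    expand = trans (sum-cube d _) (trans (sum-ext (cube d) (λ ε → fourth a (R ε)))
      (trans (sum-+ (cube d) _ _) (trans (cong₂ _+_
        (trans (sum-+ (cube d) _ _) (cong₂ _+_ (sum-cube-const d _)
          (trans (sum-*ˡ (cube d) (4ℚ * 3ℚ * (a * a)) (λ ε → R ε * R ε))
            (cong (4ℚ * 3ℚ * (a * a) *_) (rademacher-2 is u u)))))
        (sum-*ˡ (cube d) 2ℚ (λ ε → R ε * R ε * (R ε * R ε)))) (arrange p a s Q))))
    collect : ∀ p a s → 2ℚ * (p * (a * a * (a * a))) + 4ℚ * 3ℚ * (a * a * (p * s)) + 2ℚ * (3ℚ * (p * (s * s))) +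
                        4ℚ * (p * (a * a * (a * a))) ≡ 3ℚ * ((p + p) * ((a * a + s) * (a * a + s)))
    collect = solve-∀ ℚ-ring

  -- Values beyond the threshold are replaced by zero rather than clipped, so that the root of `θ`
  -- never occurs. In that case `e` is `z` itself and θ ≤ z², whence the last component.
  split-at : ∀ θ z → Σ ℚ λ c → Σ ℚ λ e →
             (c + e ≡ z) × (0ℚ ≤ θ → c * c ≤ θ) × (c * c ≤ z * z) × (θ * (e * e) ≤ z * z * (z * z))
  split-at θ z with ≤-total (z * z) θ
  ... | inj₁ h = z , 0ℚ , +-identityʳ z , (λ _ → h) , ≤-refl ,
                 subst (_≤ z * z * (z * z)) (sym (*-zeroʳ θ)) (0≤sq (z * z))
  ... | inj₂ h = 0ℚ , z , +-identityˡ z , (λ 0≤θ → 0≤θ) , 0≤sq z ,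
                 *-monoʳ-≤-nonNeg (z * z) {{nonNegative (0≤sq z)}} h

  cut excess : ℚ → ℚ → ℚ
  cut θ z    = proj₁ (split-at θ z)
  excess θ z = proj₁ (proj₂ (split-at θ z))

  private
    -- Twice νγ - βq is (ν - β)(γ + q) + (ν + β)(γ - q).
    trivial-bound : ∀ {β ν q γ} → β ≤ ν → - β ≤ ν → q ≤ γ → - q ≤ γ → β * q ≤ ν * γ
    trivial-bound {β} {ν} {q} {γ} h₁ h₂ h₃ h₄ = *-cancelˡ {2ℚ} (positive⁻¹ 2ℚ)
      (≤-gap (0≤+ (0≤* (gap h₁) (gap h₄)) (0≤* (gap h₂) (gap h₃))) (expand β ν q γ))
      where
      expand : ∀ β ν q γ → 2ℚ * (β * q) + ((ν - β) * (γ - (- q)) + (ν - (- β)) * (γ - q)) ≡ 2ℚ * (ν * γ)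
      expand = solve-∀ ℚ-ring

    -- Cauchy-Schwarz without roots: the sum of the squares (γu - αv)² is nonnegative, and its
    -- expansion is divided by 2αγ.
    inner-bound : (is : List I) (u v : I → ℚ) {α β γ : ℚ} → 0ℚ < α → 0ℚ < γ → α * β ≤ γ * γ →
                  sumL is (λ i → u i * u i) ≤ α → sumL is (λ i → v i * v i) ≤ β → sumL is (λ i → u i * v i) ≤ γ
    inner-bound is u v {α} {β} {γ} 0<α 0<γ αβ hu hv =
      *-cancelˡ {2ℚ * (α * γ)} (0<* {2ℚ} (positive⁻¹ 2ℚ) (0<* 0<α 0<γ))
        (≤-gap (0≤+ (0≤+ (0≤+ sq (0≤* (0≤sq γ) (gap hu))) (0≤* (0≤sq α) (gap hv)))
                    (0≤* (<⇒≤ 0<α) (gap αβ))) (total α β γ U V W))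
      where
      U = sumL is (λ i → u i * u i)
      V = sumL is (λ i → v i * v i)
      W = sumL is (λ i → u i * v i)
      point : ∀ γ α u v → (γ * u - α * v) * (γ * u - α * v) ≡
              γ * γ * (u * u) + (α * α * (v * v) + (- (2ℚ * (α * γ))) * (u * v))
      point = solve-∀ ℚ-ring
      sq : 0ℚ ≤ γ * γ * U + (α * α * V + (- (2ℚ * (α * γ))) * W)
      sq = subst (0ℚ ≤_)
        (trans (sum-ext is (λ i → point γ α (u i) (v i))) (trans (sum-+ is _ _)
          (cong₂ _+_ (sum-*ˡ is (γ * γ) (λ i → u i * u i)) (trans (sum-+ is _ _)
            (cong₂ _+_ (sum-*ˡ is (α * α) (λ i → v i * v i)) (sum-*ˡ is (- (2ℚ * (α * γ))) (λ i → u i * v i)))))))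
        (sum-nonneg is (λ i _ → 0≤sq (γ * u i - α * v i)))
      total : ∀ α β γ U V W → 2ℚ * (α * γ) * W + (((γ * γ * U + (α * α * V + (- (2ℚ * (α * γ))) * W)) +
              γ * γ * (α - U)) + α * α * (β - V) + α * (γ * γ - α * β)) ≡ 2ℚ * (α * γ) * γ
      total = solve-∀ ℚ-ring

  -- Rademacher sums embed the vectors isometrically in L² of a cube.  Truncating them at √48 times their norm leaves
  -- a bounded part, handled by box-bound, and a remainder of at most a quarter of the norm, which is fed back
  -- into the statement as a new family of vectors.
  grothendieck : (xs : List X) (ys : List Y) (B ν : X → Y → ℚ) {τ : ℚ} → SignBound xs ys B τ → 0ℚ ≤ τ →
    (∀ x y → (B x y ≤ ν x y) × (- B x y ≤ ν x y)) →
    ∀ k (is : List I) (u : X → I → ℚ) (v : Y → I → ℚ) {α β γ : ℚ} → 0ℚ < α → 0ℚ < β → 0ℚ < γ → α * β ≤ γ * γ →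
    (∀ x → x ∈ xs → sumL is (λ i → u x i * u x i) ≤ α) → (∀ y → y ∈ ys → sumL is (λ i → v y i * v y i) ≤ β) →
    pow2 k * pair xs ys B (λ x y → sumL is (λ i → u x i * v y i)) ≤
    γ * (pow2 k * (96ℚ * τ) + sumL xs (λ x → sumL ys (ν x)))
  grothendieck xs ys B ν {τ} bound 0≤τ B≤ν zero is u v {α} {β} {γ} 0<α 0<β 0<γ αβ hu hv =
    -- With no round of truncation left, Cauchy-Schwarz is applied entry by entry, at the price of
    -- the whole mass of `ν`. Each further round halves this term relative to the one with `τ`.
    ≤-trans (≤-reflexive (*-identityˡ _)) (≤-trans
      (sum-mono xs (λ x m → sum-mono ys (λ y n →
        trivial-bound (proj₁ (B≤ν x y)) (proj₂ (B≤ν x y)) (inner-bound is (u x) (v y) 0<α 0<γ αβ (hu x m) (hv y n))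
          (≤-trans (≤-reflexive (neg-inner x y)) (inner-bound is (λ i → - u x i) (v y) 0<α 0<γ αβ
            (≤-trans (≤-reflexive (sum-ext is (λ i → neg-sq (u x i)))) (hu x m)) (hv y n))))))
      (≤-trans (≤-reflexive (trans (sum-ext xs (λ x → sum-*ʳ ys γ (ν x))) (sum-*ʳ xs γ _)))
        (≤-gap (0≤* (<⇒≤ 0<γ) (0≤* {96ℚ} (nonNegative⁻¹ 96ℚ) 0≤τ)) (final γ τ _))))
    where
    neg-sq : ∀ p → (- p) * (- p) ≡ p * p
    neg-sq = solve-∀ ℚ-ring
    neg-prod : ∀ a b → (- 1ℚ) * (a * b) ≡ (- a) * b
    neg-prod = solve-∀ ℚ-ring
    neg-one : ∀ a → - a ≡ (- 1ℚ) * a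
    neg-one = solve-∀ ℚ-ring
    neg-inner : ∀ x y → - sumL is (λ i → u x i * v y i) ≡ sumL is (λ i → (- u x i) * v y i)
    neg-inner x y = trans (neg-one _) (trans (sym (sum-*ˡ is (- 1ℚ) _)) (sum-ext is (λ i → neg-prod (u x i) (v y i))))
    final : ∀ γ τ V → V * γ + γ * (96ℚ * τ) ≡ γ * (1ℚ * (96ℚ * τ) + V)
    final = solve-∀ ℚ-ring
  grothendieck {X = X} {Y = Y} {I = I} xs ys B ν {τ} bound 0≤τ B≤ν (suc k) is u v {α} {β} {γ} 0<α 0<β 0<γ αβ hu hv =
    *-cancelˡ (0<* {2ℚ} (positive⁻¹ 2ℚ) 0<P) (≤-trans (≤-reflexive lhs) (≤-trans
      (+-mono-≤ (+-mono-≤ (*-monoˡ {4ℚ * p} (0≤* {4ℚ} (nonNegative⁻¹ 4ℚ) (<⇒≤ (0<pow2 k))) S₁≤) S₂≤) S₃≤)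
      (≤-reflexive (collect P p γ τ V))))
    where
    d = length is
    P = pow2 d
    p = pow2 k
    Ω = cube d
    V = sumL xs (λ x → sumL ys (ν x))
    0<P = 0<pow2 d
    Φ : X → List Bool → ℚ
    Φ x = rademacher is (u x)
    Ψ : Y → List Bool → ℚ
    Ψ y = rademacher is (v y)
    -- 48 = 3 · 16: on average over the cube the fourth moment is at most 3α², so the excess has
    -- second moment at most 3α² / θ = α / 16, and four times the excess again has norm² at most α.
    θ  = 48ℚ * α
    θ′ = 48ℚ * β
    0≤θ : 0ℚ ≤ θ
    0≤θ = 0≤* {48ℚ} (nonNegative⁻¹ 48ℚ) (<⇒≤ 0<α)
    0≤θ′ : 0ℚ ≤ θ′
    0≤θ′ = 0≤* {48ℚ} (nonNegative⁻¹ 48ℚ) (<⇒≤ 0<β)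
    lo  = λ x ε → cut θ (Φ x ε)
    hi  = λ x ε → excess θ (Φ x ε)
    lo′ = λ y ε → cut θ′ (Ψ y ε)
    hi′ = λ y ε → excess θ′ (Ψ y ε)
    T = pair xs ys B (λ x y → sumL is (λ i → u x i * v y i))
    S₁ = pair xs ys B (λ x y → sumL Ω (λ ε → lo x ε * lo′ y ε))
    S₂ = pair xs ys B (λ x y → sumL Ω (λ ε → (4ℚ * hi x ε) * Ψ y ε))
    S₃ = pair xs ys B (λ x y → sumL Ω (λ ε → lo x ε * (4ℚ * hi′ y ε)))

    -- Only `lo * lo′` is bounded on both sides. In the other two products the 4 goes to the excess
    -- and restores its norm bound, so each of them costs a quarter of the bound for `k`, together a
    -- half. The 96 in the statement solves x = 48 + x / 2.
    split : ∀ x y ε → 4ℚ * (Φ x ε * Ψ y ε) ≡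
            4ℚ * (lo x ε * lo′ y ε) + ((4ℚ * hi x ε) * Ψ y ε + lo x ε * (4ℚ * hi′ y ε))
    split x y ε = subst₂ (λ a b → 4ℚ * (a * b) ≡ 4ℚ * (lo x ε * lo′ y ε) +
      ((4ℚ * hi x ε) * b + lo x ε * (4ℚ * hi′ y ε)))
      (proj₁ (proj₂ (proj₂ (split-at θ (Φ x ε))))) (proj₁ (proj₂ (proj₂ (split-at θ′ (Ψ y ε)))))
      (expand (lo x ε) (hi x ε) (lo′ y ε) (hi′ y ε))
      where
      expand : ∀ a b c e → 4ℚ * ((a + b) * (c + e)) ≡ 4ℚ * (a * c) + ((4ℚ * b) * (c + e) + a * (4ℚ * e))
      expand = solve-∀ ℚ-ring

    4PT : 4ℚ * (P * T) ≡ 4ℚ * S₁ + (S₂ + S₃)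
    4PT = trans (cong (4ℚ *_) (sym (pair-* xs ys B P _)))
      (trans (sym (pair-* xs ys B 4ℚ _))
      (trans (pair-cong xs ys B (λ x y _ _ → trans (cong (4ℚ *_) (sym (rademacher-2 is (u x) (v y))))
        (trans (sym (sum-*ˡ Ω 4ℚ _)) (trans (sum-ext Ω (split x y))
        (trans (sum-+ Ω _ _) (cong₂ _+_ (sum-*ˡ Ω 4ℚ _) (sum-+ Ω _ _)))))))
      (trans (pair-+ xs ys B _ _) (cong₂ _+_ (pair-* xs ys B 4ℚ _) (pair-+ xs ys B _ _)))))

    lhs : 2ℚ * P * (pow2 (suc k) * T) ≡ 4ℚ * p * S₁ + p * S₂ + p * S₃
    lhs = trans (arrange P p T) (trans (cong (p *_) 4PT) (distrib p S₁ S₂ S₃))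
      where
      arrange : ∀ P p T → 2ℚ * P * ((p + p) * T) ≡ p * (4ℚ * (P * T))
      arrange = solve-∀ ℚ-ring
      distrib : ∀ p a b c → p * (4ℚ * a + (b + c)) ≡ 4ℚ * p * a + p * b + p * c
      distrib = solve-∀ ℚ-ring

    S₁≤ : S₁ ≤ P * (48ℚ * γ * τ)
    S₁≤ = ≤-trans (≤-reflexive (pair-sum xs ys B Ω (λ ε x y → lo x ε * lo′ y ε)))
      (≤-trans (sum-mono Ω (λ ε _ → each ε)) (≤-reflexive (sum-cube-const d _)))
      where
      each : ∀ ε → pair xs ys B (λ x y → lo x ε * lo′ y ε) ≤ 48ℚ * γ * τ
      each ε =
        let s , 0≤s , ss , bs = uniform-bound xs (λ x → lo x ε) θ 0≤θ
                                  (λ x _ → proj₁ (proj₂ (proj₂ (proj₂ (split-at θ (Φ x ε))))) 0≤θ)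
            t , 0≤t , tt , bt = uniform-bound ys (λ y → lo′ y ε) θ′ 0≤θ′
                                  (λ y _ → proj₁ (proj₂ (proj₂ (proj₂ (split-at θ′ (Ψ y ε))))) 0≤θ′)
            st : s * t ≤ 48ℚ * γ
            st = sq-cancel-≤ (0≤* {48ℚ} (nonNegative⁻¹ 48ℚ) (<⇒≤ 0<γ))
                   (≤-trans (≤-reflexive (sq-prod s t)) (≤-trans (*-mono (0≤sq s) ss (0≤sq t) tt)
                   (≤-trans (≤-reflexive (regroup α β)) (≤-trans (*-monoˡ (0≤sq 48ℚ) αβ) (≤-reflexive (regroup′ γ))))))
        in ≤-trans (box-bound xs ys B bound (λ x → lo x ε) (λ y → lo′ y ε) s t 0≤s 0≤t bs bt)
           (≤-trans (≤-reflexive (sym (*-assoc s t τ))) (*-monoʳ-≤-nonNeg τ {{nonNegative 0≤τ}} st))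
        where
        sq-prod : ∀ s t → (s * t) * (s * t) ≡ (s * s) * (t * t)
        sq-prod = solve-∀ ℚ-ring
        regroup : ∀ α β → 48ℚ * α * (48ℚ * β) ≡ 48ℚ * 48ℚ * (α * β)
        regroup = solve-∀ ℚ-ring
        regroup′ : ∀ γ → 48ℚ * 48ℚ * (γ * γ) ≡ 48ℚ * γ * (48ℚ * γ)
        regroup′ = solve-∀ ℚ-ring

    full-norm : {Z : Set} (w : Z → I → ℚ) (z : Z) {a : ℚ} → sumL is (λ i → w z i * w z i) ≤ a →
                sumL Ω (λ ε → rademacher is (w z) ε * rademacher is (w z) ε) ≤ P * a
    full-norm w z h = ≤-trans (≤-reflexive (rademacher-2 is (w z) (w z))) (*-monoˡ (<⇒≤ 0<P) h)

    excess-norm : {Z : Set} (w : Z → I → ℚ) (z : Z) {a : ℚ} → 0ℚ < a → sumL is (λ i → w z i * w z i) ≤ a →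
                  sumL Ω (λ ε → (4ℚ * excess (48ℚ * a) (rademacher is (w z) ε)) *
                                (4ℚ * excess (48ℚ * a) (rademacher is (w z) ε))) ≤ P * a
    excess-norm w z {a} 0<a h = *-cancelˡ (0<* {3ℚ} (positive⁻¹ 3ℚ) 0<a)
      (≤-trans (≤-reflexive (trans (sym (sum-*ˡ Ω (3ℚ * a) _)) (sum-ext Ω (λ ε → rearrange a (E ε)))))
      (≤-trans (sum-mono Ω (λ ε _ → proj₂ (proj₂ (proj₂ (proj₂ (proj₂ (split-at (48ℚ * a) (R ε))))))))
      (≤-trans (rademacher-4 is (w z))
      (≤-trans (*-monoˡ {3ℚ} (nonNegative⁻¹ 3ℚ) (*-monoˡ (<⇒≤ 0<P) (*-mono s≥0 h s≥0 h)))
        (≤-reflexive (regroup P a))))))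
      where
      R = rademacher is (w z)
      E = λ ε → excess (48ℚ * a) (R ε)
      s≥0 = sum-nonneg is (λ i _ → 0≤sq (w z i))
      rearrange : ∀ a e → 3ℚ * a * ((4ℚ * e) * (4ℚ * e)) ≡ 48ℚ * a * (e * e)
      rearrange = solve-∀ ℚ-ring
      regroup : ∀ P a → 3ℚ * (P * (a * a)) ≡ 3ℚ * a * (P * a)
      regroup = solve-∀ ℚ-ring

    PαPβ : P * α * (P * β) ≤ P * γ * (P * γ)
    PαPβ = ≤-trans (≤-reflexive (regroup P α β)) (≤-trans (*-monoˡ (0≤sq P) αβ) (≤-reflexive (regroup′ P γ)))
      where
      regroup : ∀ P α β → P * α * (P * β) ≡ P * P * (α * β)
      regroup = solve-∀ ℚ-ring
      regroup′ : ∀ P γ → P * P * (γ * γ) ≡ P * γ * (P * γ)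
      regroup′ = solve-∀ ℚ-ring

    -- The points of the cube form the new index list. As sums over it are not normalised, all three
    -- bounds are multiplied by `P`, which keeps their relation.
    S₂≤ : p * S₂ ≤ P * γ * (p * (96ℚ * τ) + V)
    S₂≤ = grothendieck xs ys B ν bound 0≤τ B≤ν k Ω (λ x ε → 4ℚ * hi x ε) Ψ
      (0<* 0<P 0<α) (0<* 0<P 0<β) (0<* 0<P 0<γ) PαPβ
      (λ x m → excess-norm u x 0<α (hu x m)) (λ y n → full-norm v y (hv y n))

    S₃≤ : p * S₃ ≤ P * γ * (p * (96ℚ * τ) + V)
    S₃≤ = grothendieck xs ys B ν bound 0≤τ B≤ν k Ω lo (λ y ε → 4ℚ * hi′ y ε)
      (0<* 0<P 0<α) (0<* 0<P 0<β) (0<* 0<P 0<γ) PαPβ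
      (λ x m → ≤-trans (sum-mono Ω (λ ε _ → proj₁ (proj₂ (proj₂ (proj₂ (proj₂ (split-at θ (Φ x ε))))))))
                       (full-norm u x (hu x m)))
      (λ y n → excess-norm v y 0<β (hv y n))

    collect : ∀ P p γ τ V → 4ℚ * p * (P * (48ℚ * γ * τ)) + P * γ * (p * (96ℚ * τ) + V) + P * γ * (p * (96ℚ * τ) + V) ≡
              2ℚ * P * (γ * ((p + p) * (96ℚ * τ) + V))
    collect = solve-∀ ℚ-ring

-- Rational approximation of square roots.

module SquareRoots where
  open import Data.Empty using (⊥-elim)
  open import Data.Product using (Σ; _×_; _,_; proj₁; proj₂)
  open import Data.Nat as ℕ using (ℕ; zero; suc)
  import Data.Nat.Properties as ℕ
  import Data.Nat.Tactic.RingSolver as ℕ-Ring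
  import Data.Integer as ℤ
  import Data.Integer.Properties as ℤ
  open import Data.Rational.Unnormalised as ℚᵘ using (ℚᵘ; mkℚᵘ; *≡*)
  import Data.Rational.Unnormalised.Properties as ℚᵘ
  open import Data.Rational
  open import Data.Rational.Properties
  open import Relation.Nullary using (yes; no)
  open import Relation.Binary.PropositionalEquality hiding (J)
  open import Tactic.RingSolver using (solve-∀)
  open Rationals

  isqrt : ∀ n → Σ ℕ λ t → (t ℕ.* t ℕ.≤ n) × (n ℕ.< suc t ℕ.* suc t)
  isqrt zero = 0 , ℕ.z≤n , ℕ.s≤s ℕ.z≤n
  isqrt (suc n) with isqrt n
  ... | t , lo , hi with suc t ℕ.* suc t ℕ.≤? suc n
  ... | yes h = suc t , h , ℕ.≤-<-trans hi (ℕ.*-mono-< (ℕ.n<1+n (suc t)) (ℕ.n<1+n (suc t)))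
  ... | no h  = t , ℕ.m≤n⇒m≤1+n lo , ℕ.≰⇒> h

  toℚᵘ-ι : ∀ n → toℚᵘ (ι n) ℚᵘ.≃ mkℚᵘ (ℤ.+ n) 0
  toℚᵘ-ι zero    = ℚᵘ.≃-refl
  toℚᵘ-ι (suc n) = ℚᵘ.≃-trans (toℚᵘ-homo-+ 1ℚ (ι n)) (ℚᵘ.≃-trans (ℚᵘ.+-congʳ (toℚᵘ 1ℚ) (toℚᵘ-ι n))
    (*≡* (cong (λ m → (ℤ.1ℤ ℤ.+ m) ℤ.* ℤ.1ℤ) (ℤ.*-identityʳ (ℤ.+ n)))))

  clear-denominator : ∀ p → 0ℚ < p → Σ ℕ λ d → Σ ℕ λ k → p * ι (suc d) ≡ ι (suc k)
  clear-denominator p@(mkℚ (ℤ.+ suc k) d _) _ = d , k , toℚᵘ-injective (ℚᵘ.≃-trans (toℚᵘ-homo-* p (ι (suc d)))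
    (ℚᵘ.≃-trans (ℚᵘ.*-congˡ {toℚᵘ p} (toℚᵘ-ι (suc d))) (ℚᵘ.≃-trans (*≡* eq) (ℚᵘ.≃-sym (toℚᵘ-ι (suc k))))))
    where
    eq : (ℤ.+ suc k ℤ.* ℤ.+ suc d) ℤ.* ℤ.1ℤ ≡ ℤ.+ suc k ℤ.* (ℤ.+ (suc d ℕ.* 1))
    eq = trans (ℤ.*-identityʳ _) (cong (λ m → ℤ.+ suc k ℤ.* ℤ.+ m) (sym (ℕ.*-identityʳ (suc d))))
  clear-denominator p@(mkℚ (ℤ.+ zero) d _) h = ⊥-elim (<-irrefl (sym (↥p≡0⇒p≡0 p refl)) h)
  clear-denominator p@(mkℚ ℤ.-[1+ k ] d _) h = ⊥-elim (<-asym h (negative⁻¹ p))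

  -- Write n = K / D with positive naturals. Then √n = √(DK) / D, and the integer root R of DK gives
  -- t = R / D and s = D / R. The 4 comes from DK < (R + 1)² ≤ 4R².
  approx-sqrt : ∀ n → 0ℚ < n → Σ ℚ λ s → Σ ℚ λ t → (s * t ≡ 1ℚ) × (s * s * n ≤ 4ℚ) × (t * t ≤ n)
  approx-sqrt n 0<n with clear-denominator n 0<n
  ... | d , k , eq with isqrt (suc d ℕ.* suc k)
  ... | zero , lo , hi = ⊥-elim (ℕ.<⇒≱ hi (ℕ.s≤s ℕ.z≤n))
  ... | suc r , lo , hi = s , t , st , upper , lower
    where
    D = ι (suc d)
    R = ι (suc r)
    K = ι (suc k)
    invD = inverse D (λ e → <-irrefl (sym e) (0<ι d))
    invR = inverse R (λ e → <-irrefl (sym e) (0<ι r))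
    D′ = proj₁ invD
    R′ = proj₁ invR
    s = D * R′
    t = R * D′
    st : s * t ≡ 1ℚ
    st = trans (arrange D R′ R D′) (cong₂ _*_ (proj₂ invD) (proj₂ invR))
      where
      arrange : ∀ D R′ R D′ → (D * R′) * (R * D′) ≡ (D′ * D) * (R′ * R)
      arrange = solve-∀ ℚ-ring
    ssn : s * s * n ≡ R′ * R′ * ι (suc d ℕ.* suc k)
    ssn = trans (arrange D R′ n) (cong (R′ * R′ *_) (trans (cong (D *_) eq) (sym (ι-* (suc d) (suc k)))))
      where
      arrange : ∀ D R′ n → (D * R′) * (D * R′) * n ≡ R′ * R′ * (D * (n * D))
      arrange = solve-∀ ℚ-ring
    N≤4r² : suc d ℕ.* suc k ℕ.≤ 4 ℕ.* (suc r ℕ.* suc r)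
    N≤4r² = ℕ.≤-trans (ℕ.<⇒≤ hi) (ℕ.≤-trans (ℕ.*-mono-≤ double double) (ℕ.≤-reflexive (regroup (suc r))))
      where
      double : suc (suc r) ℕ.≤ 2 ℕ.* suc r
      double = ℕ.≤-trans (ℕ.+-monoˡ-≤ (suc r) (ℕ.s≤s ℕ.z≤n))
                 (ℕ.≤-reflexive (cong (λ z → suc r ℕ.+ z) (sym (ℕ.+-identityʳ (suc r)))))
      regroup : ∀ a → (2 ℕ.* a) ℕ.* (2 ℕ.* a) ≡ 4 ℕ.* (a ℕ.* a)
      regroup = ℕ-Ring.solve-∀
    upper : s * s * n ≤ 4ℚ
    upper = ≤-trans (≤-reflexive ssn) (≤-trans (*-monoˡ (0≤sq R′) (ι-mono N≤4r²))
      (≤-reflexive (trans (cong (R′ * R′ *_) (trans (ι-* 4 (suc r ℕ.* suc r)) (cong (ι 4 *_) (ι-* (suc r) (suc r)))))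
        (trans (arrange R′ R) (cong₂ (λ a b → 4ℚ * (a * b)) (proj₂ invR) (proj₂ invR))))))
      where
      arrange : ∀ R′ R → R′ * R′ * (4ℚ * (R * R)) ≡ 4ℚ * ((R′ * R) * (R′ * R))
      arrange = solve-∀ ℚ-ring
    lower : t * t ≤ n
    lower = *-cancelˡ (0<* (0<ι d) (0<ι d)) (≤-trans (≤-reflexive (trans (arrange D R D′)
        (cong₂ (λ a b → R * R * (a * b)) (proj₂ invD) (proj₂ invD))))
      (≤-trans (≤-reflexive (trans (arrange₁ R) (sym (ι-* (suc r) (suc r))))) (≤-trans (ι-mono lo)
      (≤-reflexive (trans (ι-* (suc d) (suc k)) (trans (cong (D *_) (sym eq)) (arrange₂ D n)))))))
      where
      arrange : ∀ D R D′ → D * D * ((R * D′) * (R * D′)) ≡ R * R * ((D′ * D) * (D′ * D))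
      arrange = solve-∀ ℚ-ring
      arrange₁ : ∀ R → R * R * (1ℚ * 1ℚ) ≡ R * R
      arrange₁ = solve-∀ ℚ-ring
      arrange₂ : ∀ D n → D * (n * D) ≡ D * D * n
      arrange₂ = solve-∀ ℚ-ring

-- Sums of rank-one matrices, elimination and the splitting of rank.

module Factorisation where
  open import Data.Sum using (_⊎_; inj₁; inj₂)
  open import Data.Product using (Σ; _×_; _,_; proj₁; proj₂)
  open import Data.List using (List; []; _∷_; map; length)
  open import Data.List.Properties using (length-map)
  open import Data.List.Relation.Unary.Any using (here; there)
  open import Data.List.Membership.Propositional using (_∈_)
  open import Data.Nat as ℕ using (ℕ; suc)
  import Data.Nat.Properties as ℕ
  open import Data.Rational
  open import Data.Rational.Properties
  open import Relation.Nullary using (yes; no)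
  open import Relation.Binary.PropositionalEquality hiding (J)
  open import Tactic.RingSolver using (solve-∀)
  open Rationals
  open ListSums

  private variable
    X Y : Set

  Terms : Set → Set → Set
  Terms X Y = List ((X → ℚ) × (Y → ℚ))

  ⟦_⟧ : Terms X Y → X → Y → ℚ
  ⟦ L ⟧ x y = sumL L (λ t → proj₁ t x * proj₂ t y)

  -- The map p ↦ p - a φ(p) on the left factors. Depending on `a` and `φ` it is a pivot step, an
  -- orthogonal projection, or the subtraction of one row from all rows.
  eliminate : (X → ℚ) → ((X → ℚ) → ℚ) → Terms X Y → Terms X Y
  eliminate a φ = map (λ t → (λ x → proj₁ t x - a x * φ (proj₁ t)) , proj₂ t)

  eliminate-eval : (a : X → ℚ) (φ : (X → ℚ) → ℚ) (L : Terms X Y) → ∀ x y →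
                   ⟦ eliminate a φ L ⟧ x y ≡ ⟦ L ⟧ x y - a x * sumL L (λ t → φ (proj₁ t) * proj₂ t y)
  eliminate-eval a φ []      x y = sym (trans (cong (λ z → 0ℚ - z) (*-zeroʳ (a x))) refl)
  eliminate-eval a φ (t ∷ L) x y = trans (cong ((proj₁ t x - a x * φ (proj₁ t)) * proj₂ t y +_)
    (eliminate-eval a φ L x y))
    (arrange (proj₁ t x) (a x) (φ (proj₁ t)) (proj₂ t y) (⟦ L ⟧ x y) (sumL L (λ t → φ (proj₁ t) * proj₂ t y)))
    where
    arrange : ∀ p a f q l s → (p - a * f) * q + (l - a * s) ≡ p * q + l - a * (f * q + s)
    arrange = solve-∀ ℚ-ring

  pivot : (p : X → ℚ) (x₀ : X) (i : ℚ) → Terms X Y → Terms X Y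
  pivot p x₀ i = eliminate (λ x → p x * i) (λ p′ → p′ x₀)

  -- Subtracting from every row the multiple of row `x₀` that clears `p` removes the first term
  -- altogether, so what remains has one term less.
  pivot-eval : (p : X → ℚ) (q : Y → ℚ) (L : Terms X Y) (x₀ : X) (i : ℚ) → i * p x₀ ≡ 1ℚ → ∀ x y →
               ⟦ (p , q) ∷ L ⟧ x y ≡ ⟦ pivot p x₀ i L ⟧ x y + p x * i * ⟦ (p , q) ∷ L ⟧ x₀ y
  pivot-eval p q L x₀ i e x y = sym (trans
    (cong (_+ p x * i * ⟦ (p , q) ∷ L ⟧ x₀ y) (eliminate-eval (λ x → p x * i) (λ p′ → p′ x₀) L x y))
    (trans (arrange (⟦ L ⟧ x y) (p x) i (⟦ L ⟧ x₀ y) (p x₀) (q y))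
    (trans (cong (λ z → ⟦ L ⟧ x y + p x * (z * q y)) e) (arrange′ (⟦ L ⟧ x y) (p x) (q y)))))
    where
    arrange : ∀ l p i m r q → l - p * i * m + p * i * (r * q + m) ≡ l + p * (i * r * q)
    arrange = solve-∀ ℚ-ring
    arrange′ : ∀ l p q → l + p * (1ℚ * q) ≡ p * q + l
    arrange′ = solve-∀ ℚ-ring

  zero-or-pivot : (xs : List X) (p : X → ℚ) →
                  (∀ x → x ∈ xs → p x ≡ 0ℚ) ⊎ Σ X λ x₀ → (x₀ ∈ xs) × Σ ℚ λ i → i * p x₀ ≡ 1ℚ
  zero-or-pivot []       p = inj₁ (λ _ ())
  zero-or-pivot (x ∷ xs) p with p x ≟ 0ℚ
  ... | no p≢0 = inj₂ (x , here refl , inverse (p x) p≢0)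
  ... | yes e with zero-or-pivot xs p
  ...   | inj₁ h             = inj₁ (λ { z (here refl) → e ; z (there m) → h z m })
  ...   | inj₂ (x₀ , m , inv) = inj₂ (x₀ , there m , inv)

  drop-zero : (p : X → ℚ) (q : Y → ℚ) (L : Terms X Y) → ∀ {x} y → p x ≡ 0ℚ → ⟦ (p , q) ∷ L ⟧ x y ≡ ⟦ L ⟧ x y
  drop-zero p q L {x} y e = trans (cong (λ z → z * q y + ⟦ L ⟧ x y) e)
    (trans (cong (_+ ⟦ L ⟧ x y) (*-zeroˡ (q y))) (+-identityˡ _))

  -- These are the pivot rows of Gaussian elimination: after a pivot at `x₀`, every row is a
  -- multiple of row `x₀` plus a row of a shorter factorisation. `k` carries the recursion because
  -- `pivot` rebuilds the list.
  determining-rows : ∀ k (L : Terms X Y) → length L ≡ k → (xs : List X) →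
    Σ (List X) λ ss → (length ss ℕ.≤ k) × (∀ s → s ∈ ss → s ∈ xs) ×
    (∀ y y′ → (∀ s → s ∈ ss → ⟦ L ⟧ s y ≡ ⟦ L ⟧ s y′) → ∀ x → x ∈ xs → ⟦ L ⟧ x y ≡ ⟦ L ⟧ x y′)
  determining-rows k []            e xs = [] , ℕ.z≤n , (λ _ ()) , λ _ _ _ _ _ → refl
  determining-rows (suc k) ((p , q) ∷ L) e xs with zero-or-pivot xs p
  ... | inj₁ p≡0 with determining-rows k L (ℕ.suc-injective e) xs
  ...   | ss , len , sub , det = ss , ℕ.m≤n⇒m≤1+n len , sub , λ y y′ agree x m →
          trans (drop-zero p q L y (p≡0 x m)) (trans
            (det y y′ (λ s n → trans (sym (drop-zero p q L y (p≡0 s (sub s n))))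
                               (trans (agree s n) (drop-zero p q L y′ (p≡0 s (sub s n))))) x m)
            (sym (drop-zero p q L y′ (p≡0 x m))))
  determining-rows (suc k) ((p , q) ∷ L) e xs | inj₂ (x₀ , m₀ , i , inv)
    with determining-rows k (pivot p x₀ i L) (trans (length-map _ L) (ℕ.suc-injective e)) xs
  ... | ss , len , sub , det = x₀ ∷ ss , ℕ.s≤s len , (λ { _ (here refl) → m₀ ; s (there n) → sub s n }) ,
    λ y y′ agree x m →
      let row₀ = agree x₀ (here refl)
          reduced = λ s n → +-cancelʳ _ _ _ (trans (sym (pivot-eval p q L x₀ i inv s y)) (trans (agree s (there n))
                      (trans (pivot-eval p q L x₀ i inv s y′)
                             (cong (λ z → ⟦ pivot p x₀ i L ⟧ s y′ + p s * i * z) (sym row₀)))))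
      in trans (pivot-eval p q L x₀ i inv x y) (trans
           (cong₂ (λ a b → a + p x * i * b) (det y y′ reduced x m) row₀) (sym (pivot-eval p q L x₀ i inv x y′)))
    where
    cancel : ∀ a b → a + b - b ≡ a
    cancel = solve-∀ ℚ-ring
    +-cancelʳ : ∀ a b c → a + c ≡ b + c → a ≡ b
    +-cancelʳ a b c h = trans (sym (cancel a c)) (trans (cong (_- c) h) (cancel b c))

  -- If ⟦ L ⟧ vanishes on a rectangle, then the coefficient vectors of its rows are orthogonal to those of its columns.
  split-rank : ∀ k (L : Terms X Y) → length L ≡ k → (xs : List X) (ys : List Y) →
    (∀ x y → x ∈ xs → y ∈ ys → ⟦ L ⟧ x y ≡ 0ℚ) →
    Σ (Terms X Y) λ A → Σ (Terms X Y) λ B → (length A ℕ.+ length B ℕ.≤ k) ×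
    (∀ x y → x ∈ xs → ⟦ L ⟧ x y ≡ ⟦ A ⟧ x y) × (∀ x y → y ∈ ys → ⟦ L ⟧ x y ≡ ⟦ B ⟧ x y)
  split-rank k [] e xs ys vanish = [] , [] , ℕ.z≤n , (λ _ _ _ → refl) , λ _ _ _ → refl
  split-rank (suc k) ((p , q) ∷ L) e xs ys vanish with zero-or-pivot xs p
  ... | inj₁ p≡0 with split-rank k L (ℕ.suc-injective e) xs ys
                      (λ x y m n → trans (sym (drop-zero p q L y (p≡0 x m))) (vanish x y m n))
  -- `p` vanishes on `xs`, so this term is invisible in those rows and is charged to the columns
  -- alone.
  ...   | A , B , len , onX , onY = A , (p , q) ∷ B ,
          ℕ.≤-trans (ℕ.≤-reflexive (ℕ.+-suc (length A) (length B))) (ℕ.s≤s len) ,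
          (λ x y m → trans (drop-zero p q L y (p≡0 x m)) (onX x y m)) ,
          λ x y n → cong (p x * q y +_) (onY x y n)
  split-rank (suc k) ((p , q) ∷ L) e xs ys vanish | inj₂ (x₀ , m₀ , i , inv) =
    -- Row `x₀` vanishes on `ys`, so its term is charged to the rows alone, and the pivoted list
    -- still vanishes on the rectangle.
    (pi , row₀) ∷ proj₁ rec , proj₁ (proj₂ rec) , ℕ.s≤s (proj₁ (proj₂ (proj₂ rec))) ,
    (λ x y m → trans (pivot-eval p q L x₀ i inv x y) (trans (+-comm (⟦ L₁ ⟧ x y) (pi x * row₀ y))
       (cong (pi x * row₀ y +_) (proj₁ (proj₂ (proj₂ (proj₂ rec))) x y m)))) ,
    λ x y n → trans (on-ys x y n) (proj₂ (proj₂ (proj₂ (proj₂ rec))) x y n)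
    where
    L₁ = pivot p x₀ i L
    pi = λ x → p x * i
    row₀ = ⟦ (p , q) ∷ L ⟧ x₀
    on-ys : ∀ x y → y ∈ ys → ⟦ (p , q) ∷ L ⟧ x y ≡ ⟦ L₁ ⟧ x y
    on-ys x y n = trans (pivot-eval p q L x₀ i inv x y)
      (trans (cong (λ z → ⟦ L₁ ⟧ x y + pi x * z) (vanish x₀ y m₀ n))
      (trans (cong (⟦ L₁ ⟧ x y +_) (*-zeroʳ (pi x))) (+-identityʳ (⟦ L₁ ⟧ x y))))
    rec = split-rank k L₁ (trans (length-map _ L) (ℕ.suc-injective e)) xs ys
            (λ x y m n → trans (sym (on-ys x y n)) (vanish x y m n))

-- Gram-Schmidt orthogonalisation for a weighted inner product.

module GramSchmidt where
  open import Data.Empty using (⊥-elim)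
  open import Data.Sum using (inj₁; inj₂)
  open import Data.Product using (Σ; _×_; _,_; proj₁; proj₂)
  open import Data.List using (List; []; _∷_; length)
  open import Data.List.Properties using (length-map)
  open import Data.List.Membership.Propositional using (_∈_)
  open import Data.Nat as ℕ using (ℕ; suc)
  import Data.Nat.Properties as ℕ
  open import Data.Rational
  open import Data.Rational.Properties
  open import Relation.Nullary using (yes; no)
  open import Relation.Binary.PropositionalEquality hiding (J)
  open import Tactic.RingSolver using (solve-∀)
  open Rationals
  open ListSums
  open SquareRoots
  open Factorisation

  private variable
    X Y : Set

  norm²ˡ : Terms X Y → X → ℚ
  norm²ˡ L x = sumL L (λ t → proj₁ t x * proj₁ t x)

  norm²ʳ : Terms X Y → Y → ℚ
  norm²ʳ L y = sumL L (λ t → proj₂ t y * proj₂ t y)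

  -- The vectors of the w-orthogonal basis of the column space are only normalised up to a factor of two,
  -- which keeps them rational.
  gram-schmidt : ∀ k (L : Terms X Y) → length L ≡ k → (xs : List X) (w : X → ℚ) → (∀ x → x ∈ xs → 0ℚ < w x) →
    Σ (Terms X Y) λ L′ → (∀ x y → x ∈ xs → ⟦ L ⟧ x y ≡ ⟦ L′ ⟧ x y) ×
    (sumL xs (λ x → w x * norm²ˡ L′ x) ≤ 4ℚ * ι k) ×
    (∀ y → norm²ʳ L′ y ≤ sumL xs (λ x → w x * (⟦ L ⟧ x y * ⟦ L ⟧ x y)))
  gram-schmidt k [] e xs w 0<w = [] , (λ _ _ _ → refl) ,
    ≤-trans (≤-reflexive (trans (sum-ext xs (λ x → *-zeroʳ (w x))) (sum-0 xs)))
            (0≤* {4ℚ} (nonNegative⁻¹ 4ℚ) (0≤ι k)) ,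
    λ y → sum-nonneg xs (λ x m → 0≤* (<⇒≤ (0<w x m)) (0≤sq 0ℚ))
  gram-schmidt {X = X} {Y = Y} (suc k) ((p , q) ∷ L) e xs w 0<w
    with sumL xs (λ x → w x * (p x * p x)) ≟ 0ℚ
  ... | yes n≡0 =
    -- Since the weights are positive, norm zero forces `p` to vanish on `xs`, and the term is
    -- dropped.
    proj₁ rec ,
    (λ x y m → trans (drop-zero p q L y (p≡0 x m)) (proj₁ (proj₂ rec) x y m)) ,
    ≤-trans (proj₁ (proj₂ (proj₂ rec))) (*-monoˡ {4ℚ} (nonNegative⁻¹ 4ℚ) (ι-mono (ℕ.n≤1+n k))) ,
    λ y → ≤-trans (proj₂ (proj₂ (proj₂ rec)) y) (≤-reflexive (sum-cong xs (λ x m →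
            cong (λ z → w x * (z * z)) (sym (drop-zero p q L y (p≡0 x m))))))
    where
    rec = gram-schmidt k L (ℕ.suc-injective e) xs w 0<w
    p≡0 : ∀ x → x ∈ xs → p x ≡ 0ℚ
    p≡0 x m with p x ≟ 0ℚ
    ... | yes h = h
    ... | no h  = ⊥-elim (<-irrefl
      (sym (sum-≡0 xs (λ x m → 0≤* (<⇒≤ (0<w x m)) (0≤sq (p x))) n≡0 x m)) (0<* (0<w x m) (≢0⇒0<sq h)))
  ... | no n≢0 =
    -- `g y` is the coefficient of column `y` along `p`. The scalings `s` and `t` multiply to 1: s²
    -- n ≤ 4 lets each basis vector add at most 4 to the weighted left norms, and t² ≤ n keeps t² g²
    -- below its Pythagorean share n g².
    ((λ x → s * p x) , (λ y → t * g y)) ∷ L₂ ,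
    (λ x y m → trans (M≡ x y) (trans (+-comm (⟦ L₁ ⟧ x y) (p x * g y))
      (cong₂ _+_ (unscale (p x) (g y)) (proj₁ (proj₂ rec) x y m)))) ,
    ≤-trans (≤-reflexive (trans (sum-ext xs (λ x → split-norm (w x) s (p x) (norm²ˡ L₂ x)))
             (trans (sum-+ xs (λ x → s * s * (w x * (p x * p x))) (λ x → w x * norm²ˡ L₂ x))
               (cong (_+ sumL xs (λ x → w x * norm²ˡ L₂ x)) (sum-*ˡ xs (s * s) (λ x → w x * (p x * p x)))))))
      (≤-trans (+-mono-≤ ssn≤4 (proj₁ (proj₂ (proj₂ rec)))) (≤-reflexive (four (ι k)))) ,
    λ y → ≤-trans (+-mono-≤ (t²g²≤ y) (proj₂ (proj₂ (proj₂ rec)) y)) (≤-reflexive (sym (pythagoras y)))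
    where
    n = sumL xs (λ x → w x * (p x * p x))
    0≤n : 0ℚ ≤ n
    0≤n = sum-nonneg xs (λ x m → 0≤* (<⇒≤ (0<w x m)) (0≤sq (p x)))
    0<n : 0ℚ < n
    0<n = ≤∧≢⇒< 0≤n (λ h → n≢0 (sym h))
      where
      ≤∧≢⇒< : ∀ {a b} → a ≤ b → a ≢ b → a < b
      ≤∧≢⇒< {a} {b} a≤b a≢b with ≤-or-> b a
      ... | inj₁ b≤a = ⊥-elim (a≢b (≤-antisym a≤b b≤a))
      ... | inj₂ a<b = a<b
    inv = inverse n n≢0
    i = proj₁ inv
    root = approx-sqrt n 0<n
    s = proj₁ root
    t = proj₁ (proj₂ root)
    st≡1 = proj₁ (proj₂ (proj₂ root))
    ssn≤4 = proj₁ (proj₂ (proj₂ (proj₂ root)))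
    tt≤n = proj₂ (proj₂ (proj₂ (proj₂ root)))
    φ : (X → ℚ) → ℚ
    φ p′ = i * sumL xs (λ x → w x * (p x * p′ x))
    L₁ : Terms X Y
    L₁ = eliminate p φ L
    rec = gram-schmidt k L₁ (trans (length-map _ L) (ℕ.suc-injective e)) xs w 0<w
    L₂ : Terms X Y
    L₂ = proj₁ rec
    M : X → Y → ℚ
    M = ⟦ (p , q) ∷ L ⟧
    c g : Y → ℚ
    c y = sumL xs (λ x → w x * (p x * M x y))
    g y = i * c y
    S : Y → ℚ
    S y = sumL L (λ t → φ (proj₁ t) * proj₂ t y)

    c≡ : ∀ y → c y ≡ q y * n + sumL L (λ t → sumL xs (λ x → w x * (p x * proj₁ t x)) * proj₂ t y)
    c≡ y = trans (sum-ext xs (λ x → distrib (w x) (p x) (q y) (⟦ L ⟧ x y)))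
      (trans (sum-+ xs (λ x → q y * (w x * (p x * p x))) (λ x → w x * p x * ⟦ L ⟧ x y))
      (cong₂ _+_ (sum-*ˡ xs (q y) (λ x → w x * (p x * p x)))
        (trans (sum-ext xs (λ x → sym (sum-*ˡ L (w x * p x) (λ t → proj₁ t x * proj₂ t y))))
        (trans (sum-swap xs L (λ x t → w x * p x * (proj₁ t x * proj₂ t y)))
          (sum-ext L (λ t → trans (sum-ext xs (λ x → assoc (w x) (p x) (proj₁ t x) (proj₂ t y)))
            (sum-*ʳ xs (proj₂ t y) (λ x → w x * (p x * proj₁ t x)))))))))
      where
      distrib : ∀ w p q l → w * (p * (p * q + l)) ≡ q * (w * (p * p)) + w * p * l
      distrib = solve-∀ ℚ-ring
      assoc : ∀ w p a b → w * p * (a * b) ≡ w * (p * a) * b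
      assoc = solve-∀ ℚ-ring

    g≡ : ∀ y → g y ≡ q y + S y
    g≡ y = trans (cong (i *_) (c≡ y)) (trans (distrib i (q y) n (sumL L
      (λ t → sumL xs (λ x → w x * (p x * proj₁ t x)) * proj₂ t y)))
      (cong₂ _+_ (trans (cong (q y *_) (proj₂ inv)) (*-identityʳ (q y)))
        (trans (sym (sum-*ˡ L i (λ t → sumL xs (λ x → w x * (p x * proj₁ t x)) * proj₂ t y)))
          (sum-ext L (λ t → sym (*-assoc i (sumL xs (λ x → w x * (p x * proj₁ t x))) (proj₂ t y)))))))
      where
      distrib : ∀ i q n r → i * (q * n + r) ≡ q * (i * n) + i * r
      distrib = solve-∀ ℚ-ring

    M≡ : ∀ x y → M x y ≡ ⟦ L₁ ⟧ x y + p x * g y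
    M≡ x y = sym (trans (cong₂ (λ a b → a + p x * b) (eliminate-eval p φ L x y) (g≡ y))
      (arrange (⟦ L ⟧ x y) (p x) (S y) (q y)))
      where
      arrange : ∀ l p s q → l - p * s + p * (q + s) ≡ p * q + l
      arrange = solve-∀ ℚ-ring

    ng≡c : ∀ y → n * g y ≡ c y
    ng≡c y = trans (assoc n i (c y)) (trans (cong (_* c y) (proj₂ inv)) (*-identityˡ (c y)))
      where
      assoc : ∀ n i c → n * (i * c) ≡ i * n * c
      assoc = solve-∀ ℚ-ring

    -- No term of `L₁` is inspected: by `M≡` the weighted product of `p` with column `y` of `M` is
    -- this sum plus n g, and n g is already the whole product.
    orthogonal : ∀ y → sumL xs (λ x → w x * (p x * ⟦ L₁ ⟧ x y)) ≡ 0ℚ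
    orthogonal y = cancel (trans (sym (trans (sum-ext xs (λ x → trans (cong (λ z → w x * (p x * z)) (M≡ x y))
          (distrib (w x) (p x) (⟦ L₁ ⟧ x y) (g y))))
        (trans (sum-+ xs (λ x → w x * (p x * ⟦ L₁ ⟧ x y)) (λ x → w x * (p x * p x) * g y))
          (cong (sumL xs (λ x → w x * (p x * ⟦ L₁ ⟧ x y)) +_) (sum-*ʳ xs (g y) (λ x → w x * (p x * p x)))))))
        (sym (ng≡c y)))
      where
      distrib : ∀ w p m g → w * (p * (m + p * g)) ≡ w * (p * m) + w * (p * p) * g
      distrib = solve-∀ ℚ-ring
      minus : ∀ a b → a + b - b ≡ a
      minus = solve-∀ ℚ-ring
      cancel : ∀ {a b} → a + b ≡ b → a ≡ 0ℚ
      cancel {a} {b} h = trans (sym (minus a b)) (trans (cong (_- b) h) (+-inverseʳ b))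

    pythagoras : ∀ y → sumL xs (λ x → w x * (M x y * M x y)) ≡
                       n * (g y * g y) + sumL xs (λ x → w x * (⟦ L₁ ⟧ x y * ⟦ L₁ ⟧ x y))
    pythagoras y = trans (sum-ext xs (λ x → trans (cong (λ z → w x * (z * z)) (M≡ x y))
        (expand (w x) (⟦ L₁ ⟧ x y) (p x) (g y))))
      (trans (sum-+ xs (λ x → w x * (⟦ L₁ ⟧ x y * ⟦ L₁ ⟧ x y)) (λ x → 2ℚ * g y * (w x * (p x * ⟦ L₁ ⟧ x y)) + g y * g
        y * (w x * (p x * p x))))
      (trans (cong (Q +_) (trans (sum-+ xs (λ x → 2ℚ * g y * (w x * (p x * ⟦ L₁ ⟧ x y)))
        (λ x → g y * g y * (w x * (p x * p x))))
          (cong₂ _+_ (trans (sum-*ˡ xs (2ℚ * g y) (λ x → w x * (p x * ⟦ L₁ ⟧ x y))) (cong (2ℚ * g y *_) (orthogonal y)))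
            (sum-*ˡ xs (g y * g y) (λ x → w x * (p x * p x))))))
        (collect Q (g y) n)))
      where
      Q = sumL xs (λ x → w x * (⟦ L₁ ⟧ x y * ⟦ L₁ ⟧ x y))
      expand : ∀ w m p g → w * ((m + p * g) * (m + p * g)) ≡ w * (m * m) +
        (2ℚ * g * (w * (p * m)) + g * g * (w * (p * p)))
      expand = solve-∀ ℚ-ring
      collect : ∀ Q g n → Q + (2ℚ * g * 0ℚ + g * g * n) ≡ n * (g * g) + Q
      collect = solve-∀ ℚ-ring

    t²g²≤ : ∀ y → t * g y * (t * g y) ≤ n * (g y * g y)
    t²g²≤ y = ≤-trans (≤-reflexive (arrange t (g y))) (*-monoʳ-≤-nonNeg (g y * g y) {{nonNegative (0≤sq (g y))}} tt≤n)
      where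
      arrange : ∀ t g → t * g * (t * g) ≡ t * t * (g * g)
      arrange = solve-∀ ℚ-ring

    unscale : ∀ a b → a * b ≡ s * a * (t * b)
    unscale a b = sym (trans (arrange s t a b) (trans (cong (_* (a * b)) st≡1) (*-identityˡ (a * b))))
      where
      arrange : ∀ s t a b → s * a * (t * b) ≡ s * t * (a * b)
      arrange = solve-∀ ℚ-ring

    split-norm : ∀ w s p r → w * (s * p * (s * p) + r) ≡ s * s * (w * (p * p)) + w * r
    split-norm = solve-∀ ℚ-ring

    four : ∀ a → 4ℚ + 4ℚ * a ≡ 4ℚ * (1ℚ + a)
    four = solve-∀ ℚ-ring

-- From the rank by independent rows to a factorisation.

module RowReduction where
  open import Data.Empty using (⊥-elim)
  open import Data.Sum using (inj₁; inj₂)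
  open import Data.Product using (Σ; _×_; _,_; proj₁; proj₂)
  open import Data.Fin as Fin using (Fin; zero; suc)
  open import Data.Fin.Properties using (any?)
  open import Data.List using ([]; _∷_; map; length)
  open import Data.List.Properties using (length-map)
  open import Data.Nat as ℕ using (ℕ; zero; suc)
  import Data.Nat.Properties as ℕ
  open import Data.Rational
  open import Data.Rational.Properties
  open import Relation.Nullary using (¬_; yes; no; ¬?)
  open import Relation.Binary.PropositionalEquality hiding (J)
  open import Tactic.RingSolver using (solve-∀)
  open import Defs
  open Rationals
  open ListSums
  open Factorisation

  sumFin-cong : ∀ k {g h : Fin k → ℚ} → (∀ i → g i ≡ h i) → sumFin k g ≡ sumFin k h
  sumFin-cong zero    e = refl
  sumFin-cong (suc k) e = cong₂ _+_ (e zero) (sumFin-cong k (λ i → e (suc i)))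

  sumFin-- : ∀ k (g h : Fin k → ℚ) → sumFin k (λ i → g i - h i) ≡ sumFin k g - sumFin k h
  sumFin-- zero    g h = refl
  sumFin-- (suc k) g h = trans (cong (g zero - h zero +_) (sumFin-- k (λ i → g (suc i)) (λ i → h (suc i))))
    (arrange (g zero) (h zero) (sumFin k (λ i → g (suc i))) (sumFin k (λ i → h (suc i))))
    where
    arrange : ∀ a b c d → a - b + (c - d) ≡ a + c - (b + d)
    arrange = solve-∀ ℚ-ring

  sumFin-*ʳ : ∀ k (g : Fin k → ℚ) c → sumFin k (λ i → g i * c) ≡ sumFin k g * c
  sumFin-*ʳ zero    g c = sym (*-zeroˡ c)
  sumFin-*ʳ (suc k) g c = trans (cong (g zero * c +_) (sumFin-*ʳ k (λ i → g (suc i)) c))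
    (sym (*-distribʳ-+ c (g zero) (sumFin k (λ i → g (suc i)))))

  IndepRows-tail : ∀ {m n} (M : Fin m → Fin n → ℚ) {k} (s : Fin (suc k) → Fin m) →
                   IndepRows M (suc k) s → IndepRows M k (λ i → s (suc i))
  IndepRows-tail M {k} s ind c h i = ind c⁺ (λ j → trans
    (trans (cong (_+ sumFin k (λ i → c i * M (s (suc i)) j)) (*-zeroˡ (M (s zero) j))) (+-identityˡ _)) (h j)) (suc i)
    where
    c⁺ : Fin (suc k) → ℚ
    c⁺ zero    = 0ℚ
    c⁺ (suc i) = c i

  -- The hypothesis excludes only families of exactly `suc r` rows. An independent family can be
  -- shortened one row at a time, so a longer one would pass through that length.
  IndepRows-bounded : ∀ {m n} (M : Fin m → Fin n → ℚ) {r} → ((s : Fin (suc r) → Fin m) → ¬ IndepRows M (suc r) s) →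
                      ∀ k (s : Fin k → Fin m) → IndepRows M k s → k ℕ.≤ r
  IndepRows-bounded M dep zero    s ind = ℕ.z≤n
  IndepRows-bounded M {r} dep (suc k) s ind
    with ℕ.m≤n⇒m<n∨m≡n (IndepRows-bounded M dep k (λ i → s (suc i)) (IndepRows-tail M s ind))
  ... | inj₁ k<r  = k<r
  ... | inj₂ refl = ⊥-elim (dep s ind)

  -- One elimination produces both: every column that is nonzero after the earlier pivots
  -- contributes an independent row and a rank-one term. This ties the rank by independent rows to
  -- the length of `Terms`.
  row-reduce : ∀ m n (M : Fin m → Fin n → ℚ) →
               Σ ℕ λ k → Σ (Fin k → Fin m) λ s → IndepRows M k s × Σ (Terms (Fin m) (Fin n)) λ L →
               (length L ≡ k) × (∀ x y → M x y ≡ ⟦ L ⟧ x y)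
  row-reduce m zero    M = 0 , (λ ()) , (λ _ _ ()) , [] , refl , λ _ ()
  row-reduce m (suc n) M with any? (λ x → ¬? (M x zero ≟ 0ℚ))
  ... | no none =
    let k , s , ind , L , len , eval = row-reduce m n (λ x j → M x (suc j))
    in k , s , (λ c h → ind c (λ j → h (suc j))) , map extend L , trans (length-map extend L) len ,
       λ { x zero    → trans (zero-col x) (sym (trans (sum-map extend L _)
                         (trans (sum-ext L (λ t → *-zeroʳ (proj₁ t x))) (sum-0 L))))
         ; x (suc j) → trans (eval x j) (sym (sum-map extend L _)) }
    where
    extend : (Fin m → ℚ) × (Fin n → ℚ) → (Fin m → ℚ) × (Fin (suc n) → ℚ)
    extend (p , q) = p , λ { zero → 0ℚ ; (suc j) → q j }
    zero-col : ∀ x → M x zero ≡ 0ℚ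
    zero-col x with M x zero ≟ 0ℚ
    ... | yes e = e
    ... | no h  = ⊥-elim (none (x , h))
  ... | yes (x₀ , p≢0) = suc k , s⁺ , ind⁺ , (a , M x₀) ∷ map extend L , cong suc (trans (length-map extend L) len) ,
    eval⁺
    where
    inv = inverse (M x₀ zero) p≢0
    a : Fin m → ℚ
    a x = M x zero * proj₁ inv
    M′ : Fin m → Fin n → ℚ
    M′ x j = M x (suc j) - a x * M x₀ (suc j)
    rec = row-reduce m n M′
    k = proj₁ rec
    s = proj₁ (proj₂ rec)
    ind = proj₁ (proj₂ (proj₂ rec))
    L = proj₁ (proj₂ (proj₂ (proj₂ rec)))
    len = proj₁ (proj₂ (proj₂ (proj₂ (proj₂ rec))))
    eval = proj₂ (proj₂ (proj₂ (proj₂ (proj₂ rec))))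
    extend : (Fin m → ℚ) × (Fin n → ℚ) → (Fin m → ℚ) × (Fin (suc n) → ℚ)
    extend (p , q) = p , λ { zero → 0ℚ ; (suc j) → q j }
    s⁺ : Fin (suc k) → Fin m
    s⁺ zero    = x₀
    s⁺ (suc i) = s i
    a*pivot : ∀ x → a x * M x₀ zero ≡ M x zero
    a*pivot x = trans (*-assoc (M x zero) _ _) (trans (cong (M x zero *_) (proj₂ inv)) (*-identityʳ _))
    eval⁺ : ∀ x y → M x y ≡ ⟦ (a , M x₀) ∷ map extend L ⟧ x y
    eval⁺ x zero = sym (trans (cong₂ _+_ (a*pivot x) (trans (sum-map extend L _)
      (trans (sum-ext L (λ t → *-zeroʳ (proj₁ t x))) (sum-0 L)))) (+-identityʳ _))
    eval⁺ x (suc j) = sym (trans (cong (a x * M x₀ (suc j) +_) (trans (sum-map extend L _) (sym (eval x j))))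
      (arrange (a x * M x₀ (suc j)) (M x (suc j))))
      where
      arrange : ∀ b m → b + (m - b) ≡ m
      arrange = solve-∀ ℚ-ring
    ind⁺ : IndepRows M (suc k) s⁺
    ind⁺ c h = λ { zero → head≡0 ; (suc i) → tail≡0 i }
      where
      c′ : Fin k → ℚ
      c′ i = c (suc i)
      A = sumFin k (λ i → c′ i * a (s i))
      -- Column zero of `M` is `a` times the pivot, so a dependency forces `A` to be minus `c zero`.
      -- Substituted into the other columns, this leaves a dependency between rows of `M′`.
      col₀ : A * M x₀ zero ≡ - (c zero * M x₀ zero)
      col₀ = trans (sym (sumFin-*ʳ k (λ i → c′ i * a (s i)) (M x₀ zero)))
        (trans (sumFin-cong k (λ i → trans (*-assoc (c′ i) (a (s i)) (M x₀ zero)) (cong (c′ i *_) (a*pivot (s i)))))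
          (move _ _ (h zero)))
        where
        cancel : ∀ a b → b ≡ (a + b) - a
        cancel = solve-∀ ℚ-ring
        move : ∀ a b → a + b ≡ 0ℚ → b ≡ - a
        move a b e = trans (cancel a b) (trans (cong (_- a) e) (+-identityˡ (- a)))
      A≡ : A ≡ - c zero
      A≡ = trans (undo A) (trans (cong (λ z → z * proj₁ inv) col₀) (redo (c zero)))
        where
        undo : ∀ A → A ≡ A * M x₀ zero * proj₁ inv
        undo A = sym (trans (*-assoc A _ _) (trans (cong (A *_) (trans (*-comm _ (proj₁ inv)) (proj₂ inv)))
          (*-identityʳ A)))
        assoc : ∀ a b i → (- (a * b)) * i ≡ (- a) * (i * b)
        assoc = solve-∀ ℚ-ring
        redo : ∀ b → (- (b * M x₀ zero)) * proj₁ inv ≡ - b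
        redo b = trans (assoc b (M x₀ zero) (proj₁ inv)) (trans (cong ((- b) *_) (proj₂ inv)) (*-identityʳ (- b)))
      tail≡0 : ∀ i → c′ i ≡ 0ℚ
      tail≡0 = ind c′ (λ j → trans (sumFin-cong k (λ i → distrib (c′ i) (M (s i) (suc j)) (a (s i)) (M x₀ (suc j))))
        (trans (sumFin-- k (λ i → c′ i * M (s i) (suc j)) (λ i → c′ i * a (s i) * M x₀ (suc j)))
        (trans (cong (λ z → sumFin k (λ i → c′ i * M (s i) (suc j)) - z)
          (trans (sumFin-*ʳ k (λ i → c′ i * a (s i)) (M x₀ (suc j))) (cong (_* M x₀ (suc j)) A≡)))
        (trans (arrange (sumFin k (λ i → c′ i * M (s i) (suc j))) (c zero) (M x₀ (suc j))) (h (suc j))))))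
        where
        distrib : ∀ c m a b → c * (m - a * b) ≡ c * m - c * a * b
        distrib = solve-∀ ℚ-ring
        arrange : ∀ t c b → t - (- c) * b ≡ c * b + t
        arrange = solve-∀ ℚ-ring
      head≡0 : c zero ≡ 0ℚ
      head≡0 = trans (sym (neg-neg (c zero))) (cong -_ (trans (sym A≡)
        (trans (sumFin-cong k (λ i → trans (cong (_* a (s i)) (tail≡0 i)) (*-zeroˡ (a (s i))))) (sum-zeros k))))
        where
        neg-neg : ∀ a → - (- a) ≡ a
        neg-neg = solve-∀ ℚ-ring
        sum-zeros : ∀ k → sumFin k (λ _ → 0ℚ) ≡ 0ℚ
        sum-zeros zero    = refl
        sum-zeros (suc k) = trans (+-identityˡ _) (sum-zeros k)

  HasRank⇒Terms : ∀ {m n} (M : Fin m → Fin n → ℚ) {r} → HasRank M r →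
                  Σ (Terms (Fin m) (Fin n)) λ L → (length L ℕ.≤ r) × (∀ x y → M x y ≡ ⟦ L ⟧ x y)
  HasRank⇒Terms {m} {n} M (_ , dep) =
    let k , s , ind , L , len , eval = row-reduce m n M
    in L , ℕ.≤-trans (ℕ.≤-reflexive len) (IndepRows-bounded M dep k s ind) , eval

-- Filtered lists and the number of entries of either sign in a rectangle.

module Counting where
  open import Data.Bool using (Bool; true; false; not; _∧_)
  open import Data.Product using (_×_; _,_)
  open import Data.List using (List; []; _∷_; length; filterᵇ)
  open import Data.List.Relation.Unary.Any using (here; there)
  open import Data.List.Membership.Propositional using (_∈_)
  open import Data.Nat
  open import Data.Nat.Properties
  open import Data.Nat.Tactic.RingSolver using (solve-∀)
  open import Data.Sign as Sign using (Sign)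
  open import Relation.Binary.PropositionalEquality hiding (J)

  private variable
    I X Y : Set

  sumℕ : List I → (I → ℕ) → ℕ
  sumℕ []       g = 0
  sumℕ (i ∷ is) g = g i + sumℕ is g

  sumℕ-cong : (is : List I) {g h : I → ℕ} → (∀ i → g i ≡ h i) → sumℕ is g ≡ sumℕ is h
  sumℕ-cong []       e = refl
  sumℕ-cong (i ∷ is) e = cong₂ _+_ (e i) (sumℕ-cong is e)

  sumℕ-mono : (is : List I) {g h : I → ℕ} → (∀ i → i ∈ is → g i ≤ h i) → sumℕ is g ≤ sumℕ is h
  sumℕ-mono []       e = z≤n
  sumℕ-mono (i ∷ is) e = +-mono-≤ (e i (here refl)) (sumℕ-mono is (λ j m → e j (there m)))

  sumℕ-const : (is : List I) (c : ℕ) → sumℕ is (λ _ → c) ≡ length is * c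
  sumℕ-const []       c = refl
  sumℕ-const (i ∷ is) c = cong (c +_) (sumℕ-const is c)

  sumℕ-+ : (is : List I) (g h : I → ℕ) → sumℕ is (λ i → g i + h i) ≡ sumℕ is g + sumℕ is h
  sumℕ-+ []       g h = refl
  sumℕ-+ (i ∷ is) g h = trans (cong (g i + h i +_) (sumℕ-+ is g h)) (swap (g i) (h i) (sumℕ is g) (sumℕ is h))
    where
    swap : ∀ a b c d → a + b + (c + d) ≡ a + c + (b + d)
    swap = solve-∀

  sumℕ-*ˡ : (is : List I) (c : ℕ) (g : I → ℕ) → sumℕ is (λ i → c * g i) ≡ c * sumℕ is g
  sumℕ-*ˡ []       c g = sym (*-zeroʳ c)
  sumℕ-*ˡ (i ∷ is) c g = trans (cong (c * g i +_) (sumℕ-*ˡ is c g)) (sym (*-distribˡ-+ c (g i) (sumℕ is g)))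

  sumℕ-filter-≤ : (P : I → Bool) (is : List I) (g : I → ℕ) → sumℕ (filterᵇ P is) g ≤ sumℕ is g
  sumℕ-filter-≤ P []       g = z≤n
  sumℕ-filter-≤ P (i ∷ is) g with P i
  ... | true  = +-monoʳ-≤ (g i) (sumℕ-filter-≤ P is g)
  ... | false = ≤-trans (sumℕ-filter-≤ P is g) (m≤n+m _ (g i))

  length-filterᵇ-≤ : (P : I → Bool) (is : List I) → length (filterᵇ P is) ≤ length is
  length-filterᵇ-≤ P []       = z≤n
  length-filterᵇ-≤ P (i ∷ is) with P i
  ... | true  = s≤s (length-filterᵇ-≤ P is)
  ... | false = m≤n⇒m≤1+n (length-filterᵇ-≤ P is)

  length-split : (P : I → Bool) (is : List I) →
                 length is ≡ length (filterᵇ P is) + length (filterᵇ (λ i → not (P i)) is)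
  length-split P []       = refl
  length-split P (i ∷ is) with P i
  ... | true  = cong suc (length-split P is)
  ... | false = trans (cong suc (length-split P is)) (sym (+-suc _ _))

  filterᵇ-cong : {P Q : I → Bool} → (∀ i → P i ≡ Q i) → (is : List I) → filterᵇ P is ≡ filterᵇ Q is
  filterᵇ-cong e [] = refl
  filterᵇ-cong {P = P} {Q} e (i ∷ is) with P i | Q i | e i
  ... | true  | .true  | refl = cong (i ∷_) (filterᵇ-cong e is)
  ... | false | .false | refl = filterᵇ-cong e is

  filterᵇ-∘ : (P Q : I → Bool) (is : List I) → filterᵇ P (filterᵇ Q is) ≡ filterᵇ (λ i → Q i ∧ P i) is
  filterᵇ-∘ P Q [] = refl
  filterᵇ-∘ P Q (i ∷ is) with Q i
  ... | false = filterᵇ-∘ P Q is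
  ... | true with P i
  ...   | true  = cong (i ∷_) (filterᵇ-∘ P Q is)
  ...   | false = filterᵇ-∘ P Q is

  filterᵇ-all : (is : List I) → filterᵇ (λ _ → true) is ≡ is
  filterᵇ-all []       = refl
  filterᵇ-all (i ∷ is) = cong (i ∷_) (filterᵇ-all is)

  ∈-filterᵇ⁻ : (P : I → Bool) (is : List I) → ∀ {i} → i ∈ filterᵇ P is → (i ∈ is) × (P i ≡ true)
  ∈-filterᵇ⁻ P (j ∷ is) m with P j in eq
  ∈-filterᵇ⁻ P (j ∷ is) (here refl) | true = here refl , eq
  ∈-filterᵇ⁻ P (j ∷ is) (there m)   | true = let n , e = ∈-filterᵇ⁻ P is m in there n , e
  ∈-filterᵇ⁻ P (j ∷ is) m           | false = let n , e = ∈-filterᵇ⁻ P is m in there n , e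

  ∈-filterᵇ⁺ : (P : I → Bool) (is : List I) → ∀ {i} → i ∈ is → P i ≡ true → i ∈ filterᵇ P is
  ∈-filterᵇ⁺ P (j ∷ is) (here refl) e with P j
  ∈-filterᵇ⁺ P (j ∷ is) (here refl) refl | .true = here refl
  ∈-filterᵇ⁺ P (j ∷ is) (there m)   e with P j
  ... | true  = there (∈-filterᵇ⁺ P is m e)
  ... | false = ∈-filterᵇ⁺ P is m e

  indicator : Sign → Sign → ℕ
  indicator Sign.+ Sign.+ = 1
  indicator Sign.- Sign.- = 1
  indicator _      _      = 0

  rowCount : Sign → (X → Y → Sign) → X → List Y → ℕ
  rowCount σ f x ys = sumℕ ys (λ y → indicator σ (f x y))

  count : Sign → (X → Y → Sign) → List X → List Y → ℕ
  count σ f xs ys = sumℕ xs (λ x → rowCount σ f x ys)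

  indicator≤1 : ∀ σ τ → indicator σ τ ≤ 1
  indicator≤1 Sign.+ Sign.+ = s≤s z≤n
  indicator≤1 Sign.+ Sign.- = z≤n
  indicator≤1 Sign.- Sign.+ = z≤n
  indicator≤1 Sign.- Sign.- = s≤s z≤n

  indicator-total : ∀ τ → indicator Sign.+ τ + indicator Sign.- τ ≡ 1
  indicator-total Sign.+ = refl
  indicator-total Sign.- = refl

  rowCount≤length : ∀ σ (f : X → Y → Sign) x ys → rowCount σ f x ys ≤ length ys
  rowCount≤length σ f x ys = ≤-trans (sumℕ-mono ys (λ y _ → indicator≤1 σ (f x y)))
    (≤-reflexive (trans (sumℕ-const ys 1) (*-identityʳ (length ys))))

  count≤area : ∀ σ (f : X → Y → Sign) xs ys → count σ f xs ys ≤ length xs * length ys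
  count≤area σ f xs ys = ≤-trans (sumℕ-mono xs (λ x _ → rowCount≤length σ f x ys))
    (≤-reflexive (sumℕ-const xs (length ys)))

  count-total : (f : X → Y → Sign) (xs : List X) (ys : List Y) →
                count Sign.+ f xs ys + count Sign.- f xs ys ≡ length xs * length ys
  count-total f xs ys = trans (sym (sumℕ-+ xs _ _)) (trans (sumℕ-cong xs row) (sumℕ-const xs (length ys)))
    where
    row : ∀ x → rowCount Sign.+ f x ys + rowCount Sign.- f x ys ≡ length ys
    row x = trans (sym (sumℕ-+ ys _ _)) (trans (sumℕ-cong ys (λ y → indicator-total (f x y)))
              (trans (sumℕ-const ys 1) (*-identityʳ (length ys))))

-- A rectangle correlated with a sign matrix of low rank.

module Discrepancy where
  open import Data.Empty using (⊥-elim)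
  open import Data.Bool using (Bool; true; false; not)
  open import Data.Sum using (_⊎_; inj₁; inj₂)
  open import Data.Product using (Σ; _×_; _,_; proj₁; proj₂)
  open import Data.Fin using (Fin)
  open import Data.Fin.Subset.Properties using (anySubset?)
  open import Data.Vec using (lookup; tabulate)
  open import Data.Vec.Properties using (lookup∘tabulate)
  open import Data.List using (List; []; _∷_; length; filterᵇ)
  open import Data.List.Relation.Unary.Any using (here; there)
  open import Data.List.Membership.Propositional using (_∈_)
  open import Data.Nat as ℕ using (ℕ; zero; suc)
  import Data.Nat.Properties as ℕ
  import Data.Nat.Tactic.RingSolver as ℕ-Ring
  open import Data.Sign as Sign using (Sign)
  open import Data.Rational
  open import Data.Rational.Properties
  open import Relation.Nullary using (¬_; yes; no)
  open import Relation.Binary.PropositionalEquality hiding (J)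
  open import Tactic.RingSolver using (solve-∀)
  open import Defs
  open Rationals
  open ListSums
  open Grothendieck
  open Factorisation
  open GramSchmidt
  open Counting

  private variable
    I X Y : Set

  pow2≡ι : ∀ k → pow2 k ≡ ι (2 ℕ.^ k)
  pow2≡ι zero    = refl
  pow2≡ι (suc k) = trans (cong₂ _+_ (pow2≡ι k) (pow2≡ι k))
    (trans (sym (ι-+ (2 ℕ.^ k) (2 ℕ.^ k))) (cong ι (cong (2 ℕ.^ k ℕ.+_) (sym (ℕ.+-identityʳ (2 ℕ.^ k))))))

  n≤2^n : ∀ n → n ℕ.≤ 2 ℕ.^ n
  n≤2^n zero    = ℕ.z≤n
  n≤2^n (suc n) = ℕ.≤-trans (ℕ.+-mono-≤ (ℕ.m^n>0 2 n) (n≤2^n n))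
    (ℕ.≤-reflexive (cong (2 ℕ.^ n ℕ.+_) (sym (ℕ.+-identityʳ (2 ℕ.^ n)))))

  complement : (I → Bool) → I → Bool
  complement P i = not (P i)

  rect : (X → Y → ℚ) → List X → List Y → ℚ
  rect B xs ys = sumL xs (λ x → sumL ys (B x))

  sum-sgn : (σ : I → Bool) (is : List I) (g : I → ℚ) →
            sumL is (λ i → sgn (σ i) * g i) ≡ sumL (filterᵇ σ is) g - sumL (filterᵇ (complement σ) is) g
  sum-sgn σ []       g = refl
  sum-sgn σ (i ∷ is) g with σ i
  ... | true  = trans (cong (1ℚ * g i +_) (sum-sgn σ is g))
                  (arrange (g i) (sumL (filterᵇ σ is) g) (sumL (filterᵇ (complement σ) is) g))
    where
    arrange : ∀ a b c → 1ℚ * a + (b - c) ≡ a + b - c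
    arrange = solve-∀ ℚ-ring
  ... | false = trans (cong ((- 1ℚ) * g i +_) (sum-sgn σ is g))
                  (arrange (g i) (sumL (filterᵇ σ is) g) (sumL (filterᵇ (complement σ) is) g))
    where
    arrange : ∀ a b c → (- 1ℚ) * a + (b - c) ≡ b - (a + c)
    arrange = solve-∀ ℚ-ring

  -- For B of total sum zero, ΣBab is twice the sum of B over the two rectangles on which a and b agree.
  rect⇒SignBound : (xs : List X) (ys : List Y) (B : X → Y → ℚ) {τ : ℚ} → rect B xs ys ≡ 0ℚ →
    ((P : X → Bool) (Q : Y → Bool) → rect B (filterᵇ P xs) (filterᵇ Q ys) ≤ τ) → SignBound xs ys B (4ℚ * τ)
  rect⇒SignBound xs ys B {τ} balanced small σ ρ = ≤-trans (≤-reflexive (trans expand (trans (fold S₊₊ S₊₋ S₋₊ S₋₋)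
      (cong (λ z → 2ℚ * (S₊₊ + S₋₋) - z) total))))
    (≤-gap (0≤* {2ℚ} (nonNegative⁻¹ 2ℚ) (0≤+ (gap (small σ ρ)) (gap (small (complement σ) (complement ρ)))))
      (finish τ S₊₊ S₋₋))
    where
    xs⁺ = filterᵇ σ xs
    xs⁻ = filterᵇ (complement σ) xs
    ys⁺ = filterᵇ ρ ys
    ys⁻ = filterᵇ (complement ρ) ys
    S₊₊ = rect B xs⁺ ys⁺
    S₊₋ = rect B xs⁺ ys⁻
    S₋₊ = rect B xs⁻ ys⁺
    S₋₋ = rect B xs⁻ ys⁻
    comm : ∀ b s r → b * (s * r) ≡ s * (r * b)
    comm = solve-∀ ℚ-ring
    minus : ∀ zs → sumL zs (λ x → sumL ys⁺ (B x) - sumL ys⁻ (B x)) ≡ rect B zs ys⁺ - rect B zs ys⁻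
    minus zs = trans (sum-+ zs (λ x → sumL ys⁺ (B x)) (λ x → - sumL ys⁻ (B x)))
      (cong (rect B zs ys⁺ +_) (trans (sum-ext zs (λ x → negate-one (sumL ys⁻ (B x))))
        (trans (sum-*ˡ zs (- 1ℚ) (λ x → sumL ys⁻ (B x))) (sym (negate-one (rect B zs ys⁻))))))
      where
      negate-one : ∀ a → - a ≡ (- 1ℚ) * a
      negate-one = solve-∀ ℚ-ring
    expand : pair xs ys B (λ x y → sgn (σ x) * sgn (ρ y)) ≡ (S₊₊ - S₊₋) - (S₋₊ - S₋₋)
    expand = trans (sum-ext xs (λ x → trans (sum-ext ys (λ y → comm (B x y) (sgn (σ x)) (sgn (ρ y))))
        (trans (sum-*ˡ ys (sgn (σ x)) (λ y → sgn (ρ y) * B x y)) (cong (sgn (σ x) *_) (sum-sgn ρ ys (B x))))))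
      (trans (sum-sgn σ xs (λ x → sumL ys⁺ (B x) - sumL ys⁻ (B x))) (cong₂ _-_ (minus xs⁺) (minus xs⁻)))
    total : (S₊₊ + S₊₋) + (S₋₊ + S₋₋) ≡ 0ℚ
    total = trans (sym (trans (sum-split σ xs (λ x → sumL ys (B x))) (cong₂ _+_ (cols xs⁺) (cols xs⁻)))) balanced
      where
      cols : ∀ zs → rect B zs ys ≡ rect B zs ys⁺ + rect B zs ys⁻
      cols zs = trans (sum-ext zs (λ x → sum-split ρ ys (B x)))
                      (sum-+ zs (λ x → sumL ys⁺ (B x)) (λ x → sumL ys⁻ (B x)))
    fold : ∀ a b c d → (a - b) - (c - d) ≡ 2ℚ * (a + d) - ((a + b) + (c + d))
    fold = solve-∀ ℚ-ring
    finish : ∀ τ a d → 2ℚ * (a + d) - 0ℚ + 2ℚ * ((τ - a) + (τ - d)) ≡ 4ℚ * τ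
    finish = solve-∀ ℚ-ring

  -- For `a` plus and `b` minus entries the weights are exchanged, so that each sign has total mass
  -- a b and the signed sum is zero. `weight` is the absolute value.
  weigh : ℕ → ℕ → Sign → ℚ
  weigh a b Sign.+ = ι b
  weigh a b Sign.- = - ι a

  weight : ℕ → ℕ → Sign → ℚ
  weight a b Sign.+ = ι b
  weight a b Sign.- = ι a

  sum-weighed : (f : X → Y → Sign) (h : Sign → ℚ) (xs : List X) (ys : List Y) →
                rect (λ x y → h (f x y)) xs ys ≡ h Sign.+ * ι (count Sign.+ f xs ys) + h Sign.- * ι
                  (count Sign.- f xs ys)
  sum-weighed f h xs ys = trans (sum-ext xs row) (collect xs (λ x → rowCount Sign.+ f x ys)
    (λ x → rowCount Sign.- f x ys))
    where
    arrange : ∀ a b p q r s → (a * p + b * q) + (a * r + b * s) ≡ a * (p + r) + b * (q + s)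
    arrange = solve-∀ ℚ-ring
    collect : (is : List I) (g g′ : I → ℕ) → sumL is (λ i → h Sign.+ * ι (g i) + h Sign.- * ι (g′ i)) ≡
              h Sign.+ * ι (sumℕ is g) + h Sign.- * ι (sumℕ is g′)
    collect []       g g′ = sym (zeros (h Sign.+) (h Sign.-))
      where
      zeros : ∀ a b → a * 0ℚ + b * 0ℚ ≡ 0ℚ
      zeros = solve-∀ ℚ-ring
    collect (i ∷ is) g g′ = trans (cong (h Sign.+ * ι (g i) + h Sign.- * ι (g′ i) +_) (collect is g g′))
      (trans (arrange (h Sign.+) (h Sign.-) (ι (g i)) (ι (g′ i)) (ι (sumℕ is g)) (ι (sumℕ is g′)))
        (cong₂ (λ a b → h Sign.+ * a + h Sign.- * b) (sym (ι-+ (g i) (sumℕ is g))) (sym (ι-+ (g′ i) (sumℕ is g′)))))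
    single : ∀ τ → h τ ≡ h Sign.+ * ι (indicator Sign.+ τ) + h Sign.- * ι (indicator Sign.- τ)
    single Sign.+ = sym (unit (h Sign.+) (h Sign.-))
      where
      unit : ∀ a b → a * (1ℚ + 0ℚ) + b * 0ℚ ≡ a
      unit = solve-∀ ℚ-ring
    single Sign.- = sym (unit (h Sign.+) (h Sign.-))
      where
      unit : ∀ a b → a * 0ℚ + b * (1ℚ + 0ℚ) ≡ b
      unit = solve-∀ ℚ-ring
    row : ∀ x → sumL ys (λ y → h (f x y)) ≡ h Sign.+ * ι (rowCount Sign.+ f x ys) + h Sign.- * ι
      (rowCount Sign.- f x ys)
    row x = trans (sum-ext ys (λ y → single (f x y)))
                  (collect ys (λ y → indicator Sign.+ (f x y)) (λ y → indicator Sign.- (f x y)))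

  -- `δ` is the 0/1 indicator of z ≤ c as a rational, so that it can multiply vectors. The second
  -- inequality is the pointwise form of Markov's.
  threshold : ∀ z c → 0ℚ ≤ z → 0ℚ ≤ c → Σ ℚ λ δ → (δ * δ * z ≤ c) × ((1ℚ - δ) * c ≤ z)
  threshold z c 0≤z 0≤c with ≤-total z c
  ... | inj₁ z≤c = 1ℚ , ≤-trans (≤-reflexive (*-identityˡ z)) z≤c , ≤-trans (≤-reflexive (*-zeroˡ c)) 0≤z
  ... | inj₂ c≤z = 0ℚ , ≤-trans (≤-reflexive (*-zeroˡ z)) 0≤c , ≤-trans (≤-reflexive (*-identityˡ c)) c≤z

  sum-pos : (is : List I) {g : I → ℚ} {i : I} → i ∈ is → (∀ i → i ∈ is → 0ℚ < g i) → 0ℚ < sumL is g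
  sum-pos (i ∷ is) _ 0<g = <-≤-trans (0<g i (here refl)) (≤-gap (sum-nonneg is (λ j m → <⇒≤ (0<g j (there m)))) refl)

  -- Decided by trying all pairs of subsets. For p plus and q minus entries in the rectangle the
  -- condition is D (b p - a q) ≥ a b without subtraction: the signed mass is at least 1 / D of the
  -- mass of one sign.
  correlated-rectangle-or-not : ∀ {m n} (f : Fin m → Fin n → Sign) xs ys (a b D : ℕ) →
    (Σ (Fin m → Bool) λ P → Σ (Fin n → Bool) λ Q →
      a ℕ.* b ℕ.+ D ℕ.* (count Sign.- f (filterᵇ P xs) (filterᵇ Q ys) ℕ.* a) ℕ.≤
      D ℕ.* (count Sign.+ f (filterᵇ P xs) (filterᵇ Q ys) ℕ.* b)) ⊎
    (∀ P Q → D ℕ.* (count Sign.+ f (filterᵇ P xs) (filterᵇ Q ys) ℕ.* b) ℕ.<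
      a ℕ.* b ℕ.+ D ℕ.* (count Sign.- f (filterᵇ P xs) (filterᵇ Q ys) ℕ.* a))
  correlated-rectangle-or-not f xs ys a b D
    with anySubset? (λ p → anySubset? (λ q →
      a ℕ.* b ℕ.+ D ℕ.* (count Sign.- f (filterᵇ (lookup p) xs) (filterᵇ (lookup q) ys) ℕ.* a) ℕ.≤?
      D ℕ.* (count Sign.+ f (filterᵇ (lookup p) xs) (filterᵇ (lookup q) ys) ℕ.* b)))
  ... | yes (p , q , h) = inj₁ (lookup p , lookup q , h)
  ... | no none = inj₂ λ P Q → ℕ.≰⇒> λ h → none (tabulate P , tabulate Q ,
    subst₂ (λ xs′ ys′ → a ℕ.* b ℕ.+ D ℕ.* (count Sign.- f xs′ ys′ ℕ.* a) ℕ.≤ D ℕ.* (count Sign.+ f xs′ ys′ ℕ.* b))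
      (filterᵇ-cong (λ i → sym (lookup∘tabulate P i)) xs) (filterᵇ-cong (λ i → sym (lookup∘tabulate Q i)) ys) h)

  -- Here `z` stands for a b and `p` for 2^k. In units of p c z the left side is 2048, while on the
  -- right Grothendieck's constant gives 2 · 96 · 4 = 768 and the leftover mass at most 1024 because
  -- of 4c ≤ p. The factor 1024 in `D` is what leaves this margin.
  contradictory : ∀ c z p → 1 ℕ.≤ c → 1 ℕ.≤ z → 1 ℕ.≤ p → 4 ℕ.* c ℕ.≤ p →
    ¬ (p ℕ.* (2 ℕ.* (1024 ℕ.* c ℕ.* z)) ℕ.≤ 2 ℕ.* (c ℕ.* (p ℕ.* (96 ℕ.* (4 ℕ.* z)) ℕ.+ 2 ℕ.* (1024 ℕ.* c ℕ.* z))))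
  contradictory c z p 1≤c 1≤z 1≤p 4c≤p h = ℕ.<⇒≱ (ℕ.*-monoʳ-< 256 (ℕ.*-mono-≤ 1≤p (ℕ.*-mono-≤ 1≤c 1≤z)))
    (ℕ.+-cancelˡ-≤ (1792 ℕ.* Z) (256 ℕ.* Z) 0 (subst₂ ℕ._≤_ (lhs c z p) (rhs c z p)
      (ℕ.≤-trans h (ℕ.≤-trans (ℕ.≤-reflexive (mid c z p)) (ℕ.+-monoʳ-≤ (768 ℕ.* (p ℕ.* (c ℕ.* z)))
        (ℕ.*-monoˡ-≤ (1024 ℕ.* (c ℕ.* z)) 4c≤p))))))
    where
    Z = p ℕ.* (c ℕ.* z)
    lhs : ∀ c z p → p ℕ.* (2 ℕ.* (1024 ℕ.* c ℕ.* z)) ≡ 1792 ℕ.* (p ℕ.* (c ℕ.* z)) ℕ.+ 256 ℕ.* (p ℕ.* (c ℕ.* z))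
    lhs = ℕ-Ring.solve-∀
    mid : ∀ c z p → 2 ℕ.* (c ℕ.* (p ℕ.* (96 ℕ.* (4 ℕ.* z)) ℕ.+ 2 ℕ.* (1024 ℕ.* c ℕ.* z))) ≡
                    768 ℕ.* (p ℕ.* (c ℕ.* z)) ℕ.+ 4 ℕ.* c ℕ.* (1024 ℕ.* (c ℕ.* z))
    mid = ℕ-Ring.solve-∀
    rhs : ∀ c z p → 768 ℕ.* (p ℕ.* (c ℕ.* z)) ℕ.+ p ℕ.* (1024 ℕ.* (c ℕ.* z)) ≡ 1792 ℕ.* (p ℕ.* (c ℕ.* z)) ℕ.+ 0
    rhs = ℕ-Ring.solve-∀

  -- If all rectangles were small, Grothendieck's inequality would bound the pairing of `B` with the
  -- inner products of the vectors that factor `f`, the long ones set to zero. On the kept rows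
  -- these products are `f` itself, and `B` times `f` is `ν`; so the pairing is the mass `T` of the
  -- kept rows, at least half of everything.
  discrepancy : ∀ {m n} (f : Fin m → Fin n → Sign) (L : Terms (Fin m) (Fin n)) xs ys →
    (∀ x y → x ∈ xs → y ∈ ys → signToℚ (f x y) ≡ ⟦ L ⟧ x y) →
    ∀ c → 1 ℕ.≤ c → 8 ℕ.* length L ℕ.≤ c ℕ.* c → {y₀ : Fin n} → y₀ ∈ ys → {x₀ : Fin m} → x₀ ∈ xs →
    let a = count Sign.+ f xs ys
        b = count Sign.- f xs ys
        D = 1024 ℕ.* c
    in 1 ℕ.≤ a → 1 ℕ.≤ b →
    Σ (Fin m → Bool) λ P → Σ (Fin n → Bool) λ Q →
      a ℕ.* b ℕ.+ D ℕ.* (count Sign.- f (filterᵇ P xs) (filterᵇ Q ys) ℕ.* a) ℕ.≤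
      D ℕ.* (count Sign.+ f (filterᵇ P xs) (filterᵇ Q ys) ℕ.* b)
  discrepancy {m} {n} f L xs ys f≡L c 1≤c 8L≤cc y₀∈ys x₀∈xs 1≤a 1≤b
    with correlated-rectangle-or-not f xs ys (count Sign.+ f xs ys) (count Sign.- f xs ys) (1024 ℕ.* c)
  ... | inj₁ found = found
  ... | inj₂ small = ⊥-elim (contradictory c (a ℕ.* b) (2 ℕ.^ k) 1≤c (ℕ.*-mono-≤ 1≤a 1≤b) (ℕ.m^n>0 2 k) (n≤2^n k)
      (ι-cancel-≤ (≤-trans (≤-reflexive lhs) (≤-trans (*-monoˡ (0≤ι (2 ℕ.^ k)) W≤2T)
        (≤-trans (≤-reflexive (trans (cong (λ p → p * (2ℚ * T)) (sym (pow2≡ι k))) (comm (pow2 k) T)))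
        (≤-trans (*-monoˡ {2ℚ} (nonNegative⁻¹ 2ℚ) bound) (≤-reflexive rhs)))))))
    where
    a = count Sign.+ f xs ys
    b = count Sign.- f xs ys
    D = 1024 ℕ.* c
    -- The number of truncation rounds: the leftover term c W / 2^k is small enough once 4c ≤ 2^k.
    -- As `k` does not enter the conclusion, the crude 4c ≤ 2^(4c) suffices.
    k = 4 ℕ.* c
    r = length L
    c² = ι c * ι c
    0<c² : 0ℚ < c²
    0<c² = 0<* (ι-pos 1≤c) (ι-pos 1≤c)
    1≤D : 1 ℕ.≤ D
    1≤D = ℕ.*-mono-≤ {1} {1024} (ℕ.s≤s ℕ.z≤n) 1≤c
    B ν : Fin m → Fin n → ℚ
    -- The factor `D` clears the denominator of the search: when the search fails, every rectangle
    -- has `B`-sum at most a b.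
    B x y = ι D * weigh a b (f x y)
    ν x y = ι D * weight a b (f x y)
    w : Fin m → ℚ
    w x = sumL ys (ν x)
    W = sumL xs w

    rect-B : ∀ xs′ ys′ → rect B xs′ ys′ ≡
             ι D * (ι b * ι (count Sign.+ f xs′ ys′) - ι a * ι (count Sign.- f xs′ ys′))
    rect-B xs′ ys′ = trans (sum-weighed f (λ σ → ι D * weigh a b σ) xs′ ys′)
      (arrange (ι D) (ι a) (ι b) (ι (count Sign.+ f xs′ ys′)) (ι (count Sign.- f xs′ ys′)))
      where
      arrange : ∀ D a b p q → D * b * p + D * (- a) * q ≡ D * (b * p - a * q)
      arrange = solve-∀ ℚ-ring

    balanced : rect B xs ys ≡ 0ℚ
    balanced = trans (rect-B xs ys) (cancel (ι D) (ι a) (ι b))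
      where
      cancel : ∀ D a b → D * (b * a - a * b) ≡ 0ℚ
      cancel = solve-∀ ℚ-ring

    W≡ : W ≡ ι (2 ℕ.* (D ℕ.* (a ℕ.* b)))
    W≡ = trans (sum-weighed f (λ σ → ι D * weight a b σ) xs ys)
      (trans (arrange (ι D) (ι a) (ι b)) (sym (trans (ι-* 2 (D ℕ.* (a ℕ.* b)))
        (cong (ι 2 *_) (trans (ι-* D (a ℕ.* b)) (cong (ι D *_) (ι-* a b)))))))
      where
      arrange : ∀ D a b → D * b * a + D * a * b ≡ 2ℚ * (D * (a * b))
      arrange = solve-∀ ℚ-ring

    small-rect : ∀ P Q → rect B (filterᵇ P xs) (filterᵇ Q ys) ≤ ι (a ℕ.* b)
    small-rect P Q = ≤-trans (≤-reflexive (rect-B (filterᵇ P xs) (filterᵇ Q ys)))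
      (≤-gap (gap (subst₂ _≤_ (ι-side p b) (trans (ι-+ (a ℕ.* b) (D ℕ.* (q ℕ.* a)))
        (cong (ι (a ℕ.* b) +_) (ι-side q a)))
                    (ι-mono (ℕ.<⇒≤ (small P Q)))))
        (arrange (ι D) (ι a) (ι b) (ι p) (ι q) (ι (a ℕ.* b))))
      where
      p = count Sign.+ f (filterᵇ P xs) (filterᵇ Q ys)
      q = count Sign.- f (filterᵇ P xs) (filterᵇ Q ys)
      ι-side : ∀ p b → ι (D ℕ.* (p ℕ.* b)) ≡ ι D * (ι p * ι b)
      ι-side p b = trans (ι-* D (p ℕ.* b)) (cong (ι D *_) (ι-* p b))
      arrange : ∀ D a b p q z → D * (b * p - a * q) + (z + D * (q * a) - D * (p * b)) ≡ z
      arrange = solve-∀ ℚ-ring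

    bounded : ∀ x y → (B x y ≤ ν x y) × (- B x y ≤ ν x y)
    bounded x y with f x y
    ... | Sign.+ = ≤-refl , ≤-gap (0≤* {2ℚ} (nonNegative⁻¹ 2ℚ) (0≤* (0≤ι D) (0≤ι b))) (double (ι D * ι b))
      where
      double : ∀ z → - z + 2ℚ * z ≡ z
      double = solve-∀ ℚ-ring
    ... | Sign.- = ≤-gap (0≤* {2ℚ} (nonNegative⁻¹ 2ℚ) (0≤* (0≤ι D) (0≤ι a))) (double (ι D) (ι a)) ,
                   ≤-reflexive (negate (ι D) (ι a))
      where
      double : ∀ D a → D * (- a) + 2ℚ * (D * a) ≡ D * a
      double = solve-∀ ℚ-ring
      negate : ∀ D a → - (D * (- a)) ≡ D * a
      negate = solve-∀ ℚ-ring

    B*f≡ν : ∀ x y → B x y * signToℚ (f x y) ≡ ν x y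
    B*f≡ν x y with f x y
    ... | Sign.+ = *-identityʳ _
    ... | Sign.- = negate (ι D) (ι a)
      where
      negate : ∀ D a → D * (- a) * (- 1ℚ) ≡ D * a
      negate = solve-∀ ℚ-ring

    sign² : ∀ σ → signToℚ σ * signToℚ σ ≡ 1ℚ
    sign² Sign.+ = refl
    sign² Sign.- = refl

    0<ν : ∀ x y → 0ℚ < ν x y
    0<ν x y with f x y
    ... | Sign.+ = 0<* (ι-pos 1≤D) (ι-pos 1≤b)
    ... | Sign.- = 0<* (ι-pos 1≤D) (ι-pos 1≤a)

    0<w : ∀ x → 0ℚ < w x
    0<w x = sum-pos ys y₀∈ys (λ y _ → 0<ν x y)

    0<W : 0ℚ < W
    0<W = sum-pos xs x₀∈xs (λ x _ → 0<w x)

    basis = gram-schmidt r L refl xs w (λ x _ → 0<w x)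
    L′ = proj₁ basis
    norm² : Fin m → ℚ
    norm² = norm²ˡ L′
    0≤norm² : ∀ x → 0ℚ ≤ norm² x
    0≤norm² x = sum-nonneg L′ (λ t _ → 0≤sq (proj₁ t x))

    invW = inverse W (λ e → <-irrefl (sym e) 0<W)
    W⁻¹ = proj₁ invW
    0<W⁻¹ : 0ℚ < W⁻¹
    0<W⁻¹ = inverse-pos {W} {W⁻¹} 0<W (proj₂ invW)

    -- Kept rows have norm² at most c² / W against column norms² of at most W, so Grothendieck's
    -- inequality applies with γ = c. The weighted norms² add up to at most 4r, and 8r ≤ c² leaves
    -- half of the mass on kept rows.
    keep : ∀ x → Σ ℚ λ δ → (δ * δ * (W * norm² x) ≤ c²) × ((1ℚ - δ) * c² ≤ W * norm² x)
    keep x = threshold (W * norm² x) c² (0≤* (<⇒≤ 0<W) (0≤norm² x)) (<⇒≤ 0<c²)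
    δ : Fin m → ℚ
    δ x = proj₁ (keep x)

    T = sumL xs (λ x → δ x * w x)

    -- Markov's inequality for norm² under the weights w.
    W≤2T : ι (2 ℕ.* (D ℕ.* (a ℕ.* b))) ≤ 2ℚ * T
    W≤2T = ≤-trans (≤-reflexive (sym W≡)) (*-cancelˡ 0<c² (≤-gap (gap (≤-trans doubled (*-monoˡ (<⇒≤ 0<W) 8r≤c²)))
      (finish c² W T)))
      where
      weighted : sumL xs (λ x → w x * ((1ℚ - δ x) * c²)) ≤ sumL xs (λ x → W * (w x * norm² x))
      weighted = sum-mono xs (λ x _ → ≤-trans (*-monoˡ (<⇒≤ (0<w x)) (proj₂ (proj₂ (keep x))))
        (≤-reflexive (arrange (w x) W (norm² x))))
        where
        arrange : ∀ w W n → w * (W * n) ≡ W * (w * n)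
        arrange = solve-∀ ℚ-ring
      left : sumL xs (λ x → w x * ((1ℚ - δ x) * c²)) ≡ c² * (W - T)
      left = trans (sum-ext xs (λ x → arrange (w x) (δ x) c²)) (trans (sum-*ˡ xs c² (λ x → w x + (- 1ℚ) * (δ x * w x)))
        (cong (c² *_) (trans (sum-+ xs w (λ x → (- 1ℚ) * (δ x * w x)))
          (trans (cong (W +_) (sum-*ˡ xs (- 1ℚ) (λ x → δ x * w x))) (minus W T)))))
        where
        arrange : ∀ w d c → w * ((1ℚ - d) * c) ≡ c * (w + (- 1ℚ) * (d * w))
        arrange = solve-∀ ℚ-ring
        minus : ∀ a b → a + (- 1ℚ) * b ≡ a - b
        minus = solve-∀ ℚ-ring
      doubled : 2ℚ * (c² * (W - T)) ≤ W * (2ℚ * (4ℚ * ι r))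
      doubled = ≤-trans (*-monoˡ {2ℚ} (nonNegative⁻¹ 2ℚ) (≤-trans (≤-reflexive (sym left)) (≤-trans weighted
        (≤-trans (≤-reflexive (sum-*ˡ xs W (λ x → w x * norm² x))) (*-monoˡ (<⇒≤ 0<W) (proj₁ (proj₂ (proj₂ basis))))))))
        (≤-reflexive (arrange W (ι r)))
        where
        arrange : ∀ W r → 2ℚ * (W * (4ℚ * r)) ≡ W * (2ℚ * (4ℚ * r))
        arrange = solve-∀ ℚ-ring
      8r≤c² : 2ℚ * (4ℚ * ι r) ≤ c²
      8r≤c² = subst₂ _≤_ (trans (ι-* 8 r) (eight (ι r))) (ι-* c c) (ι-mono 8L≤cc)
        where
        eight : ∀ r → ι 8 * r ≡ 2ℚ * (4ℚ * r)
        eight = solve-∀ ℚ-ring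
      finish : ∀ c W T → c * W + (W * c - 2ℚ * (c * (W - T))) ≡ c * (2ℚ * T)
      finish = solve-∀ ℚ-ring

    u : Fin m → (Fin m → ℚ) × (Fin n → ℚ) → ℚ
    u x t = δ x * proj₁ t x
    v : Fin n → (Fin m → ℚ) × (Fin n → ℚ) → ℚ
    v y t = proj₂ t y

    u-norm : ∀ x → sumL L′ (λ t → u x t * u x t) ≤ W⁻¹ * c²
    u-norm x = ≤-trans (≤-reflexive (trans (sum-ext L′ (λ t → arrange (δ x) (proj₁ t x)))
        (trans (sum-*ˡ L′ (δ x * δ x) (λ t → proj₁ t x * proj₁ t x)) (insert (norm² x)))))
      (*-monoˡ {W⁻¹} (<⇒≤ 0<W⁻¹) (proj₁ (proj₂ (keep x))))
      where
      arrange : ∀ d p → d * p * (d * p) ≡ d * d * (p * p)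
      arrange = solve-∀ ℚ-ring
      regroup : ∀ i d W n → i * W * (d * n) ≡ i * (d * (W * n))
      regroup = solve-∀ ℚ-ring
      insert : ∀ n → δ x * δ x * n ≡ W⁻¹ * (δ x * δ x * (W * n))
      insert n = trans (sym (trans (cong (_* (δ x * δ x * n)) (proj₂ invW)) (*-identityˡ _)))
                       (regroup W⁻¹ (δ x * δ x) W n)

    v-norm : ∀ y → y ∈ ys → sumL L′ (λ t → v y t * v y t) ≤ W
    v-norm y n = ≤-trans (proj₂ (proj₂ (proj₂ basis)) y) (≤-reflexive (sum-cong xs (λ x m →
      trans (cong (w x *_) (trans (cong (λ z → z * z) (sym (f≡L x y m n))) (sign² (f x y)))) (*-identityʳ (w x)))))

    αβ : W⁻¹ * c² * W ≤ ι c * ι c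
    αβ = ≤-reflexive (trans (arrange W⁻¹ c² W) (trans (cong (_* c²) (proj₂ invW)) (*-identityˡ c²)))
      where
      arrange : ∀ i c W → i * c * W ≡ i * W * c
      arrange = solve-∀ ℚ-ring

    pairing : pair xs ys B (λ x y → sumL L′ (λ t → u x t * v y t)) ≡ T
    pairing = sum-cong xs (λ x m → trans (sum-cong ys (λ y n →
        trans (cong (B x y *_) (trans (sum-ext L′ (λ t → *-assoc (δ x) (proj₁ t x) (proj₂ t y)))
          (trans (sum-*ˡ L′ (δ x) (λ t → proj₁ t x * proj₂ t y))
            (cong (δ x *_) (trans (sym (proj₁ (proj₂ basis) x y m)) (sym (f≡L x y m n)))))))
        (trans (swap (B x y) (δ x) (signToℚ (f x y))) (cong (δ x *_) (B*f≡ν x y)))))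
      (sum-*ˡ ys (δ x) (ν x)))
      where
      swap : ∀ a b c → a * (b * c) ≡ b * (a * c)
      swap = solve-∀ ℚ-ring

    bound : pow2 k * T ≤ ι c * (pow2 k * (96ℚ * (4ℚ * ι (a ℕ.* b))) + W)
    bound = subst (λ z → pow2 k * z ≤ ι c * (pow2 k * (96ℚ * (4ℚ * ι (a ℕ.* b))) + W)) pairing
      (grothendieck xs ys B ν (rect⇒SignBound xs ys B balanced small-rect)
        (0≤* {4ℚ} (nonNegative⁻¹ 4ℚ) (0≤ι (a ℕ.* b))) bounded k L′ u v
        (0<* {W⁻¹} 0<W⁻¹ 0<c²) 0<W (ι-pos 1≤c) αβ (λ x _ → u-norm x) v-norm)

    lhs : ι (2 ℕ.^ k ℕ.* (2 ℕ.* (D ℕ.* (a ℕ.* b)))) ≡ ι (2 ℕ.^ k) * ι (2 ℕ.* (D ℕ.* (a ℕ.* b)))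
    lhs = ι-* (2 ℕ.^ k) (2 ℕ.* (D ℕ.* (a ℕ.* b)))

    comm : ∀ p T → p * (2ℚ * T) ≡ 2ℚ * (p * T)
    comm = solve-∀ ℚ-ring

    rhs : 2ℚ * (ι c * (pow2 k * (96ℚ * (4ℚ * ι (a ℕ.* b))) + W)) ≡
          ι (2 ℕ.* (c ℕ.* (2 ℕ.^ k ℕ.* (96 ℕ.* (4 ℕ.* (a ℕ.* b))) ℕ.+ 2 ℕ.* (D ℕ.* (a ℕ.* b)))))
    rhs = sym (trans (ι-* 2 (c ℕ.* E)) (cong (2ℚ *_) (trans (ι-* c E) (cong (ι c *_)
      (trans (ι-+ (2 ℕ.^ k ℕ.* (96 ℕ.* (4 ℕ.* (a ℕ.* b)))) (2 ℕ.* (D ℕ.* (a ℕ.* b)))) (cong₂ _+_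
        (trans (ι-* (2 ℕ.^ k) (96 ℕ.* (4 ℕ.* (a ℕ.* b)))) (cong₂ _*_ (sym (pow2≡ι k))
          (trans (ι-* 96 (4 ℕ.* (a ℕ.* b))) (cong (96ℚ *_) (ι-* 4 (a ℕ.* b))))))
        (sym W≡)))))))
      where
      E = 2 ℕ.^ k ℕ.* (96 ℕ.* (4 ℕ.* (a ℕ.* b))) ℕ.+ 2 ℕ.* (D ℕ.* (a ℕ.* b))

-- From correlated rectangles to a large monochromatic one.

module MonochromaticRectangles where
  open import Data.Empty using (⊥-elim)
  open import Data.Bool using (Bool; true; false; not; _∧_)
  open import Data.Sum using (_⊎_; inj₁; inj₂)
  open import Data.Product using (Σ; _×_; _,_; proj₁; proj₂)
  open import Data.Fin using (Fin)
  open import Data.List using (List; []; _∷_; map; length; filterᵇ)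
  open import Data.List.Properties using (length-map)
  open import Data.List.Relation.Unary.Any using (here; there)
  open import Data.List.Membership.Propositional using (_∈_)
  open import Data.Nat
  open import Data.Nat.Properties
  open import Data.Nat.Tactic.RingSolver using (solve-∀)
  open import Data.Sign as Sign using (Sign; opposite)
  open import Data.Rational as ℚ using (ℚ)
  import Data.Rational.Properties as ℚ
  open import Relation.Binary.PropositionalEquality hiding (J)
  import Tactic.RingSolver as Ring
  open import Defs
  open Rationals using (ℚ-ring)
  open Factorisation
  open Counting
  open Discrepancy

  private variable
    I X Y : Set

  -- The first two terms of the binomial expansion; the induction multiplies by a + d and drops the
  -- term in a².
  bernoulli : ∀ a d k → d ^ suc k + suc k * (a * d ^ k) ≤ (a + d) ^ suc k
  bernoulli a d zero    = ≤-reflexive (base a d)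
    where
    base : ∀ a d → d * 1 + 1 * (a * 1) ≡ (a + d) * 1
    base = solve-∀
  bernoulli a d (suc k) = ≤-trans (≤-trans (m≤m+n _ (a * (suc k * (a * d ^ k))))
    (≤-reflexive (expand a d (suc k) (d ^ k))))
    (*-monoʳ-≤ (a + d) (bernoulli a d k))
    where
    expand : ∀ a d k p → d * (d * p) + (1 + k) * (a * (d * p)) + a * (k * (a * p)) ≡ (a + d) * (d * p + k * (a * p))
    expand = solve-∀

  ^-distribʳ-* : ∀ a b k → (a * b) ^ k ≡ a ^ k * b ^ k
  ^-distribʳ-* a b zero    = refl
  ^-distribʳ-* a b (suc k) = trans (cong (a * b *_) (^-distribʳ-* a b k)) (swap a b (a ^ k) (b ^ k))
    where
    swap : ∀ a b c d → a * b * (c * d) ≡ a * c * (b * d)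
    swap = solve-∀

  cancel-≤ : ∀ {c a b} → 1 ≤ c → c * a ≤ c * b → a ≤ b
  cancel-≤ {suc c} {a} {b} _ h = *-cancelˡ-≤ (suc c) h

  -- Passing to a rectangle with counts a′, b′ loses at most as much of a as the ratio b / a gains, to the k-th power.
  density-step : ∀ {a₀ a b a′ b′} k → 1 ≤ k → 1 ≤ a → 1 ≤ b → a₀ * b ^ k ≤ a ^ suc k →
                 a * b + k * (b′ * a) ≤ k * (a′ * b) → a₀ * b′ ^ k ≤ a′ ^ suc k
  density-step {a₀} {a} {b} {a′} {b′} k 1≤k 1≤a 1≤b inv step =
    cancel-≤ {(k * a) ^ k * k} (*-mono-≤ (m^n>0′ {k * a} {k} (*-mono-≤ 1≤k 1≤a)) 1≤k) (≤-trans (≤-reflexive left)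
      (≤-trans (*-monoˡ-≤ k (≤-trans (*-monoʳ-≤ a₀ kab) (≤-reflexive (sym (*-assoc a₀ (b ^ k) (d ^ k))))))
      (≤-trans (*-monoˡ-≤ k (*-monoˡ-≤ (d ^ k) inv))
      (≤-trans (≤-reflexive (mid a k (a ^ k) (d ^ k)))
      (≤-trans (*-monoʳ-≤ (a ^ k) (≤-trans (≤-trans (*-monoˡ-≤ (a * d ^ k) (n≤1+n k)) (m≤n+m _ (d ^ suc k)))
        (bernoulli a d k)))
        (≤-reflexive right))))))
    where
    m^n>0′ : ∀ {m n} → 1 ≤ m → 1 ≤ m ^ n
    m^n>0′ {suc m} {n} _ = m^n>0 (suc m) n
    t = k * a′
    a≤t : a ≤ t
    a≤t = cancel-≤ 1≤b (≤-trans (≤-reflexive (*-comm b a)) (≤-trans (m≤m+n (a * b) (k * (b′ * a))) (≤-trans step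
            (≤-reflexive (assoc k a′ b)))))
      where
      assoc : ∀ k a b → k * (a * b) ≡ b * (k * a)
      assoc = solve-∀
    -- In terms of the slack `d` the hypothesis reads k a b′ ≤ b d. Its k-th power and `inv` reduce
    -- the claim to k a d^k ≤ (a + d)^(k + 1), a consequence of `bernoulli`.
    d = t ∸ a
    a+d≡t : a + d ≡ t
    a+d≡t = m+[n∸m]≡n a≤t
    kb′a≤db : (k * a) * b′ ≤ b * d
    kb′a≤db = +-cancelˡ-≤ (a * b) _ _ (≤-trans (≤-reflexive (cong (a * b +_) (assoc k a b′))) (≤-trans step
      (≤-reflexive (trans (sym (*-assoc k a′ b)) (trans (cong (_* b) (sym a+d≡t)) (distrib a d b))))))
      where
      assoc : ∀ k a b → k * a * b ≡ k * (b * a)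
      assoc = solve-∀
      distrib : ∀ a d b → (a + d) * b ≡ a * b + b * d
      distrib = solve-∀
    kab : (k * a) ^ k * b′ ^ k ≤ b ^ k * d ^ k
    kab = subst₂ _≤_ (^-distribʳ-* (k * a) b′ k) (^-distribʳ-* b d k) (^-monoˡ-≤ k kb′a≤db)
    left : (k * a) ^ k * k * (a₀ * b′ ^ k) ≡ a₀ * ((k * a) ^ k * b′ ^ k) * k
    left = arrange ((k * a) ^ k) k a₀ (b′ ^ k)
      where
      arrange : ∀ p k a q → p * k * (a * q) ≡ a * (p * q) * k
      arrange = solve-∀
    mid : ∀ a k p q → a * p * q * k ≡ p * (k * (a * q))
    mid = solve-∀
    right : a ^ k * (a + d) ^ suc k ≡ (k * a) ^ k * k * a′ ^ suc k
    right = trans (cong (λ z → a ^ k * z ^ suc k) a+d≡t) (trans (cong (a ^ k *_) (^-distribʳ-* k a′ (suc k)))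
      (trans (arrange (a ^ k) k (k ^ k) (a′ ^ suc k)) (cong (λ z → z * k * a′ ^ suc k) (sym (^-distribʳ-* k a k)))))
      where
      arrange : ∀ p k q r → p * (k * q * r) ≡ q * p * k * r
      arrange = solve-∀

  sumℕ-pos : (is : List I) {g : I → ℕ} → 1 ≤ sumℕ is g → Σ I λ i → (i ∈ is) × (1 ≤ g i)
  sumℕ-pos (i ∷ is) {g} h with g i in eq
  ... | suc k = i , here refl , subst (1 ≤_) (sym eq) (s≤s z≤n)
  ... | zero  = let j , m , p = sumℕ-pos is h in j , there m , p

  count-filter-≤ : ∀ σ (f : X → Y → Sign) (P : X → Bool) (Q : Y → Bool) xs ys →
                   count σ f (filterᵇ P xs) (filterᵇ Q ys) ≤ count σ f xs ys
  count-filter-≤ σ f P Q xs ys = ≤-trans (sumℕ-mono (filterᵇ P xs) (λ x _ → sumℕ-filter-≤ Q ys _))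
    (sumℕ-filter-≤ P xs _)

  Represents : (X → Y → Sign) → Terms X Y → List X → List Y → Set
  Represents f L xs ys = ∀ x y → x ∈ xs → y ∈ ys → signToℚ (f x y) ≡ ⟦ L ⟧ x y

  represents-sub : {f : X → Y → Sign} {L : Terms X Y} (P : X → Bool) (Q : Y → Bool) (xs : List X) (ys : List Y) →
                   Represents f L xs ys → Represents f L (filterᵇ P xs) (filterᵇ Q ys)
  represents-sub P Q xs ys h x y m n = h x y (proj₁ (∈-filterᵇ⁻ P xs m)) (proj₁ (∈-filterᵇ⁻ Q ys n))

  -- `a₀` is the number of plus entries at the start and `E` the ratio aimed at. The second
  -- component trades area for ratio: while b / a exceeds 1 / E, at least a₀ / E^D plus entries
  -- survive. The last step may overshoot, but it loses at most a factor `D`; hence the third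
  -- component.
  Invariant : (X → Y → Sign) → List X → List Y → ℕ → ℕ → ℕ → Set
  Invariant f xs ys a₀ D E =
    (1 ≤ count Sign.+ f xs ys) × (a₀ * count Sign.- f xs ys ^ D ≤ count Sign.+ f xs ys ^ suc D) ×
    (a₀ ≤ D * E ^ D * count Sign.+ f xs ys)

  -- `density-step` preserves the second component. As a < E b still holds before the step, that
  -- component gives a₀ ≤ E^D a, and the correlation gives a ≤ D a′. The minus count drops strictly
  -- because a′ ≤ a and the correlation has the surplus a b > 0.
  amplify-step : ∀ {m n} (f : Fin m → Fin n → Sign) (L : Terms (Fin m) (Fin n)) xs ys → Represents f L xs ys →
    ∀ {a₀} c D E → D ≡ 1024 * c → 1 ≤ c → 8 * length L ≤ c * c → Invariant f xs ys a₀ D E →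
    count Sign.+ f xs ys < E * count Sign.- f xs ys →
    Σ (Fin m → Bool) λ P → Σ (Fin n → Bool) λ Q → Invariant f (filterᵇ P xs) (filterᵇ Q ys) a₀ D E ×
    (count Sign.- f (filterᵇ P xs) (filterᵇ Q ys) < count Sign.- f xs ys)
  amplify-step f L xs ys rep {a₀} c D E D≡ 1≤c 8L (1≤a , inv , _) a<Eb =
    P , Q , (1≤a′ , density-step {a₀} {a} {b} {a′} {b′} D 1≤D 1≤a 1≤b inv step , a₀≤) , b′<b
    where
    1≤D : 1 ≤ D
    1≤D = subst (1 ≤_) (sym D≡) (*-mono-≤ {1} {1024} (s≤s z≤n) 1≤c)
    a = count Sign.+ f xs ys
    b = count Sign.- f xs ys
    1≤b : 1 ≤ b
    1≤b = pos b a<Eb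
      where
      pos : ∀ b → a < E * b → 1 ≤ b
      pos zero    h = ⊥-elim (n≮0 (subst (a <_) (*-zeroʳ E) h))
      pos (suc b) h = s≤s z≤n
    row = sumℕ-pos xs 1≤a
    col = sumℕ-pos ys (proj₂ (proj₂ row))
    found = discrepancy f L xs ys rep c 1≤c 8L (proj₁ (proj₂ col)) (proj₁ (proj₂ row)) 1≤a 1≤b
    P = proj₁ found
    Q = proj₁ (proj₂ found)
    a′ = count Sign.+ f (filterᵇ P xs) (filterᵇ Q ys)
    b′ = count Sign.- f (filterᵇ P xs) (filterᵇ Q ys)
    step : a * b + D * (b′ * a) ≤ D * (a′ * b)
    step = subst (λ D → a * b + D * (b′ * a) ≤ D * (a′ * b)) (sym D≡) (proj₂ (proj₂ found))
    a≤Da′ : a ≤ D * a′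
    a≤Da′ = cancel-≤ 1≤b (≤-trans (≤-reflexive (*-comm b a)) (≤-trans (m≤m+n (a * b) (D * (b′ * a)))
              (≤-trans step (≤-reflexive (assoc D a′ b)))))
      where
      assoc : ∀ k a b → k * (a * b) ≡ b * (k * a)
      assoc = solve-∀
    1≤a′ : 1 ≤ a′
    1≤a′ = pos a′ (≤-trans 1≤a a≤Da′)
      where
      pos : ∀ a′ → 1 ≤ D * a′ → 1 ≤ a′
      pos zero    h = ⊥-elim (n≮0 (subst (1 ≤_) (*-zeroʳ D) h))
      pos (suc _) h = s≤s z≤n
    a₀≤E^Da : a₀ ≤ E ^ D * a
    a₀≤E^Da = cancel-≤ {a ^ D} (positive a D 1≤a) (≤-trans (≤-reflexive (*-comm (a ^ D) a₀))
      (≤-trans (*-monoʳ-≤ a₀ (^-monoˡ-≤ D (<⇒≤ a<Eb))) (≤-trans (≤-reflexive (trans (cong (a₀ *_) (^-distribʳ-* E b D))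
        (swap a₀ (E ^ D) (b ^ D)))) (≤-trans (*-monoʳ-≤ (E ^ D) inv) (≤-reflexive (rotate (E ^ D) a (a ^ D)))))))
      where
      positive : ∀ m n → 1 ≤ m → 1 ≤ m ^ n
      positive (suc m) n _ = m^n>0 (suc m) n
      swap : ∀ a e b → a * (e * b) ≡ e * (a * b)
      swap = solve-∀
      rotate : ∀ e a p → e * (a * p) ≡ p * (e * a)
      rotate = solve-∀
    a₀≤ : a₀ ≤ D * E ^ D * a′
    a₀≤ = ≤-trans a₀≤E^Da (≤-trans (*-monoʳ-≤ (E ^ D) a≤Da′) (≤-reflexive (assoc (E ^ D) D a′)))
      where
      assoc : ∀ e d a → e * (d * a) ≡ d * e * a
      assoc = solve-∀
    b′<b : b′ < b
    b′<b = *-cancelˡ-< (D * a) b′ b (<-≤-trans (s≤s (≤-reflexive (assoc D a b′)))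
      (≤-trans (+-monoˡ-≤ (D * (b′ * a)) (*-mono-≤ 1≤a 1≤b)) (≤-trans step
        (≤-trans (*-monoʳ-≤ D (*-monoˡ-≤ b (count-filter-≤ Sign.+ f P Q xs ys))) (≤-reflexive (sym (*-assoc D a b)))))))
      where
      assoc : ∀ d a b → d * a * b ≡ d * (b * a)
      assoc = solve-∀

  -- The minus count drops with every step and serves as `fuel`. A rectangle within a rectangle is
  -- described by conjunctions of predicates.
  amplify : ∀ {m n} (f : Fin m → Fin n → Sign) (L : Terms (Fin m) (Fin n)) xs ys → Represents f L xs ys →
    ∀ {a₀} c D E → D ≡ 1024 * c → 1 ≤ c → 8 * length L ≤ c * c → ∀ fuel → count Sign.- f xs ys ≤ fuel →
    Invariant f xs ys a₀ D E →
    Σ (Fin m → Bool) λ P → Σ (Fin n → Bool) λ Q → Invariant f (filterᵇ P xs) (filterᵇ Q ys) a₀ D E ×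
    (E * count Sign.- f (filterᵇ P xs) (filterᵇ Q ys) ≤ count Sign.+ f (filterᵇ P xs) (filterᵇ Q ys))
  amplify {m} {n} f L xs ys rep {a₀} c D E D≡ 1≤c 8L fuel b≤fuel inv = decide
    (≤-total (E * count Sign.- f xs ys) (count Sign.+ f xs ys))
    where
    Dense : List (Fin m) → List (Fin n) → Set
    Dense xs ys = Invariant f xs ys a₀ D E × (E * count Sign.- f xs ys ≤ count Sign.+ f xs ys)
    Result : Set
    Result = Σ (Fin m → Bool) λ P → Σ (Fin n → Bool) λ Q → Dense (filterᵇ P xs) (filterᵇ Q ys)
    stop : Dense xs ys → Result
    stop d = (λ _ → true) , (λ _ → true) , subst₂ Dense (sym (filterᵇ-all xs)) (sym (filterᵇ-all ys)) d
    continue : ∀ fuel → count Sign.- f xs ys ≤ fuel → (P : Fin m → Bool) (Q : Fin n → Bool) →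
               Invariant f (filterᵇ P xs) (filterᵇ Q ys) a₀ D E →
               count Sign.- f (filterᵇ P xs) (filterᵇ Q ys) < count Sign.- f xs ys → Result
    continue zero       b≤fuel P Q inv′ b′<b = ⊥-elim (n≮0 (<-≤-trans b′<b b≤fuel))
    continue (suc fuel) b≤fuel P Q inv′ b′<b =
      let P′ , Q′ , d = amplify f L (filterᵇ P xs) (filterᵇ Q ys) (represents-sub {f = f} {L} P Q xs ys rep) c D E D≡
            1≤c 8L fuel
                          (≤-pred (<-≤-trans b′<b b≤fuel)) inv′
      in (λ i → P i ∧ P′ i) , (λ j → Q j ∧ Q′ j) , subst₂ Dense (filterᵇ-∘ P′ P xs) (filterᵇ-∘ Q′ Q ys) d
    decide : (E * count Sign.- f xs ys ≤ count Sign.+ f xs ys) ⊎ (count Sign.+ f xs ys ≤ E * count Sign.- f xs ys) →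
      Result
    decide (inj₁ done)  = stop (inv , done)
    decide (inj₂ a≤Eb) = case-eq (m≤n⇒m<n∨m≡n a≤Eb)
      where
      case-eq : (count Sign.+ f xs ys < E * count Sign.- f xs ys) ⊎ (count Sign.+ f xs ys ≡ E * count Sign.- f xs ys)
        → Result
      case-eq (inj₁ a<Eb) =
        let P , Q , inv′ , b′<b = amplify-step f L xs ys rep c D E D≡ 1≤c 8L inv a<Eb
        in continue fuel b≤fuel P Q inv′ b′<b
      case-eq (inj₂ a≡Eb) = stop (inv , ≤-reflexive (sym a≡Eb))

  all-plus : (X → Y → Sign) → List X → Y → Bool
  all-plus f []       y = true
  all-plus f (s ∷ ss) y with f s y
  ... | Sign.+ = all-plus f ss y
  ... | Sign.- = false

  all-plus⇒plus : (f : X → Y → Sign) (ss : List X) (y : Y) → all-plus f ss y ≡ true → ∀ s → s ∈ ss → f s y ≡ Sign.+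
  all-plus⇒plus f (s ∷ ss) y e t m with f s y in eq
  all-plus⇒plus f (s ∷ ss) y e t (here refl) | Sign.+ = eq
  all-plus⇒plus f (s ∷ ss) y e t (there m)   | Sign.+ = all-plus⇒plus f ss y e t m

  -- Every removed column has a minus in some row of `ss`; these minuses are then counted by rows.
  removed-columns : (f : X → Y → Sign) (ss : List X) (ys : List Y) →
    length (filterᵇ (λ y → not (all-plus f ss y)) ys) ≤ sumℕ ss (λ s → rowCount Sign.- f s ys)
  removed-columns f ss ys = ≤-trans (column ys) (≤-reflexive (swap ss ys))
    where
    bad : ∀ y → ℕ
    bad y = sumℕ ss (λ s → indicator Sign.- (f s y))
    not-all : ∀ ss y → all-plus f ss y ≡ false → 1 ≤ sumℕ ss (λ s → indicator Sign.- (f s y))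
    not-all (s ∷ ss) y e with f s y
    ... | Sign.+ = not-all ss y e
    ... | Sign.- = s≤s z≤n
    column : ∀ ys → length (filterᵇ (λ y → not (all-plus f ss y)) ys) ≤ sumℕ ys bad
    column []       = z≤n
    column (y ∷ ys) with all-plus f ss y in eq
    ... | true  = ≤-trans (column ys) (m≤n+m _ (bad y))
    ... | false = +-mono-≤ (not-all ss y eq) (column ys)
    swap : ∀ ss ys → sumℕ ys (λ y → sumℕ ss (λ s → indicator Sign.- (f s y))) ≡ sumℕ ss (λ s → rowCount Sign.- f s ys)
    swap []       ys = trans (sumℕ-const ys 0) (*-zeroʳ (length ys))
    swap (s ∷ ss) ys = trans (sumℕ-+ ys _ _) (cong (rowCount Sign.- f s ys +_) (swap ss ys))

  rowCount-full : ∀ (f : X → Y → Sign) x ys → (∀ y → y ∈ ys → f x y ≡ Sign.-) → length ys ≤ rowCount Sign.- f x ys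
  rowCount-full f x ys h = ≤-trans (≤-reflexive (sym (trans (sumℕ-const ys 1) (*-identityʳ (length ys)))))
    (sumℕ-mono ys (λ y m → ≤-reflexive (cong (indicator Sign.-) (sym (h y m)))))

  signToℚ-injective : ∀ σ τ → signToℚ σ ≡ signToℚ τ → σ ≡ τ
  signToℚ-injective Sign.+ Sign.+ _ = refl
  signToℚ-injective Sign.- Sign.- _ = refl

  nonempty : {ys : List Y} {y : Y} → y ∈ ys → 1 ≤ length ys
  nonempty (here _)  = s≤s z≤n
  nonempty (there _) = s≤s z≤n

  -- By averaging, at least half of the rows have minuses in at most n / 4e of the n columns. At
  -- most `e` of these rows determine the columns on all of them, and dropping the columns with a
  -- minus in a determining row costs at most n / 4. The columns left agree on the determining rows,
  -- hence on every kept row. A kept row is therefore constant there, and constant minus would mean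
  -- 3n / 4 minuses.
  monochromatic : (f : X → Y → Sign) (L : Terms X Y) (xs : List X) (ys : List Y) → Represents f L xs ys →
    ∀ e → 1 ≤ e → length L ≤ e → 1 ≤ length ys → 8 * e * count Sign.- f xs ys ≤ length xs * length ys →
    Σ (X → Bool) λ P → Σ (Y → Bool) λ Q → (∀ x y → x ∈ filterᵇ P xs → y ∈ filterᵇ Q ys → f x y ≡ Sign.+) ×
    (length xs ≤ 2 * length (filterᵇ P xs)) × (length ys ≤ 2 * length (filterᵇ Q ys))
  monochromatic {X} {Y} f L xs ys rep e 1≤e L≤e 1≤n 8eb =
    P , Q , mono , rows , cols
    where
    n = length ys
    few : ∀ x → Σ Bool λ p → (p ≡ true → 4 * e * rowCount Sign.- f x ys ≤ n) ×
                             (not p ≡ true → n ≤ 4 * e * rowCount Sign.- f x ys)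
    few x with ≤-total (4 * e * rowCount Sign.- f x ys) n
    ... | inj₁ h = true , (λ _ → h) , λ ()
    ... | inj₂ h = false , (λ ()) , λ _ → h
    P : X → Bool
    P x = proj₁ (few x)
    xs⁺ = filterᵇ P xs
    xs⁻ = filterᵇ (λ x → not (P x)) xs
    bad-rows : length xs⁻ * n ≤ 4 * e * count Sign.- f xs ys
    bad-rows = ≤-trans (≤-reflexive (sym (sumℕ-const xs⁻ n))) (≤-trans
      (sumℕ-mono xs⁻ (λ x m → proj₂ (proj₂ (few x)) (proj₂ (∈-filterᵇ⁻ (λ x → not (P x)) xs m))))
      (≤-trans (≤-reflexive (sumℕ-*ˡ xs⁻ (4 * e) _)) (*-monoʳ-≤ (4 * e) (sumℕ-filter-≤ (λ x → not (P x)) xs _))))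
    2bad≤ : 2 * length xs⁻ ≤ length xs
    2bad≤ = cancel-≤ 1≤n (≤-trans (≤-reflexive (arrange n (length xs⁻))) (≤-trans (*-monoʳ-≤ 2 bad-rows)
      (≤-trans (≤-reflexive (double e (count Sign.- f xs ys))) (≤-trans 8eb (≤-reflexive (*-comm (length xs) n))))))
      where
      arrange : ∀ n l → n * (2 * l) ≡ 2 * (l * n)
      arrange = solve-∀
      double : ∀ e b → 2 * (4 * e * b) ≡ 8 * e * b
      double = solve-∀
    rows : length xs ≤ 2 * length xs⁺
    rows = +-cancelʳ-≤ (length xs) _ _ (≤-trans (≤-reflexive (trans (cong (λ z → z + z) (length-split P xs))
      (arrange (length xs⁺) (length xs⁻))))
      (+-monoʳ-≤ (2 * length xs⁺) 2bad≤))
      where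
      arrange : ∀ a b → a + b + (a + b) ≡ 2 * a + 2 * b
      arrange = solve-∀
    det = determining-rows (length L) L refl xs⁺
    ss = proj₁ det
    Q : Y → Bool
    Q = all-plus f ss
    ys⁺ = filterᵇ Q ys
    ys⁻ = filterᵇ (λ y → not (Q y)) ys
    removed : 4 * length ys⁻ ≤ n
    removed = cancel-≤ 1≤e (≤-trans (≤-reflexive (arrange e (length ys⁻)))
      (≤-trans (*-monoʳ-≤ (4 * e) (removed-columns f ss ys))
      (≤-trans (≤-reflexive (sym (sumℕ-*ˡ ss (4 * e) _))) (≤-trans
        (sumℕ-mono ss (λ s m → proj₁ (proj₂ (few s)) (proj₂ (∈-filterᵇ⁻ P xs (proj₁ (proj₂ (proj₂ det)) s m)))))
        (≤-trans (≤-reflexive (sumℕ-const ss n)) (*-monoˡ-≤ n (≤-trans (proj₁ (proj₂ det)) L≤e)))))))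
      where
      arrange : ∀ e l → e * (4 * l) ≡ 4 * e * l
      arrange = solve-∀
    3n≤ : 3 * n ≤ 4 * length ys⁺
    3n≤ = +-cancelʳ-≤ n _ _ (≤-trans (≤-reflexive (trans (four n) (trans (cong (4 *_) (length-split Q ys))
      (*-distribˡ-+ 4 (length ys⁺) (length ys⁻))))) (+-monoʳ-≤ (4 * length ys⁺) removed))
      where
      four : ∀ n → 3 * n + n ≡ 4 * n
      four = solve-∀
    cols : n ≤ 2 * length ys⁺
    cols = *-cancelˡ-≤ 2 (≤-trans (*-monoˡ-≤ n {2} {3} (s≤s (s≤s z≤n)))
      (≤-trans 3n≤ (≤-reflexive (arrange (length ys⁺)))))
      where
      arrange : ∀ l → 4 * l ≡ 2 * (2 * l)
      arrange = solve-∀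
    constant : ∀ x → x ∈ xs⁺ → ∀ y y′ → y ∈ ys⁺ → y′ ∈ ys⁺ → f x y ≡ f x y′
    constant x m y y′ p p′ = signToℚ-injective _ _ (trans (rep x y (∈xs m) (∈ys p)) (trans
      (proj₂ (proj₂ (proj₂ det)) y y′ (λ s q → let s∈ = ∈xs (proj₁ (proj₂ (proj₂ det)) s q) in
        trans (sym (rep s y s∈ (∈ys p))) (trans (cong signToℚ (trans (all-plus⇒plus f ss y (is-Q p) s q)
          (sym (all-plus⇒plus f ss y′ (is-Q p′) s q)))) (rep s y′ s∈ (∈ys p′)))) x m)
      (sym (rep x y′ (∈xs m) (∈ys p′)))))
      where
      ∈xs : ∀ {x} → x ∈ xs⁺ → x ∈ xs
      ∈xs m = proj₁ (∈-filterᵇ⁻ P xs m)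
      ∈ys : ∀ {y} → y ∈ ys⁺ → y ∈ ys
      ∈ys m = proj₁ (∈-filterᵇ⁻ Q ys m)
      is-Q : ∀ {y} → y ∈ ys⁺ → Q y ≡ true
      is-Q m = proj₂ (∈-filterᵇ⁻ Q ys m)
    mono : ∀ x y → x ∈ xs⁺ → y ∈ ys⁺ → f x y ≡ Sign.+
    mono x y m p with f x y in eq
    ... | Sign.+ = refl
    ... | Sign.- = ⊥-elim (<⇒≱ (*-monoˡ-< n {{>-nonZero 1≤n}} 1<3) (≤-trans 3n≤ (≤-trans
        (*-monoʳ-≤ 4 (≤-trans (rowCount-full f x ys⁺ (λ y′ p′ → trans (sym (constant x m y y′ p p′)) eq))
          (sumℕ-filter-≤ Q ys _)))
        (≤-trans (≤-trans (*-monoˡ-≤ (rowCount Sign.- f x ys) (*-monoʳ-≤ 4 1≤e))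
          (proj₁ (proj₂ (few x)) (proj₂ (∈-filterᵇ⁻ P xs m)))) (≤-reflexive (sym (*-identityˡ n)))))))
      where
      1<3 : 1 < 3
      1<3 = s≤s (s≤s z≤n)

  flip-terms : Terms X Y → Terms X Y
  flip-terms = map (λ t → (λ x → ℚ.- proj₁ t x) , proj₂ t)

  flip-represents : (f : X → Y → Sign) (L : Terms X Y) (xs : List X) (ys : List Y) → Represents f L xs ys →
                    Represents (λ x y → opposite (f x y)) (flip-terms L) xs ys
  flip-represents f L xs ys rep x y m n = trans (sign (f x y)) (trans (cong ℚ.-_ (rep x y m n)) (sym (eval L)))
    where
    sign : ∀ σ → signToℚ (opposite σ) ≡ ℚ.- signToℚ σ
    sign Sign.+ = refl
    sign Sign.- = refl
    arrange : ∀ a b c → (ℚ.- a) ℚ.* b ℚ.+ (ℚ.- c) ≡ ℚ.- (a ℚ.* b ℚ.+ c)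
    arrange = Ring.solve-∀ ℚ-ring
    eval : ∀ L → ⟦ flip-terms L ⟧ x y ≡ ℚ.- ⟦ L ⟧ x y
    eval []      = refl
    eval (t ∷ L) = trans (cong ((ℚ.- proj₁ t x) ℚ.* proj₂ t y ℚ.+_) (eval L))
      (arrange (proj₁ t x) (proj₂ t y) (⟦ L ⟧ x y))

  count-opposite : ∀ σ (f : X → Y → Sign) xs ys → count σ (λ x y → opposite (f x y)) xs ys ≡ count (opposite σ) f xs ys
  count-opposite σ f xs ys = sumℕ-cong xs (λ x → sumℕ-cong ys (λ y → single σ (f x y)))
    where
    single : ∀ σ τ → indicator σ (opposite τ) ≡ indicator (opposite σ) τ
    single Sign.+ Sign.+ = refl
    single Sign.+ Sign.- = refl
    single Sign.- Sign.+ = refl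
    single Sign.- Sign.- = refl

  LargeMonochromatic : ∀ {m n} → (Fin m → Fin n → Sign) → List (Fin m) → List (Fin n) → ℕ → Sign → Set
  LargeMonochromatic {m} {n} f xs ys T σ = Σ (Fin m → Bool) λ P → Σ (Fin n → Bool) λ Q →
    (∀ x y → x ∈ filterᵇ P xs → y ∈ filterᵇ Q ys → f x y ≡ σ) ×
    (length xs ≤ T * length (filterᵇ P xs)) × (length ys ≤ T * length (filterᵇ Q ys))

  -- A majority of pluses makes the area at most 2a, and amplification keeps a ≤ T₀ a₁, so area and
  -- hence each side shrink by at most 2T₀. `monochromatic` halves each side once more; its
  -- hypothesis is the reason for E = 8e.
  majority-plus : ∀ {m n} (f : Fin m → Fin n → Sign) (L : Terms (Fin m) (Fin n)) (xs : List (Fin m))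
    (ys : List (Fin n)) →
    Represents f L xs ys → ∀ c D e → D ≡ 1024 * c → 1 ≤ c → 8 * length L ≤ c * c → 1 ≤ e → length L ≤ e →
    1 ≤ length xs → 1 ≤ length ys → count Sign.- f xs ys ≤ count Sign.+ f xs ys →
    LargeMonochromatic f xs ys (4 * (D * (8 * e) ^ D)) Sign.+
  majority-plus {m} {n} f L xs ys rep c D e D≡ 1≤c 8L 1≤e L≤e 1≤xs 1≤ys b≤a =
    (λ i → P i ∧ P′ i) , (λ j → Q j ∧ Q′ j) ,
    subst₂ Big (filterᵇ-∘ P′ P xs) (filterᵇ-∘ Q′ Q ys) (proj₁ (proj₂ (proj₂ final)) , big-rows , big-cols)
    where
    E = 8 * e
    T₀ = D * E ^ D
    a = count Sign.+ f xs ys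
    b = count Sign.- f xs ys
    area = length xs * length ys
    Big : List (Fin m) → List (Fin n) → Set
    Big xs′ ys′ = (∀ x y → x ∈ xs′ → y ∈ ys′ → f x y ≡ Sign.+) ×
      (length xs ≤ 4 * T₀ * length xs′) × (length ys ≤ 4 * T₀ * length ys′)
    area≤2a : area ≤ 2 * a
    area≤2a = ≤-trans (≤-reflexive (sym (count-total f xs ys))) (≤-trans (+-monoʳ-≤ a b≤a)
                (≤-reflexive (cong (a +_) (sym (+-identityʳ a)))))
    1≤a : 1 ≤ a
    1≤a = pos a (≤-trans (*-mono-≤ 1≤xs 1≤ys) area≤2a)
      where
      pos : ∀ a → 1 ≤ 2 * a → 1 ≤ a
      pos (suc a) _ = s≤s z≤n
    1≤D : 1 ≤ D
    1≤D = subst (1 ≤_) (sym D≡) (*-mono-≤ {1} {1024} (s≤s z≤n) 1≤c)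
    1≤E^ : ∀ k → 1 ≤ E ^ k
    1≤E^ zero    = ≤-refl
    1≤E^ (suc k) = *-mono-≤ (*-mono-≤ {1} {8} (s≤s z≤n) 1≤e) (1≤E^ k)
    start : Invariant f xs ys a D E
    start = 1≤a , *-monoʳ-≤ a (^-monoˡ-≤ D b≤a) ,
      ≤-trans (≤-reflexive (sym (*-identityˡ a))) (*-monoˡ-≤ a (*-mono-≤ 1≤D (1≤E^ D)))
    dense = amplify f L xs ys rep c D E D≡ 1≤c 8L b ≤-refl start
    P = proj₁ dense
    Q = proj₁ (proj₂ dense)
    xs₁ = filterᵇ P xs
    ys₁ = filterᵇ Q ys
    a₁ = count Sign.+ f xs₁ ys₁
    a≤T₀a₁ : a ≤ T₀ * a₁
    a≤T₀a₁ = proj₂ (proj₂ (proj₁ (proj₂ (proj₂ dense))))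
    1≤a₁ : 1 ≤ a₁
    1≤a₁ = proj₁ (proj₁ (proj₂ (proj₂ dense)))
    row = sumℕ-pos xs₁ 1≤a₁
    col = sumℕ-pos ys₁ (proj₂ (proj₂ row))
    final = monochromatic f L xs₁ ys₁ (represents-sub {f = f} {L} P Q xs ys rep) e 1≤e L≤e
      (nonempty (proj₁ (proj₂ col)))
              (≤-trans (proj₂ (proj₂ (proj₂ dense))) (count≤area Sign.+ f xs₁ ys₁))
    P′ = proj₁ final
    Q′ = proj₁ (proj₂ final)
    area≤ : area ≤ 2 * T₀ * (length xs₁ * length ys₁)
    area≤ = ≤-trans area≤2a (≤-trans (*-monoʳ-≤ 2 (≤-trans a≤T₀a₁ (*-monoʳ-≤ T₀ (count≤area Sign.+ f xs₁ ys₁))))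
              (≤-reflexive (sym (*-assoc 2 T₀ _))))
    xs≤ : length xs ≤ 2 * T₀ * length xs₁
    xs≤ = cancel-≤ 1≤ys (≤-trans (≤-reflexive (*-comm (length ys) (length xs))) (≤-trans area≤
      (≤-trans (*-monoʳ-≤ (2 * T₀) (*-monoʳ-≤ (length xs₁) (length-filterᵇ-≤ Q ys)))
        (≤-reflexive (arrange (2 * T₀) (length xs₁) (length ys))))))
      where
      arrange : ∀ t a b → t * (a * b) ≡ b * (t * a)
      arrange = solve-∀
    ys≤ : length ys ≤ 2 * T₀ * length ys₁
    ys≤ = cancel-≤ 1≤xs (≤-trans area≤
      (≤-trans (*-monoʳ-≤ (2 * T₀) (*-monoˡ-≤ (length ys₁) (length-filterᵇ-≤ P xs)))
        (≤-reflexive (arrange (2 * T₀) (length xs) (length ys₁)))))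
      where
      arrange : ∀ t a b → t * (a * b) ≡ a * (t * b)
      arrange = solve-∀
    chain : ∀ {p q r} → p ≤ 2 * T₀ * q → q ≤ 2 * r → p ≤ 4 * T₀ * r
    chain {p} {q} {r} h₁ h₂ = ≤-trans h₁ (≤-trans (*-monoʳ-≤ (2 * T₀) h₂) (≤-reflexive (arrange T₀ r)))
      where
      arrange : ∀ t r → 2 * t * (2 * r) ≡ 4 * t * r
      arrange = solve-∀
    big-rows : length xs ≤ 4 * T₀ * length (filterᵇ P′ xs₁)
    big-rows = chain {q = length xs₁} xs≤ (proj₁ (proj₂ (proj₂ (proj₂ final))))
    big-cols : length ys ≤ 4 * T₀ * length (filterᵇ Q′ ys₁)
    big-cols = chain {q = length ys₁} ys≤ (proj₂ (proj₂ (proj₂ (proj₂ final))))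

  large-monochromatic : ∀ {m n} (f : Fin m → Fin n → Sign) (L : Terms (Fin m) (Fin n)) (xs : List (Fin m))
    (ys : List (Fin n)) →
    Represents f L xs ys → ∀ c D e → D ≡ 1024 * c → 1 ≤ c → 8 * length L ≤ c * c → 1 ≤ e → length L ≤ e →
    1 ≤ length xs → 1 ≤ length ys → Σ Sign (LargeMonochromatic f xs ys (4 * (D * (8 * e) ^ D)))
  large-monochromatic f L xs ys rep c D e D≡ 1≤c 8L 1≤e L≤e 1≤xs 1≤ys
    with ≤-total (count Sign.- f xs ys) (count Sign.+ f xs ys)
  ... | inj₁ b≤a = Sign.+ , majority-plus f L xs ys rep c D e D≡ 1≤c 8L 1≤e L≤e 1≤xs 1≤ys b≤a
  ... | inj₂ a≤b =
    let P , Q , mono , rest = majority-plus (λ x y → opposite (f x y)) (flip-terms L) xs ys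
          (flip-represents f L xs ys rep)
          c D e D≡ 1≤c (subst (λ l → 8 * l ≤ c * c) (sym (length-map _ L)) 8L) 1≤e
          (subst (_≤ e) (sym (length-map _ L)) L≤e) 1≤xs 1≤ys
          (subst₂ _≤_ (sym (count-opposite Sign.- f xs ys)) (sym (count-opposite Sign.+ f xs ys)) a≤b)
    in Sign.- , P , Q , (λ x y m n → un-opposite (f x y) (mono x y m n)) , rest
    where
    un-opposite : ∀ σ → opposite σ ≡ Sign.+ → σ ≡ Sign.-
    un-opposite Sign.- _ = refl

-- Protocols that peel off bands of rows and columns.

module Protocols where
  open import Data.Empty using (⊥; ⊥-elim)
  open import Data.Bool using (Bool; true; false; not; T)
  open import Data.Sum using (_⊎_; inj₁; inj₂)
  open import Data.Product using (Σ; _×_; _,_)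
  open import Data.List using (List; []; _∷_; length; filterᵇ)
  open import Data.List.Membership.Propositional using (_∈_)
  open import Data.Nat
  open import Data.Nat.Properties
  open import Data.Nat.Tactic.RingSolver using (solve-∀)
  open import Data.Sign as Sign using ()
  open import Data.Rational as ℚ using (ℚ)
  open import Relation.Binary.PropositionalEquality hiding (J)
  open import Defs
  open Factorisation
  open Counting
  open MonochromaticRectangles

  private variable
    X Y X′ Y′ A : Set

  Solves : (X → Y → A) → List X → List Y → ℕ → Protocol X Y A → Set
  Solves f xs ys c π = ∀ x y → x ∈ xs → y ∈ ys → (run π x y ≡ f x y) × (bits π x y ≤ c)

  relabel : (X → X′) → (Y → Y′) → Protocol X′ Y′ A → Protocol X Y A
  relabel φ ψ (leaf a)      = leaf a
  relabel φ ψ (alice g p q) = alice (λ x → g (φ x)) (relabel φ ψ p) (relabel φ ψ q)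
  relabel φ ψ (bob h p q)   = bob (λ y → h (ψ y)) (relabel φ ψ p) (relabel φ ψ q)

  relabel-run : (φ : X → X′) (ψ : Y → Y′) (π : Protocol X′ Y′ A) → ∀ x y → run (relabel φ ψ π) x y ≡ run π (φ x) (ψ y)
  relabel-run φ ψ (leaf a)      x y = refl
  relabel-run φ ψ (alice g p q) x y with g (φ x)
  ... | true  = relabel-run φ ψ p x y
  ... | false = relabel-run φ ψ q x y
  relabel-run φ ψ (bob h p q)   x y with h (ψ y)
  ... | true  = relabel-run φ ψ p x y
  ... | false = relabel-run φ ψ q x y

  relabel-bits : (φ : X → X′) (ψ : Y → Y′) (π : Protocol X′ Y′ A) → ∀ x y → bits (relabel φ ψ π) x y ≡ bits π (φ x)
    (ψ y)
  relabel-bits φ ψ (leaf a)      x y = refl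
  relabel-bits φ ψ (alice g p q) x y with g (φ x)
  ... | true  = cong suc (relabel-bits φ ψ p x y)
  ... | false = cong suc (relabel-bits φ ψ q x y)
  relabel-bits φ ψ (bob h p q)   x y with h (ψ y)
  ... | true  = cong suc (relabel-bits φ ψ p x y)
  ... | false = cong suc (relabel-bits φ ψ q x y)

  ≤ᵇ-true : ∀ {m n} → (m ≤ᵇ n) ≡ true → m ≤ n
  ≤ᵇ-true {m} {n} e = ≤ᵇ⇒≤ m n (subst T (sym e) _)

  ≤ᵇ-false : ∀ {m n} → (m ≤ᵇ n) ≡ false → n < m
  ≤ᵇ-false {m} {n} e = ≰⇒> (λ h → subst T e (≤⇒≤ᵇ h))

  below : ∀ {v} k → v < 2 ^ suc k → v ∸ 2 ^ k < 2 ^ k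
  below {v} k h = m<n+o⇒m∸n<o v (2 ^ k) {{m^n≢0 2 k}} (subst (v <_) (cong (2 ^ k +_) (+-identityʳ (2 ^ k))) h)

  -- A number below 2^k is sent in binary, most significant digit first; `κ` is the continuation
  -- once both players know it.
  alice-sends : ℕ → (X → ℕ) → (ℕ → Protocol X Y A) → Protocol X Y A
  alice-sends zero    g κ = κ 0
  alice-sends (suc k) g κ = alice (λ x → 2 ^ k ≤ᵇ g x)
    (alice-sends k (λ x → g x ∸ 2 ^ k) (λ v → κ (2 ^ k + v))) (alice-sends k g κ)

  bob-sends : ℕ → (Y → ℕ) → (ℕ → Protocol X Y A) → Protocol X Y A
  bob-sends zero    g κ = κ 0
  bob-sends (suc k) g κ = bob (λ y → 2 ^ k ≤ᵇ g y)
    (bob-sends k (λ y → g y ∸ 2 ^ k) (λ v → κ (2 ^ k + v))) (bob-sends k g κ)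

  alice-sends-spec : ∀ k (g : X → ℕ) (κ : ℕ → Protocol X Y A) x y → g x < 2 ^ k →
    (run (alice-sends k g κ) x y ≡ run (κ (g x)) x y) × (bits (alice-sends k g κ) x y ≡ k + bits (κ (g x)) x y)
  alice-sends-spec zero g κ x y h with g x | h
  ... | zero | _ = refl , refl
  ... | suc _ | s≤s ()
  alice-sends-spec (suc k) g κ x y h with 2 ^ k ≤ᵇ g x in eq
  ... | false = let r , b = alice-sends-spec k g κ x y (≤ᵇ-false eq) in r , cong suc b
  ... | true  =
    let r , b = alice-sends-spec k (λ x → g x ∸ 2 ^ k) (λ v → κ (2 ^ k + v)) x y (below k h)
        e = m+[n∸m]≡n (≤ᵇ-true {2 ^ k} {g x} eq)
    in trans r (cong (λ v → run (κ v) x y) e) , cong suc (trans b (cong (λ v → k + bits (κ v) x y) e))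

  bob-sends-spec : ∀ k (g : Y → ℕ) (κ : ℕ → Protocol X Y A) x y → g y < 2 ^ k →
    (run (bob-sends k g κ) x y ≡ run (κ (g y)) x y) × (bits (bob-sends k g κ) x y ≡ k + bits (κ (g y)) x y)
  bob-sends-spec zero g κ x y h with g y | h
  ... | zero | _ = refl , refl
  ... | suc _ | s≤s ()
  bob-sends-spec (suc k) g κ x y h with 2 ^ k ≤ᵇ g y in eq
  ... | false = let r , b = bob-sends-spec k g κ x y (≤ᵇ-false eq) in r , cong suc b
  ... | true  =
    let r , b = bob-sends-spec k (λ y → g y ∸ 2 ^ k) (λ v → κ (2 ^ k + v)) x y (below k h)
        e = m+[n∸m]≡n (≤ᵇ-true {2 ^ k} {g y} eq)
    in trans r (cong (λ v → run (κ v) x y) e) , cong suc (trans b (cong (λ v → k + bits (κ v) x y) e))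

  data Exit (X Y A : Set) : Set where
    rows    : (X → Bool) → Protocol X Y A → Exit X Y A
    columns : (Y → Bool) → Protocol X Y A → Exit X Y A

  -- The position counts exits of both kinds, which makes it comparable with `first-column`, yet it
  -- depends on `x` alone. The length of the list means that no exit of rows applies.
  first-row : List (Exit X Y A) → X → ℕ
  first-row []              x = 0
  first-row (rows P _ ∷ s)  x with P x
  ... | true  = 0
  ... | false = suc (first-row s x)
  first-row (columns _ _ ∷ s) x = suc (first-row s x)

  first-column : List (Exit X Y A) → Y → ℕ
  first-column []                y = 0
  first-column (rows _ _ ∷ s)    y = suc (first-column s y)
  first-column (columns Q _ ∷ s) y with Q y
  ... | true  = 0
  ... | false = suc (first-column s y)

  first-row≤length : (s : List (Exit X Y A)) (x : X) → first-row s x ≤ length s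
  first-row≤length []                x = z≤n
  first-row≤length (rows P _ ∷ s)    x with P x
  ... | true  = z≤n
  ... | false = s≤s (first-row≤length s x)
  first-row≤length (columns _ _ ∷ s) x = s≤s (first-row≤length s x)

  first-column≤length : (s : List (Exit X Y A)) (y : Y) → first-column s y ≤ length s
  first-column≤length []                y = z≤n
  first-column≤length (rows _ _ ∷ s)    y = s≤s (first-column≤length s y)
  first-column≤length (columns Q _ ∷ s) y with Q y
  ... | true  = z≤n
  ... | false = s≤s (first-column≤length s y)

  -- The default is met only past the end of the list, where `Exhausts` leaves no input.
  select : A → List (Exit X Y A) → ℕ → Protocol X Y A
  select a []                _       = leaf a
  select a (rows _ π ∷ s)    zero    = π
  select a (columns _ π ∷ s) zero    = π
  select a (_ ∷ s)           (suc i) = select a s i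

  -- Each protocol answers for its band only within what the earlier exits have left; this is why
  -- the first exit that applies has to be taken.
  Exhausts : (X → Y → A) → ℕ → List (Exit X Y A) → List X → List Y → Set
  Exhausts f c []                xs ys = ∀ x y → x ∈ xs → y ∈ ys → ⊥
  Exhausts f c (rows P π ∷ s)    xs ys = Solves f (filterᵇ P xs) ys c π × Exhausts f c s
    (filterᵇ (λ x → not (P x)) xs) ys
  Exhausts f c (columns Q π ∷ s) xs ys = Solves f xs (filterᵇ Q ys) c π × Exhausts f c s xs
    (filterᵇ (λ y → not (Q y)) ys)

  select-solves : (a : A) (f : X → Y → A) (c : ℕ) (s : List (Exit X Y A)) (xs : List X) (ys : List Y) → Exhausts f c
    s xs ys →
    ∀ x y → x ∈ xs → y ∈ ys → let π = select a s (first-row s x ⊓ first-column s y) in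
    (run π x y ≡ f x y) × (bits π x y ≤ c)
  select-solves a f c [] xs ys ex x y m n = ⊥-elim (ex x y m n)
  select-solves a f c (rows P π ∷ s) xs ys (sol , ex) x y m n with P x in eq
  ... | true  = sol x y (∈-filterᵇ⁺ P xs m eq) n
  ... | false = select-solves a f c s _ ys ex x y (∈-filterᵇ⁺ (λ x → not (P x)) xs m (cong not eq)) n
  select-solves a f c (columns Q π ∷ s) xs ys (sol , ex) x y m n with Q y in eq
  ... | true  = sol x y m (∈-filterᵇ⁺ Q ys n eq)
  ... | false = select-solves a f c s xs _ ex x y m (∈-filterᵇ⁺ (λ y → not (Q y)) ys n (cong not eq))

  -- Each player alone knows the first exit of his or her own kind that applies; the earlier of the two is the one taken.
  exit-protocol : A → ℕ → List (Exit X Y A) → Protocol X Y A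
  exit-protocol a k s = alice-sends k (first-row s) λ i → bob-sends k (first-column s) λ j → select a s (i ⊓ j)

  exit-protocol-solves : (a : A) (f : X → Y → A) (c k : ℕ) (s : List (Exit X Y A)) (xs : List X) (ys : List Y) →
    length s < 2 ^ k → Exhausts f c s xs ys → Solves f xs ys (2 * k + c) (exit-protocol a k s)
  exit-protocol-solves a f c k s xs ys short ex x y m n =
    let r₁ , b₁ = alice-sends-spec k (first-row s) (λ i → bob-sends k (first-column s) λ j → select a s (i ⊓ j)) x y
                    (≤-<-trans (first-row≤length s x) short)
        r₂ , b₂ = bob-sends-spec k (first-column s) (λ j → select a s (first-row s x ⊓ j)) x y
                    (≤-<-trans (first-column≤length s y) short)
        r₃ , b₃ = select-solves a f c s xs ys ex x y m n
    in trans r₁ (trans r₂ r₃) ,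
       ≤-trans (≤-reflexive (trans b₁ (cong (k +_) b₂))) (≤-trans (+-monoʳ-≤ k (+-monoʳ-≤ k b₃))
         (≤-reflexive (arrange k c)))
    where
    arrange : ∀ k c → k + (k + c) ≡ 2 * k + c
    arrange = solve-∀

  -- Only the side that is cut has to be large: the band runs across the whole other side, and the
  -- protocol solves all of it.
  Peel : (X → Y → A) → ℕ → ℕ → List X → List Y → Set
  Peel {X} {Y} {A} f c t xs ys = Σ (Protocol X Y A) λ π →
    (Σ (X → Bool) λ P → Solves f (filterᵇ P xs) ys c π × (length xs ≤ suc t * length (filterᵇ P xs))) ⊎
    (Σ (Y → Bool) λ Q → Solves f xs (filterᵇ Q ys) c π × (length ys ≤ suc t * length (filterᵇ Q ys)))

  remaining : (t : ℕ) (P : X → Bool) (xs : List X) → length xs ≤ suc t * length (filterᵇ P xs) →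
              suc t * length (filterᵇ (λ x → not (P x)) xs) ≤ t * length xs
  remaining t P xs h = +-cancelˡ-≤ (length xs) _ _ (≤-trans (+-monoˡ-≤
    (suc t * length (filterᵇ (λ x → not (P x)) xs)) h)
    (≤-reflexive (trans (sym (*-distribˡ-+ (suc t) (length (filterᵇ P xs)) _))
      (cong (suc t *_) (sym (length-split P xs))))))

  -- Every exit multiplies the remaining area by at most t / (t + 1). The hypothesis on `fuel` says
  -- that this brings the area below 1, so one side is empty by the time the fuel is spent.
  peel : (f : X → Y → A) (c t : ℕ) (Inv : List X → List Y → Set) →
    (∀ P xs ys → Inv xs ys → Inv (filterᵇ P xs) ys) → (∀ Q xs ys → Inv xs ys → Inv xs (filterᵇ Q ys)) →
    (∀ xs ys → Inv xs ys → 1 ≤ length xs → 1 ≤ length ys → Peel f c t xs ys) →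
    ∀ fuel xs ys → Inv xs ys → t ^ fuel * (length xs * length ys) < suc t ^ fuel →
    Σ (List (Exit X Y A)) λ s → (length s ≤ fuel) × Exhausts f c s xs ys
  peel f c t Inv invX invY step fuel []           ys inv h = [] , z≤n , λ _ _ ()
  peel f c t Inv invX invY step fuel xs@(_ ∷ _)   [] inv h = [] , z≤n , λ _ _ _ ()
  peel f c t Inv invX invY step zero xs@(_ ∷ _) ys@(_ ∷ _) inv (s≤s ())
  peel f c t Inv invX invY step (suc fuel) xs@(_ ∷ _) ys@(_ ∷ _) inv h with step xs ys inv (s≤s z≤n) (s≤s z≤n)
  ... | π , inj₁ (P , sol , big) =
    let s , len , ex = peel f c t Inv invX invY step fuel (filterᵇ (λ x → not (P x)) xs) ys
          (invX (λ x → not (P x)) xs ys inv)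
          (*-cancelˡ-< (suc t) _ _ (≤-<-trans (≤-trans (≤-reflexive (arrange (suc t) (t ^ fuel)
            (length (filterᵇ (λ x → not (P x)) xs)) (length ys)))
            (≤-trans (*-monoʳ-≤ (t ^ fuel) (*-monoˡ-≤ (length ys) (remaining t P xs big)))
              (≤-reflexive (collect (t ^ fuel) t (length xs) (length ys))))) h))
    in rows P π ∷ s , s≤s len , sol , ex
    where
    arrange : ∀ T p a b → T * (p * (a * b)) ≡ p * (T * a * b)
    arrange = solve-∀
    collect : ∀ p t a b → p * (t * a * b) ≡ t * p * (a * b)
    collect = solve-∀
  ... | π , inj₂ (Q , sol , big) =
    let s , len , ex = peel f c t Inv invX invY step fuel xs (filterᵇ (λ y → not (Q y)) ys)
          (invY (λ y → not (Q y)) xs ys inv)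
          (*-cancelˡ-< (suc t) _ _ (≤-<-trans (≤-trans (≤-reflexive (arrange (suc t) (t ^ fuel) (length xs)
            (length (filterᵇ (λ y → not (Q y)) ys))))
            (≤-trans (*-monoʳ-≤ (t ^ fuel) (*-monoʳ-≤ (length xs) (remaining t Q ys big)))
              (≤-reflexive (collect (t ^ fuel) t (length xs) (length ys))))) h))
    in columns Q π ∷ s , s≤s len , sol , ex
    where
    arrange : ∀ T p a b → T * (p * (a * b)) ≡ p * (a * (T * b))
    arrange = solve-∀
    collect : ∀ p t a b → p * (a * (t * b)) ≡ t * p * (a * b)
    collect = solve-∀

  -- By Bernoulli (1 + 1 / t)^(t + 1) ≥ 2, so that `suc t` exits halve the area.
  2t^≤ : ∀ t → 2 * t ^ suc t ≤ suc t ^ suc t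
  2t^≤ t = ≤-trans (≤-reflexive (cong (t ^ suc t +_) (+-identityʳ (t ^ suc t))))
    (≤-trans (+-monoʳ-≤ (t ^ suc t) (≤-trans (*-monoˡ-≤ (t ^ t) (n≤1+n t))
      (≤-reflexive (cong (suc t *_) (sym (*-identityˡ (t ^ t)))))))
      (bernoulli 1 t t))

  -- `N` blocks of `suc t` exits bring the area from 2^N down to 1, and one more block below 1.
  enough-fuel : ∀ t N area → area ≤ 2 ^ N → t ^ (suc t * suc N) * area < suc t ^ (suc t * suc N)
  enough-fuel t N area area≤ = below-half (m^n>0 (suc t) (suc t * suc N))
    (≤-trans (*-monoʳ-≤ 2 (*-monoʳ-≤ (t ^ (suc t * suc N)) area≤)) (≤-trans (≤-reflexive regroup) powers))
    where
    below-half : ∀ {z v} → 1 ≤ v → 2 * z ≤ v → z < v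
    below-half {zero}  1≤v h = 1≤v
    below-half {suc z} 1≤v h = <-≤-trans (m<m+n (suc z) {suc z + 0} (s≤s z≤n)) h
    regroup : 2 * (t ^ (suc t * suc N) * 2 ^ N) ≡ (2 * t ^ suc t) ^ suc N
    regroup = trans (arrange (t ^ (suc t * suc N)) (2 ^ N)) (trans (cong (2 ^ suc N *_)
      (sym (^-*-assoc t (suc t) (suc N))))
      (sym (^-distribʳ-* 2 (t ^ suc t) (suc N))))
      where
      arrange : ∀ p q → 2 * (p * q) ≡ 2 * q * p
      arrange = solve-∀
    powers : (2 * t ^ suc t) ^ suc N ≤ suc t ^ (suc t * suc N)
    powers = ≤-trans (^-monoˡ-≤ (suc N) (2t^≤ t)) (≤-reflexive (^-*-assoc (suc t) (suc t) (suc N)))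

-- Numerical parameters of the levels and the total cost.

module LevelParameters where
  open import Data.Product using (Σ; _×_; _,_)
  open import Data.Nat
  open import Data.Nat.Properties
  open import Data.Nat.Logarithm using (⌈log₂_⌉; ⌈log₂⌉-mono-≤; ⌈log₂2^n⌉≡n)
  open import Data.Nat.Tactic.RingSolver using (solve-∀)
  open import Relation.Nullary using (yes; no)
  open import Relation.Binary.PropositionalEquality hiding (J)

  n<2^n : ∀ n → n < 2 ^ n
  n<2^n zero    = s≤s z≤n
  n<2^n (suc n) = ≤-trans (+-mono-≤ (m^n>0 2 n) (n<2^n n)) (≤-reflexive (cong (2 ^ n +_) (sym (+-identityʳ (2 ^ n)))))

  -- At level j the rank is below 2^j.  The rectangle found has density 1 / suc t in rows and in columns, and
  -- K bits suffice to announce an exit.  G stands for 4096: as a literal it would make the powers below unfold.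
  Parameters : ℕ → ℕ → ℕ → Set
  Parameters G ℓ j = Σ ℕ λ c → Σ ℕ λ D → Σ ℕ λ t → Σ ℕ λ K →
    (D ≡ 1024 * c) × (1 ≤ c) × (8 * 2 ^ j ≤ c * c) × (4 * (D * (8 * 2 ^ ℓ) ^ D) ≡ suc t) ×
    (suc t * suc (2 * 2 ^ ℓ) < 2 ^ K) × (K ≤ 6 * (ℓ * (G * 2 ^ ⌈ j /2⌉)))

  -- All choices are powers of two, so logarithms are exact. With h = ⌈j / 2⌉, c = 4 · 2^h has c² ≥
  -- 16 · 2^j, and D = 1024 c = 2^(12 + h) makes the inverse density T = 2^a. The T (2 · 2^ℓ + 1)
  -- exits fit below 2^(a + ℓ + 2), an exponent dominated by (3 + ℓ) D, of order ℓ 2^h.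
  parameters : ∀ {G} → G ≡ 4096 → ∀ ℓ j → 1 ≤ ℓ → Parameters G ℓ j
  parameters {G} G≡ ℓ j 1≤ℓ = c , D , pred T , K , D≡ , *-mono-≤ {1} {4} (s≤s z≤n) 1≤2^h , 8·2^j≤ , sym sucT ,
    subst (λ T → T * suc (2 * 2 ^ ℓ) < 2 ^ K) (sym sucT) small , K≤
    where
    h = ⌈ j /2⌉
    1≤2^h : 1 ≤ 2 ^ h
    1≤2^h = m^n>0 2 h
    c = 4 * 2 ^ h
    D = G * 2 ^ h
    D≡ : D ≡ 1024 * c
    D≡ = trans (cong (_* 2 ^ h) G≡) (assoc (2 ^ h))
      where
      assoc : ∀ p → 4096 * p ≡ 1024 * (4 * p)
      assoc = solve-∀
    D≡2^ : D ≡ 2 ^ (12 + h)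
    D≡2^ = trans (cong (_* 2 ^ h) G≡) (sym (^-distribˡ-+-* 2 12 h))
    8·2^j≤ : 8 * 2 ^ j ≤ c * c
    8·2^j≤ = ≤-trans (*-monoˡ-≤ (2 ^ j) (m≤m+n 8 8)) (≤-trans (*-monoʳ-≤ 16
      (≤-trans (^-monoʳ-≤ 2 j≤h+h) (≤-reflexive (^-distribˡ-+-* 2 h h))))
      (≤-reflexive (arrange (2 ^ h))))
      where
      arrange : ∀ p → 16 * (p * p) ≡ 4 * p * (4 * p)
      arrange = solve-∀
      j≤h+h : j ≤ h + h
      j≤h+h = ≤-trans (≤-reflexive (sym (⌊n/2⌋+⌈n/2⌉≡n j))) (+-monoˡ-≤ h (⌊n/2⌋≤⌈n/2⌉ j))
    a = 2 + ((12 + h) + (3 + ℓ) * D)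
    T = 4 * (D * (8 * 2 ^ ℓ) ^ D)
    T≡ : T ≡ 2 ^ a
    T≡ = trans (cong (4 *_) (trans (cong₂ _*_ D≡2^ (trans (cong (_^ D) (sym (^-distribˡ-+-* 2 3 ℓ)))
      (^-*-assoc 2 (3 + ℓ) D)))
      (sym (^-distribˡ-+-* 2 (12 + h) ((3 + ℓ) * D))))) (sym (^-distribˡ-+-* 2 2 ((12 + h) + (3 + ℓ) * D)))
    sucT : suc (pred T) ≡ T
    sucT = suc-pred T {{>-nonZero (subst (1 ≤_) (sym T≡) (m^n>0 2 a))}}
    K = a + (ℓ + 2)
    small : T * suc (2 * 2 ^ ℓ) < 2 ^ K
    small = <-≤-trans (*-monoʳ-< T {{>-nonZero (subst (1 ≤_) (sym T≡) (m^n>0 2 a))}} (third (2 ^ ℓ) (m^n>0 2 ℓ)))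
      (≤-reflexive (trans (cong (_* (2 ^ ℓ * 4)) T≡) (trans (cong (2 ^ a *_) (sym (^-distribˡ-+-* 2 ℓ 2)))
        (sym (^-distribˡ-+-* 2 a (ℓ + 2))))))
      where
      third : ∀ p → 1 ≤ p → suc (2 * p) < p * 4
      third (suc p) _ = ≤-trans (m≤m+n _ (2 * p)) (≤-reflexive (expand p))
        where
        expand : ∀ p → 2 + 2 * (1 + p) + 2 * p ≡ (1 + p) * 4
        expand = solve-∀
    16+h≤D : 16 + h ≤ D
    16+h≤D = ≤-trans (+-mono-≤ (≤-trans (≤-reflexive (sym (*-identityʳ 16))) (*-monoʳ-≤ 16 1≤2^h)) (<⇒≤ (n<2^n h)))
      (≤-trans (≤-reflexive (expand (2 ^ h))) (*-monoˡ-≤ (2 ^ h) (subst (17 ≤_) (sym G≡) (m≤m+n 17 4079))))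
      where
      expand : ∀ p → 16 * p + p ≡ 17 * p
      expand = solve-∀
    1≤D : 1 ≤ D
    1≤D = ≤-trans (s≤s z≤n) 16+h≤D
    K≤ : K ≤ 6 * (ℓ * D)
    K≤ = ≤-trans (≤-reflexive (split h ℓ D)) (≤-trans (+-mono-≤ (+-mono-≤ (≤-trans 16+h≤D D≤ℓD) (*-monoʳ-≤ 3 D≤ℓD))
        (+-monoʳ-≤ (ℓ * D) ℓ≤ℓD)) (≤-reflexive (collect (ℓ * D))))
      where
      split : ∀ h ℓ D → 2 + ((12 + h) + (3 + ℓ) * D) + (ℓ + 2) ≡ (16 + h) + 3 * D + (ℓ * D + ℓ)
      split = solve-∀
      collect : ∀ z → z + 3 * z + (z + z) ≡ 6 * z
      collect = solve-∀
      D≤ℓD : D ≤ ℓ * D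
      D≤ℓD = ≤-trans (≤-reflexive (sym (*-identityˡ D))) (*-monoˡ-≤ D 1≤ℓ)
      ℓ≤ℓD : ℓ ≤ ℓ * D
      ℓ≤ℓD = ≤-trans (≤-reflexive (sym (*-identityʳ ℓ))) (*-monoʳ-≤ ℓ 1≤D)

  -- The 12 is twice the 6 in `Parameters`, as both players announce an exit; the 1 is the single
  -- bit at the bottom.
  cost : ℕ → ℕ → ℕ → ℕ
  cost G ℓ zero    = 1
  cost G ℓ (suc j) = 12 * (ℓ * (G * 2 ^ ⌈ suc j /2⌉)) + cost G ℓ j

  -- A geometric series taken two levels at a time: with p = 2^⌈j / 2⌉ each of the two adds at most
  -- 24 ℓ G p, together the growth from 48 ℓ G p to 48 ℓ G · 2p.
  cost-bound : ∀ G ℓ j → cost G ℓ j + 48 * (ℓ * G) ≤ 48 * (ℓ * G) * 2 ^ ⌈ j /2⌉ + 1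
  cost-bound G ℓ zero = ≤-reflexive (base (48 * (ℓ * G)))
    where
    base : ∀ z → 1 + z ≡ z * 1 + 1
    base = solve-∀
  cost-bound G ℓ (suc zero) = ≤-trans (m≤m+n _ (24 * (ℓ * G))) (≤-reflexive (base ℓ G))
    where
    base : ∀ ℓ G → 12 * (ℓ * (G * 2)) + 1 + 48 * (ℓ * G) + 24 * (ℓ * G) ≡ 48 * (ℓ * G) * 2 + 1
    base = solve-∀
  cost-bound G ℓ (suc (suc j)) = ≤-trans (≤-reflexive (assoc (12 * (ℓ * (G * 2 ^ ⌈ suc (suc j) /2⌉))) _ (cost G ℓ j)
    (48 * (ℓ * G))))
    (≤-trans (+-mono-≤ (+-monoʳ-≤ (12 * (ℓ * (G * 2 ^ ⌈ suc (suc j) /2⌉)))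
        (*-monoʳ-≤ 12 (*-monoʳ-≤ ℓ (*-monoʳ-≤ G (^-monoʳ-≤ 2 (⌈n/2⌉-mono (n≤1+n (suc j)))))))) (cost-bound G ℓ j))
      (≤-reflexive (collect ℓ G (2 ^ ⌈ j /2⌉))))
    where
    assoc : ∀ a b c d → a + (b + c) + d ≡ a + b + (c + d)
    assoc = solve-∀
    collect : ∀ ℓ G p → 12 * (ℓ * (G * (2 * p))) + 12 * (ℓ * (G * (2 * p))) + (48 * (ℓ * G) * p + 1) ≡
                        48 * (ℓ * G) * (2 * p) + 1
    collect = solve-∀

  bracket : ∀ r → 1 ≤ r → Σ ℕ λ k → (2 ^ k ≤ r) × (r < 2 ^ suc k)
  bracket (suc zero)    _ = 0 , ≤-refl , s≤s (s≤s z≤n)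
  bracket (suc (suc r)) _ with bracket (suc r) (s≤s z≤n)
  ... | k , lo , hi with suc (suc r) <? 2 ^ suc k
  ... | yes h = k , m≤n⇒m≤1+n lo , h
  ... | no h  = suc k , ≮⇒≥ h , ≤-<-trans hi (≤-trans (m<m+n (2 ^ suc k) (m^n>0 2 (suc k)))
                  (≤-reflexive (cong (2 ^ suc k +_) (sym (+-identityʳ (2 ^ suc k))))))

  <2^suc⌈log₂⌉ : ∀ r → 1 ≤ r → suc r ≤ 2 ^ suc ⌈log₂ r ⌉
  <2^suc⌈log₂⌉ r 1≤r = let k , lo , hi = bracket r 1≤r in
    ≤-trans hi (^-monoʳ-≤ 2 (s≤s (subst (_≤ ⌈log₂ r ⌉) (⌈log₂2^n⌉≡n k) (⌈log₂⌉-mono-≤ lo))))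

  2^⌈log₂⌉≤ : ∀ r → 1 ≤ r → 2 ^ ⌈log₂ r ⌉ ≤ 2 * r
  2^⌈log₂⌉≤ r 1≤r = let k , lo , hi = bracket r 1≤r in
    ≤-trans (^-monoʳ-≤ 2 (subst (⌈log₂ r ⌉ ≤_) (⌈log₂2^n⌉≡n (suc k)) (⌈log₂⌉-mono-≤ (<⇒≤ hi)))) (*-monoʳ-≤ 2 lo)

  -- 49 is 48 plus the bit at the bottom. The 8 comes from 2⌈ℓ / 2⌉ ≤ ℓ + 1 and 2^⌈log₂ r⌉ ≤ 2r,
  -- which bound p² by 8r.
  final-bound : ∀ G r → 1 ≤ G → 1 ≤ r → let ℓ = suc ⌈log₂ r ⌉ in
                ∀ b → b ≤ cost G ℓ ℓ → b ^ 2 ≤ 49 * G * (49 * G) * 8 * (r * (ℓ ^ 2))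
  final-bound G r 1≤G 1≤r b b≤ = ≤-trans (*-mono-≤ b≤′ (*-monoˡ-≤ 1 b≤′)) (≤-trans (≤-reflexive (arrange G ℓ p))
    (≤-trans (*-monoʳ-≤ (49 * G * (49 * G) * (ℓ * ℓ)) pp≤8r) (≤-reflexive (regroup G ℓ r))))
    where
    ℓ = suc ⌈log₂ r ⌉
    p = 2 ^ ⌈ ℓ /2⌉
    1≤p : 1 ≤ p
    1≤p = m^n>0 2 ⌈ ℓ /2⌉
    b≤′ : b ≤ 49 * (ℓ * G) * p
    b≤′ = ≤-trans b≤ (≤-trans (m≤m+n _ (48 * (ℓ * G))) (≤-trans (cost-bound G ℓ ℓ)
      (≤-trans (+-monoʳ-≤ (48 * (ℓ * G) * p) (*-mono-≤ {1} {ℓ * G} (*-mono-≤ {1} {ℓ} (s≤s z≤n) 1≤G) 1≤p))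
        (≤-reflexive (collect (ℓ * G) p)))))
      where
      collect : ∀ z p → 48 * z * p + z * p ≡ 49 * z * p
      collect = solve-∀
    arrange : ∀ G ℓ p → 49 * (ℓ * G) * p * (49 * (ℓ * G) * p * 1) ≡ 49 * G * (49 * G) * (ℓ * ℓ) * (p * p)
    arrange = solve-∀
    regroup : ∀ G ℓ r → 49 * G * (49 * G) * (ℓ * ℓ) * (8 * r) ≡ 49 * G * (49 * G) * 8 * (r * (ℓ * (ℓ * 1)))
    regroup = solve-∀
    pp≤8r : p * p ≤ 8 * r
    pp≤8r = ≤-trans (≤-reflexive (sym (^-distribˡ-+-* 2 ⌈ ℓ /2⌉ ⌈ ℓ /2⌉))) (≤-trans (^-monoʳ-≤ 2 twice)
      (≤-trans (*-monoʳ-≤ 2 (*-monoʳ-≤ 2 (2^⌈log₂⌉≤ r 1≤r))) (≤-reflexive (four r))))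
      where
      four : ∀ r → 2 * (2 * (2 * r)) ≡ 8 * r
      four = solve-∀
      twice : ⌈ ℓ /2⌉ + ⌈ ℓ /2⌉ ≤ suc ℓ
      twice = ≤-trans (+-monoʳ-≤ ⌈ ℓ /2⌉ (⌊n/2⌋-mono (n≤1+n (suc ℓ)))) (≤-reflexive (⌊n/2⌋+⌈n/2⌉≡n (suc ℓ)))

-- Halving the rank and assembling the protocol.

module RankProtocol where
  open import Data.Empty using (⊥; ⊥-elim)
  open import Data.Bool using (Bool; true; false; not; T)
  open import Data.Sum using (_⊎_; inj₁; inj₂)
  open import Data.Product using (Σ; _×_; _,_; proj₁; proj₂)
  open import Data.Fin using (Fin)
  open import Data.List using (List; []; _∷_; map; length; filterᵇ; _++_; allFin)
  open import Data.List.Properties using (length-map; length-++)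
  open import Data.List.Relation.Unary.Any using (here; there)
  open import Data.List.Membership.Propositional using (_∈_)
  open import Data.List.Membership.Propositional.Properties using (∈-++⁺ˡ; ∈-++⁺ʳ; ∈-allFin)
  open import Data.Nat
  open import Data.Nat.Properties
  open import Data.Nat.Logarithm using (⌈log₂_⌉)
  open import Data.Nat.Tactic.RingSolver using (solve-∀)
  open import Data.Sign as Sign using (Sign)
  open import Data.Rational as ℚ using (ℚ; 0ℚ; 1ℚ)
  import Data.Rational.Properties as ℚ
  open import Relation.Nullary using (yes; no)
  open import Relation.Binary.PropositionalEquality hiding (J)
  import Tactic.RingSolver as Ring
  open import Defs
  open Rationals using (ℚ-ring)
  open ListSums using (sum-map; sum-ext)
  open Factorisation
  open RowReduction
  open Counting
  open MonochromaticRectangles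
  open Protocols
  open LevelParameters

  private variable
    X Y : Set

  -- Rank up to a matrix with constant columns, the notion that is halved from level to level.
  AffineRank< : (X → Y → Sign) → ℕ → List X → List Y → Set
  AffineRank< {X} {Y} f d xs ys = Σ (Y → ℚ) λ α → Σ (Terms X Y) λ L → (length L < d) ×
    (∀ x y → x ∈ xs → y ∈ ys → signToℚ (f x y) ≡ α y ℚ.+ ⟦ L ⟧ x y)

  affine-rows : (f : X → Y → Sign) (d : ℕ) (P : X → Bool) → ∀ xs ys →
                AffineRank< f d xs ys → AffineRank< f d (filterᵇ P xs) ys
  affine-rows f d P xs ys (α , L , len , eval) = α , L , len , λ x y m n → eval x y (proj₁ (∈-filterᵇ⁻ P xs m)) n

  affine-columns : (f : X → Y → Sign) (d : ℕ) (Q : Y → Bool) → ∀ xs ys →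
                   AffineRank< f d xs ys → AffineRank< f d xs (filterᵇ Q ys)
  affine-columns f d Q xs ys (α , L , len , eval) = α , L , len , λ x y m n → eval x y m (proj₁ (∈-filterᵇ⁻ Q ys n))

  first-filtered : (P : X → Bool) (xs : List X) (t : ℕ) → 1 ≤ length xs → length xs ≤ t * length (filterᵇ P xs) →
                   Σ X (_∈ filterᵇ P xs)
  first-filtered P xs t 1≤ h with filterᵇ P xs
  ... | []     = ⊥-elim (<⇒≱ (≤-trans 1≤ h) (≤-reflexive (*-zeroʳ t)))
  ... | x ∷ _  = x , here refl

  -- Row `x₀` of `f` is absorbed into the part with constant columns, so subtracting it does not
  -- lengthen `L`. The rest vanishes on the rectangle, where `f` equals its row `x₀`; by
  -- `split-rank` the lengths for the two bands add up to less than 2d.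
  halve-affine-rank : (f : X → Y → Sign) (d : ℕ) (P : X → Bool) (Q : Y → Bool) → ∀ xs ys σ →
    (∀ x y → x ∈ filterᵇ P xs → y ∈ filterᵇ Q ys → f x y ≡ σ) → Σ X (_∈ filterᵇ P xs) →
    AffineRank< f (2 * d) xs ys → AffineRank< f d (filterᵇ P xs) ys ⊎ AffineRank< f d xs (filterᵇ Q ys)
  halve-affine-rank {X} {Y} f d P Q xs ys σ mono (x₀ , m₀) (α , L , len , eval) = choose (d ≤? length A)
    where
    α′ : Y → ℚ
    α′ y = α y ℚ.+ ⟦ L ⟧ x₀ y
    L₀ : Terms X Y
    L₀ = eliminate (λ _ → 1ℚ) (λ p → p x₀) L
    sub : ∀ {x} → x ∈ filterᵇ P xs → x ∈ xs
    sub m = proj₁ (∈-filterᵇ⁻ P xs m)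
    sub′ : ∀ {y} → y ∈ filterᵇ Q ys → y ∈ ys
    sub′ m = proj₁ (∈-filterᵇ⁻ Q ys m)
    eval₀ : ∀ x y → x ∈ xs → y ∈ ys → signToℚ (f x y) ≡ α′ y ℚ.+ ⟦ L₀ ⟧ x y
    eval₀ x y m n = trans (eval x y m n) (sym (trans (cong (α′ y ℚ.+_) (eliminate-eval (λ _ → 1ℚ) (λ p → p x₀) L x y))
      (arrange (α y) (⟦ L ⟧ x₀ y) (⟦ L ⟧ x y))))
      where
      arrange : ∀ a b c → a ℚ.+ b ℚ.+ (c ℚ.- 1ℚ ℚ.* b) ≡ a ℚ.+ c
      arrange = Ring.solve-∀ ℚ-ring
    vanish : ∀ x y → x ∈ filterᵇ P xs → y ∈ filterᵇ Q ys → ⟦ L₀ ⟧ x y ≡ 0ℚ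
    vanish x y m n = trans (isolate (α′ y) (⟦ L₀ ⟧ x y)) (trans
      (cong₂ ℚ._-_ (trans (sym (eval₀ x y (sub m) (sub′ n))) (cong signToℚ (mono x y m n)))
                   (trans (sym (eval x₀ y (sub m₀) (sub′ n))) (cong signToℚ (mono x₀ y m₀ n))))
      (ℚ.+-inverseʳ (signToℚ σ)))
      where
      isolate : ∀ a b → b ≡ (a ℚ.+ b) ℚ.- a
      isolate = Ring.solve-∀ ℚ-ring
    parts = split-rank (length L) L₀ (length-map _ L) (filterᵇ P xs) (filterᵇ Q ys) vanish
    A = proj₁ parts
    B = proj₁ (proj₂ parts)
    A+B≤L : length A + length B ≤ length L
    A+B≤L = proj₁ (proj₂ (proj₂ parts))
    choose : _ → AffineRank< f d (filterᵇ P xs) ys ⊎ AffineRank< f d xs (filterᵇ Q ys)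
    choose (no d≰A) = inj₁ (α′ , A , ≰⇒> d≰A , λ x y m n →
      trans (eval₀ x y (sub m) n) (cong (α′ y ℚ.+_) (proj₁ (proj₂ (proj₂ (proj₂ parts))) x y m)))
    choose (yes d≤A) = inj₂ (α′ , B , +-cancelˡ-< d (length B) d (≤-<-trans (+-monoˡ-≤ (length B) d≤A)
        (≤-<-trans A+B≤L (<-≤-trans len (≤-reflexive (cong (d +_) (+-identityʳ d)))))) , λ x y m n →
      trans (eval₀ x y m (sub′ n)) (cong (α′ y ℚ.+_) (proj₂ (proj₂ (proj₂ (proj₂ parts))) x y n)))

  affine⇒represents : (f : X → Y → Sign) (xs : List X) (ys : List Y) (α : Y → ℚ) (L : Terms X Y) →
    (∀ x y → x ∈ xs → y ∈ ys → signToℚ (f x y) ≡ α y ℚ.+ ⟦ L ⟧ x y) → Represents f (((λ _ → 1ℚ) , α) ∷ L) xs ys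
  affine⇒represents f xs ys α L eval x y m n = trans (eval x y m n) (cong (ℚ._+ ⟦ L ⟧ x y) (sym (ℚ.*-identityˡ (α y))))

  sign-positive : Sign → Bool
  sign-positive Sign.+ = true
  sign-positive Sign.- = false

  sign-positive-injective : ∀ σ τ → sign-positive σ ≡ sign-positive τ → σ ≡ τ
  sign-positive-injective Sign.+ Sign.+ _ = refl
  sign-positive-injective Sign.- Sign.- _ = refl

  -- With no term left, `f` depends on the column alone, and Bob evaluates it in row `x₀`.
  column-protocol : (f : X → Y → Sign) (xs : List X) (ys : List Y) → AffineRank< f 1 xs ys →
                    Σ (Protocol X Y Sign) (Solves f xs ys 1)
  column-protocol f []       ys _ = leaf Sign.+ , λ _ _ ()
  column-protocol {X} {Y} f (x₀ ∷ xs) ys (α , [] , _ , eval) = bob is-plus (leaf Sign.+) (leaf Sign.-) , correct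
    where
    is-plus : Y → Bool
    is-plus y = sign-positive (f x₀ y)
    constant : ∀ x y → x ∈ x₀ ∷ xs → y ∈ ys → f x y ≡ f x₀ y
    constant x y m n = signToℚ-injective (f x y) (f x₀ y) (trans (eval x y m n) (sym (eval x₀ y (here refl) n)))
    correct : Solves f (x₀ ∷ xs) ys 1 (bob is-plus (leaf Sign.+) (leaf Sign.-))
    correct x y m n with f x₀ y in eq
    ... | Sign.+ = sym (trans (constant x y m n) eq) , ≤-refl
    ... | Sign.- = sym (trans (constant x y m n) eq) , ≤-refl
  column-protocol f (x₀ ∷ xs) ys (α , _ ∷ _ , s≤s () , eval)

  -- Every band that is peeled off has half the affine rank, so the level below solves it within the
  -- same cost, however many bands there are. The area bound stays that of the top level.
  protocol-at-level : ∀ {m n} (f : Fin m → Fin n → Sign) {G} → G ≡ 4096 → ∀ ℓ j → 1 ≤ ℓ → j ≤ ℓ → ∀ xs ys →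
    AffineRank< f (2 ^ j) xs ys → length xs * length ys ≤ 2 ^ (2 * 2 ^ ℓ) →
    Σ (Protocol (Fin m) (Fin n) Sign) (Solves f xs ys (cost G ℓ j))
  protocol-at-level f G≡ ℓ zero 1≤ℓ j≤ℓ xs ys aff area = column-protocol f xs ys aff
  protocol-at-level {m} {n} f {G} G≡ ℓ (suc j) 1≤ℓ j<ℓ xs ys aff area = use (parameters G≡ ℓ (suc j) 1≤ℓ)
    where
    use : Parameters G ℓ (suc j) → Σ (Protocol (Fin m) (Fin n) Sign) (Solves f xs ys (cost G ℓ (suc j)))
    use (c , D , t , K , D≡ , 1≤c , 8≤cc , T≡ , short , K≤) =
      exit-protocol Sign.+ K s , λ x y m n →
        let r , b = exit-protocol-solves Sign.+ f (cost G ℓ j) K s xs ys (≤-<-trans len short) ex x y m n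
        in r , ≤-trans b (+-monoˡ-≤ (cost G ℓ j) (≤-trans (*-monoʳ-≤ 2 K≤)
          (≤-reflexive (twelve (ℓ * (G * 2 ^ ⌈ suc j /2⌉))))))
      where
      twelve : ∀ z → 2 * (6 * z) ≡ 12 * z
      twelve = solve-∀
      Inv : List (Fin m) → List (Fin n) → Set
      Inv xs ys = AffineRank< f (2 ^ suc j) xs ys × (length xs * length ys ≤ 2 ^ (2 * 2 ^ ℓ))
      step : ∀ xs ys → Inv xs ys → 1 ≤ length xs → 1 ≤ length ys → Peel f (cost G ℓ j) t xs ys
      step xs ys (aff@(α , L , L< , eval) , area) 1≤xs 1≤ys =
        continue (halve-affine-rank f (2 ^ j) P Q xs ys σ mono (first-filtered P xs (suc t) 1≤xs big-rows) aff)
        where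
        -- The part with constant columns is one more term, for which the strict bound on `L` makes
        -- room. The proportion aimed at is governed by 2^ℓ on all levels, since only its logarithm
        -- enters the cost.
        L⁺ = ((λ _ → 1ℚ) , α) ∷ L
        big = large-monochromatic f L⁺ xs ys (affine⇒represents f xs ys α L eval) c D (2 ^ ℓ) D≡ 1≤c
                (≤-trans (*-monoʳ-≤ 8 L<) 8≤cc) (m^n>0 2 ℓ) (≤-trans L< (^-monoʳ-≤ 2 j<ℓ)) 1≤xs 1≤ys
        σ = proj₁ big
        P = proj₁ (proj₂ big)
        Q = proj₁ (proj₂ (proj₂ big))
        mono = proj₁ (proj₂ (proj₂ (proj₂ big)))
        big-rows : length xs ≤ suc t * length (filterᵇ P xs)
        big-rows = subst (λ T → length xs ≤ T * length (filterᵇ P xs)) T≡ (proj₁ (proj₂ (proj₂ (proj₂ (proj₂ big)))))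
        big-columns : length ys ≤ suc t * length (filterᵇ Q ys)
        big-columns = subst (λ T → length ys ≤ T * length (filterᵇ Q ys)) T≡ (proj₂ (proj₂ (proj₂ (proj₂ (proj₂ big)))))
        continue : AffineRank< f (2 ^ j) (filterᵇ P xs) ys ⊎ AffineRank< f (2 ^ j) xs (filterᵇ Q ys) → Peel f
          (cost G ℓ j) t xs ys
        continue (inj₁ aff′) =
          let π , sol = protocol-at-level f G≡ ℓ j 1≤ℓ (<⇒≤ j<ℓ) (filterᵇ P xs) ys aff′
                          (≤-trans (*-monoˡ-≤ (length ys) (length-filterᵇ-≤ P xs)) area)
          in π , inj₁ (P , sol , big-rows)
        continue (inj₂ aff′) =
          let π , sol = protocol-at-level f G≡ ℓ j 1≤ℓ (<⇒≤ j<ℓ) xs (filterᵇ Q ys) aff′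
                          (≤-trans (*-monoʳ-≤ (length xs) (length-filterᵇ-≤ Q ys)) area)
          in π , inj₂ (Q , sol , big-columns)
      peeled = peel f (cost G ℓ j) t Inv
        (λ P xs ys (aff , area) → affine-rows f (2 ^ suc j) P xs ys aff ,
          ≤-trans (*-monoˡ-≤ (length ys) (length-filterᵇ-≤ P xs)) area)
        (λ Q xs ys (aff , area) → affine-columns f (2 ^ suc j) Q xs ys aff ,
          ≤-trans (*-monoʳ-≤ (length xs) (length-filterᵇ-≤ Q ys)) area)
        step (suc t * suc (2 * 2 ^ ℓ)) xs ys (aff , area) (enough-fuel t (2 * 2 ^ ℓ) (length xs * length ys) area)
      s = proj₁ peeled
      len = proj₁ (proj₂ peeled)
      ex = proj₂ (proj₂ peeled)

  -- Splitting by the sign at each `t` in turn leaves at most one class per sign pattern, and its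
  -- first member represents it.
  representatives : (f : X → Y → Sign) (ts : List Y) (xs : List X) →
    Σ (List X) λ xs′ → (length xs′ ≤ 2 ^ length ts) ×
    (∀ x → x ∈ xs → Σ X λ x′ → (x′ ∈ xs′) × (x′ ∈ xs) × (∀ t → t ∈ ts → f x t ≡ f x′ t))
  representatives f []       []       = [] , z≤n , λ _ ()
  representatives f []       (x ∷ xs) = x ∷ [] , ≤-refl , λ _ _ → x , here refl , here refl , λ _ ()
  representatives {X} {Y} f (t ∷ ts) xs = xs⁺ ++ xs⁻ ,
    ≤-trans (≤-reflexive (length-++ xs⁺))
      (+-mono-≤ (proj₁ (proj₂ rec⁺)) (≤-trans (proj₁ (proj₂ rec⁻)) (≤-reflexive (sym (+-identityʳ _))))) ,
    λ x m → represent x m (P x) refl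
    where
    P P⁻ : X → Bool
    P x = sign-positive (f x t)
    P⁻ x = not (P x)
    rec⁺ = representatives f ts (filterᵇ P xs)
    rec⁻ = representatives f ts (filterᵇ P⁻ xs)
    xs⁺ = proj₁ rec⁺
    xs⁻ = proj₁ rec⁻
    not-injective : ∀ b c → not b ≡ not c → b ≡ c
    not-injective true  true  _ = refl
    not-injective false false _ = refl
    represent : ∀ x → x ∈ xs → (b : Bool) → P x ≡ b →
                Σ X λ x′ → (x′ ∈ xs⁺ ++ xs⁻) × (x′ ∈ xs) × (∀ s → s ∈ t ∷ ts → f x s ≡ f x′ s)
    represent x m true e =
      let x′ , m′ , n′ , agree = proj₂ (proj₂ rec⁺) x (∈-filterᵇ⁺ P xs m e)
          n , e′ = ∈-filterᵇ⁻ P xs n′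
      in x′ , ∈-++⁺ˡ m′ , n , λ { _ (here refl) → sign-positive-injective _ _ (trans e (sym e′)) ; s (there p) →
        agree s p }
    represent x m false e =
      let x′ , m′ , n′ , agree = proj₂ (proj₂ rec⁻) x (∈-filterᵇ⁺ P⁻ xs m (cong not e))
          n , e′ = ∈-filterᵇ⁻ P⁻ xs n′
      in x′ , ∈-++⁺ʳ xs⁺ m′ , n ,
         λ { _ (here refl) → sign-positive-injective _ _ (not-injective _ _ (trans (cong not e) (sym e′))) ; s
           (there p) → agree s p }

  transpose : Terms X Y → Terms Y X
  transpose = map (λ t → proj₂ t , proj₁ t)

  transpose-eval : (L : Terms X Y) → ∀ x y → ⟦ transpose L ⟧ y x ≡ ⟦ L ⟧ x y
  transpose-eval L x y = trans (sum-map _ L _) (sum-ext L (λ t → ℚ.*-comm (proj₂ t y) (proj₁ t x)))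

  -- At most `length L` columns determine all of them, so a row is known from its signs there. This
  -- frees the number of exits from m and n.
  few-rows : ∀ {m n} (f : Fin m → Fin n → Sign) (L : Terms (Fin m) (Fin n)) → (∀ x y → signToℚ (f x y) ≡ ⟦ L ⟧ x y) →
    Σ (List (Fin m)) λ xs → (length xs ≤ 2 ^ length L) ×
    (∀ x → Σ (Fin m) λ x′ → (x′ ∈ xs) × (∀ y → f x y ≡ f x′ y))
  few-rows {m} {n} f L eval =
    proj₁ reps , ≤-trans (proj₁ (proj₂ reps)) (^-monoʳ-≤ 2 (proj₁ (proj₂ det))) , λ x →
      let x′ , m′ , _ , agree = proj₂ (proj₂ reps) x (∈-allFin x)
      in x′ , m′ , λ y → signToℚ-injective _ _ (trans (value x y) (trans
           (proj₂ (proj₂ (proj₂ det)) x x′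
             (λ t p → trans (sym (value x t)) (trans (cong signToℚ (agree t p)) (value x′ t))) y (∈-allFin y))
           (sym (value x′ y))))
    where
    value : ∀ x y → signToℚ (f x y) ≡ ⟦ transpose L ⟧ y x
    value x y = trans (eval x y) (sym (transpose-eval L x y))
    det = determining-rows (length L) (transpose L) (length-map _ L) (allFin n)
    reps = representatives f (proj₁ det) (allFin m)

  -- Each player first replaces the input by the representative of its row or column, at no cost in
  -- bits. The `suc` in ℓ makes the rank strictly smaller than 2^ℓ.
  rank-protocol : ∀ {m n} (f : Fin m → Fin n → Sign) (r : ℕ) → 1 ≤ r → (L : Terms (Fin m) (Fin n)) → length L ≤ r →
    (∀ x y → signToℚ (f x y) ≡ ⟦ L ⟧ x y) → ∀ {G} → G ≡ 4096 → let ℓ = suc ⌈log₂ r ⌉ in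
    Σ (Protocol (Fin m) (Fin n) Sign) λ π → ∀ x y → (run π x y ≡ f x y) × (bits π x y ≤ cost G ℓ ℓ)
  rank-protocol {m} {n} f r 1≤r L L≤r eval {G} G≡ =
    relabel φ ψ (proj₁ solved) , λ x y →
      let r , b = proj₂ solved (φ x) (ψ y) (proj₁ (proj₂ (proj₂ (proj₂ Rows) x))) (proj₁ (proj₂ (proj₂ (proj₂ Cols) y)))
      in trans (relabel-run φ ψ (proj₁ solved) x y) (trans r (sym (trans (proj₂ (proj₂ (proj₂ (proj₂ Rows) x)) y)
           (proj₂ (proj₂ (proj₂ (proj₂ Cols) y)) (φ x))))) ,
         ≤-trans (≤-reflexive (relabel-bits φ ψ (proj₁ solved) x y)) b
    where
    ℓ = suc ⌈log₂ r ⌉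
    N = 2 ^ ℓ
    L<N : length L < N
    L<N = ≤-trans (s≤s L≤r) (<2^suc⌈log₂⌉ r 1≤r)
    Rows = few-rows f L eval
    Cols = few-rows (λ y x → f x y) (transpose L) (λ y x → trans (eval x y) (sym (transpose-eval L x y)))
    φ : Fin m → Fin m
    φ x = proj₁ (proj₂ (proj₂ Rows) x)
    ψ : Fin n → Fin n
    ψ y = proj₁ (proj₂ (proj₂ Cols) y)
    area : length (proj₁ Rows) * length (proj₁ Cols) ≤ 2 ^ (2 * N)
    area = ≤-trans (*-mono-≤ (≤-trans (proj₁ (proj₂ Rows)) (^-monoʳ-≤ 2 (<⇒≤ L<N)))
        (≤-trans (proj₁ (proj₂ Cols)) (^-monoʳ-≤ 2 (≤-trans (≤-reflexive (length-map _ L)) (<⇒≤ L<N)))))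
      (≤-reflexive (trans (sym (^-distribˡ-+-* 2 N N)) (cong (λ z → 2 ^ (N + z)) (sym (+-identityʳ N)))))
    solved = protocol-at-level f G≡ ℓ ℓ (s≤s z≤n) ≤-refl (proj₁ Rows) (proj₁ Cols)
      ((λ _ → 0ℚ) , L , L<N , λ x y _ _ → trans (eval x y) (sym (ℚ.+-identityˡ (⟦ L ⟧ x y)))) area

  low-rank-protocol : ∀ {G} → G ≡ 4096 → (m n : ℕ) (f : Fin m → Fin n → Sign) (r : ℕ) → HasRank (matrixOf f) r →
    Σ (Protocol (Fin m) (Fin n) Sign) λ P → ((x : Fin m) (y : Fin n) → run P x y ≡ f x y) ×
    ((x : Fin m) (y : Fin n) → bits P x y ^ 2 ≤ 49 * G * (49 * G) * 8 * (r * (suc ⌈log₂ r ⌉ ^ 2)))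
  -- Entries 1 and -1 exclude rank zero unless there is no pair of inputs at all, so silence is
  -- correct.
  low-rank-protocol {G} G≡ m n f zero h = leaf Sign.+ , (λ x y → ⊥-elim (empty x y)) , λ x y → z≤n
    where
    empty : Fin m → Fin n → ⊥
    empty x y with HasRank⇒Terms (matrixOf f) h
    ... | [] , _ , eval = nonzero (f x y) (eval x y)
      where
      nonzero : ∀ σ → signToℚ σ ≢ 0ℚ
      nonzero Sign.+ ()
      nonzero Sign.- ()
  low-rank-protocol {G} G≡ m n f (suc r) h =
    let L , L≤ , eval = HasRank⇒Terms (matrixOf f) h
        π , spec = rank-protocol f (suc r) (s≤s z≤n) L L≤ eval G≡
    in π , (λ x y → proj₁ (spec x y)) ,
       λ x y → final-bound G (suc r) (subst (1 ≤_) (sym G≡) (s≤s z≤n)) (s≤s z≤n) (bits π x y) (proj₂ (spec x y))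

open import Defs
open import Data.Nat using (ℕ; suc; _*_; _^_; _≤_)
open import Data.Nat.Logarithm using (⌈log₂_⌉)
open import Data.Fin using (Fin)
open import Data.Sign using (Sign)
open import Data.Product using (Σ; _×_; _,_)
open import Relation.Binary.PropositionalEquality using (_≡_; refl)

theorem1 : Σ ℕ λ C →
    (m n : ℕ) (f : Fin m → Fin n → Sign) (r : ℕ) →
    HasRank (matrixOf f) r →
    Σ (Protocol (Fin m) (Fin n) Sign) λ P →
    ((x : Fin m) (y : Fin n) → run P x y ≡ f x y) ×
    ((x : Fin m) (y : Fin n) → bits P x y ^ 2 ≤ C * (r * (suc ⌈log₂ r ⌉ ^ 2)))
theorem1 = 49 * 4096 * (49 * 4096) * 8 , RankProtocol.low-rank-protocol refl
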